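{- Let $m$ and $n$ be positive integers. Then, modulo $\Phi_n(q)^2$, \[ \tau_0(mn,(m-1)n,q)\equiv 2m-nm(2m-1)(1-q^n)+(-1)^nq^{n(n+1)/2}\left(m\bigl(\mathcal{A}_n(q)+\mathcal{B}_n(q)-1\bigr)-\frac{3nm(m-1)}{2}(1-q^n)\right). \]
   Context: For integers $n,k$ the $q$-binomial coefficient is ${n\brack k}={n\brack k}_q=\frac{(1-q^n)(1-q^{n-1})\cdots(1-q^{n-k+1})}{(1-q)(1-q^2)\cdots(1-q^k)}$ if $0\le k\le n$, and $0$ otherwise; ${n\brack k}_{q^2}$ denotes the same with $q$ replaced by $q^2$. The $q$-trinomial coefficient of Andrews and Baxter is \[ \tau_0(N,M,q)=\sum_{k=0}^{N}(-1)^kq^{Nk-\binom{k}{2}}{N\brack k}{2N-2k\brack N-M-k}. \] $\Phi_n(q)$ is the $n$th cyclotomic polynomial. For rational functions $A(q),B(q)$ and a polynomial $P(q)\in\mathbb{Z}[q]$, $A(q)\equiv B(q)\pmod{P(q)}$ means that $A(q)-B(q)$, written as a quotient $A_1(q)/A_2(q)$, has numerator $A_1(q)$ divisible by $P(q)$ and denominator $A_2(q)$ coprime to $P(q)$. Define, for a positive integer $n$, \[ \mathcal{A}_n(q)=\begin{cases}(-1)^r(1+q^r)q^{r(3r-1)/2}, & n=3r,\\ (-1)^rq^{r(3r+1)/2}, & n=3r+1,\\ (-1)^{r+1}q^{(r+1)(3r+2)/2}, & n=3r+2,\end{cases} \qquad \mathcal{B}_n(q)=\begin{cases}(-1)^r(1+q^{2r})q^{r(3r-5)/2},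 & n=3r,\\ (-1)^rq^{r(3r+1)/2}, & n=3r+1,\\ (-1)^{r+1}q^{(r-1)(3r+2)/2}, & n=3r+2.\end{cases} \] -}

module Defs where

open import Data.Nat as ℕ using (ℕ; zero; suc; _∸_; _<?_; _≤?_)
import Data.Nat.DivMod as ℕD
open import Data.Nat.Divisibility using (_∣?_)
open import Data.Integer as ℤ using (ℤ; +_; -[1+_]; _+_; _*_; -_; 0ℤ; 1ℤ)
open import Data.Integer.DivMod using (_/ℕ_)
open import Data.List using (List; []; _∷_; _++_; replicate; length; map; foldr; upTo)
open import Data.Product using (Σ; _×_; _,_)
open import Relation.Nullary using (yes; no)
open import Relation.Binary.PropositionalEquality using (_≡_)

-- Polynomials in ℤ[q], as little-endian coefficient lists
-- (entry i is the coefficient of q^i; trailing zeros allowed).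

Poly : Set
Poly = List ℤ

infixl 6 _⊕_ _⊖_
infixl 7 _⊗_

_⊕_ : Poly → Poly → Poly
[] ⊕ p = p
(a ∷ p) ⊕ [] = a ∷ p
(a ∷ p) ⊕ (b ∷ r) = (a + b) ∷ (p ⊕ r)

negP : Poly → Poly
negP = map -_

_⊖_ : Poly → Poly → Poly
p ⊖ r = p ⊕ negP r

scale : ℤ → Poly → Poly
scale c = map (c *_)

_⊗_ : Poly → Poly → Poly
[] ⊗ r = []
(a ∷ p) ⊗ r = scale a r ⊕ (0ℤ ∷ (p ⊗ r))

cst : ℤ → Poly
cst c = c ∷ []

X^ : ℕ → Poly
X^ k = replicate k 0ℤ ++ (1ℤ ∷ [])

shiftP : ℕ → Poly → Poly
shiftP k p = replicate k 0ℤ ++ p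

prodP : List Poly → Poly
prodP = foldr _⊗_ (cst 1ℤ)

sumP : List Poly → Poly
sumP = foldr _⊕_ []

coeff : Poly → ℕ → ℤ
coeff [] i = 0ℤ
coeff (a ∷ p) zero = a
coeff (a ∷ p) (suc i) = coeff p i

infix 4 _≈_
_≈_ : Poly → Poly → Set
p ≈ r = ∀ i → coeff p i ≡ coeff r i

infix 4 _∣ₚ_
_∣ₚ_ : Poly → Poly → Set
P ∣ₚ D = Σ Poly (λ C → C ⊗ P ≈ D)

-- Exact division by a monic polynomial (long division; returns the
-- quotient).  Used only where the division is exact.

private
  cons0 : ℤ → Poly → Poly
  cons0 (+ zero) [] = []
  cons0 a [] = a ∷ []
  cons0 a (b ∷ r) = a ∷ b ∷ r

  strip : Poly → Poly
  strip [] = []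
  strip (a ∷ p) = cons0 a (strip p)

  lead : Poly → ℤ
  lead [] = 0ℤ
  lead (a ∷ []) = a
  lead (a ∷ b ∷ p) = lead (b ∷ p)

  divStep : ℕ → Poly → Poly → Poly
  divStep zero p d = []
  divStep (suc f) p d with strip p
  ... | p' with length p' <? length d
  ... | yes _ = []
  ... | no _ = t ⊕ divStep f (p' ⊖ t ⊗ d) d
    where t = shiftP (length p' ∸ length d) (cst (lead p'))

divMonic : Poly → Poly → Poly
divMonic p d = divStep (suc (length p)) p (strip d)

-- q-binomial coefficients:
--   [n, k] = (1-q^n)...(1-q^{n-k+1}) / (1-q)...(1-q^k)   (0 ≤ k ≤ n)
--          = (q^n-1)...(q^{n-k+1}-1) / (q-1)...(q^k-1)  (same number of sign flips)
-- and 0 otherwise (arguments are integers).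

qbinomℕ : ℕ → ℕ → Poly
qbinomℕ n k with k ≤? n
... | no _ = []
... | yes _ = divMonic (prodP (map (λ j → X^ (n ∸ j) ⊖ cst 1ℤ) (upTo k)))
                       (prodP (map (λ i → X^ (suc i) ⊖ cst 1ℤ) (upTo k)))

qbinom : ℤ → ℤ → Poly
qbinom (+ n) (+ k) = qbinomℕ n k
qbinom _ _ = []

sgn : ℕ → ℤ
sgn zero = 1ℤ
sgn (suc k) = - sgn k

τ₀ : ℕ → ℕ → Poly
τ₀ N M = sumP (map term (upTo (suc N)))
  where
  term : ℕ → Poly
  term k = scale (sgn k)
             (shiftP (N ℕ.* k ∸ (k ℕ.* (k ∸ 1)) ℕD./ 2)
               (qbinom (+ N) (+ k) ⊗
                qbinom (+ (2 ℕ.* N ∸ 2 ℕ.* k)) (+ N - + M - + k)))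
    where open import Data.Integer using (_-_)

-- Cyclotomic polynomials, via q^n - 1 = ∏_{d ∣ n} Φ_d (recursively,
-- Φ_n = (q^n - 1) / ∏_{d ∣ n, d < n} Φ_d).

cycTable : ℕ → ℕ → Poly
cycTable zero d = cst 1ℤ
cycTable (suc n) d with d ℕ.≟ suc n
... | no _ = cycTable n d
... | yes _ = divMonic (X^ (suc n) ⊖ cst 1ℤ)
                       (prodP (map pick (upTo (suc n))))
  where
  pick : ℕ → Poly
  pick zero = cst 1ℤ
  pick (suc e) with suc e ∣? suc n
  ... | yes _ = cycTable n (suc e)
  ... | no _ = cst 1ℤ

Φ : ℕ → Poly
Φ n = cycTable n n

-- Laurent polynomials q^{-s} · p, represented as (s , p).

LPoly : Set
LPoly = ℕ × Poly

lift : Poly → LPoly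
lift p = (0 , p)

infixl 6 _⊕ᴸ_ _⊖ᴸ_
infixl 7 _⊗ᴸ_

_⊕ᴸ_ : LPoly → LPoly → LPoly
(s , a) ⊕ᴸ (t , b) = (s ℕ.+ t , shiftP t a ⊕ shiftP s b)

_⊗ᴸ_ : LPoly → LPoly → LPoly
(s , a) ⊗ᴸ (t , b) = (s ℕ.+ t , a ⊗ b)

_⊖ᴸ_ : LPoly → LPoly → LPoly
(s , a) ⊖ᴸ (t , b) = (s , a) ⊕ᴸ (t , negP b)

cstᴸ : ℤ → LPoly
cstᴸ c = lift (cst c)

monoᴸ : ℤ → LPoly
monoᴸ (+ k) = lift (X^ k)
monoᴸ -[1+ k ] = (suc k , cst 1ℤ)

-- Congruence modulo a polynomial P:  q^{-s} a ≡ q^{-t} b (mod P)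
-- iff P divides the numerator q^t a - q^s b of the difference
-- (whose denominator is a power of q).
infix 4 _≡_[modₚ_]
_≡_[modₚ_] : LPoly → LPoly → Poly → Set
(s , a) ≡ (t , b) [modₚ P ] = P ∣ₚ (shiftP t a ⊖ shiftP s b)

half : ℤ → ℤ
half z = z /ℕ 2

𝒜 : ℕ → LPoly
𝒜 n with n ℕD.% 3
... | 0 = cstᴸ (sgn r) ⊗ᴸ (cstᴸ 1ℤ ⊕ᴸ monoᴸ (+ r))
           ⊗ᴸ monoᴸ (half (+ r * (+ (3 ℕ.* r) - 1ℤ)))
  where r = n ℕD./ 3
        open import Data.Integer using (_-_)
... | 1 = cstᴸ (sgn r) ⊗ᴸ monoᴸ (half (+ r * (+ (3 ℕ.* r) + 1ℤ)))
  where r = n ℕD./ 3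
... | _ = cstᴸ (- sgn r) ⊗ᴸ monoᴸ (half ((+ r + 1ℤ) * (+ (3 ℕ.* r) + + 2)))
  where r = n ℕD./ 3

ℬ : ℕ → LPoly
ℬ n with n ℕD.% 3
... | 0 = cstᴸ (sgn r) ⊗ᴸ (cstᴸ 1ℤ ⊕ᴸ monoᴸ (+ (2 ℕ.* r)))
           ⊗ᴸ monoᴸ (half (+ r * (+ (3 ℕ.* r) - + 5)))
  where r = n ℕD./ 3
        open import Data.Integer using (_-_)
... | 1 = cstᴸ (sgn r) ⊗ᴸ monoᴸ (half (+ r * (+ (3 ℕ.* r) + 1ℤ)))
  where r = n ℕD./ 3
... | _ = cstᴸ (- sgn r) ⊗ᴸ monoᴸ (half ((+ r - 1ℤ) * (+ (3 ℕ.* r) + + 2)))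
  where r = n ℕD./ 3
        open import Data.Integer using (_-_)

RHS : ℕ → ℕ → LPoly
RHS m n =
  cstᴸ (+ (2 ℕ.* m)) ⊖ᴸ cstᴸ (+ (n ℕ.* m ℕ.* (2 ℕ.* m ∸ 1))) ⊗ᴸ oneMinus
  ⊕ᴸ cstᴸ (sgn n) ⊗ᴸ monoᴸ (+ ((n ℕ.* (n ℕ.+ 1)) ℕD./ 2))
     ⊗ᴸ ( cstᴸ (+ m) ⊗ᴸ (𝒜 n ⊕ᴸ ℬ n ⊖ᴸ cstᴸ 1ℤ)
          ⊖ᴸ cstᴸ (+ ((3 ℕ.* n ℕ.* m ℕ.* (m ∸ 1)) ℕD./ 2)) ⊗ᴸ oneMinus )
  where oneMinus = cstᴸ 1ℤ ⊖ᴸ monoᴸ (+ n)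

{-# OPTIONS --safe #-}
module Submission where

-- Work in ℤ[q]/Φ_n², where e = 1 - q^n satisfies e² = 0, q is invertible, and 1 - q^k is
-- regular for 0 < k < n.  In the sum τ₀(mn,(m-1)n) only the terms 0 ≤ k ≤ n survive.  The
-- terms k = 0 and k = n are the Gaussian binomials [2mn,n] and [mn,n], which the
-- q-Vandermonde identity evaluates because its inner terms are multiples of e².  For
-- 0 < k < n the factor [mn,k] is a multiple of e, so everything else only matters modulo Φ_n;
-- reflecting [2j,j] to [n-j-1,j-1] for j = n - k turns the inner sum into m times two signed
-- sums of the q-Lucas numbers (1-q^n)/(1-q^(n-j)) [n-j,j].  Both are combinations of
-- F_n = Σ_j (-1)^j q^(j(j-1)/2) [n-j,j], which satisfies F_(n+3) = -q^(n+1) F_n, and this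
-- gives 𝒜_n and ℬ_n.

-- Over ℤ a factor 1 - q^k with 0 < k < n need not become invertible modulo Φ_n, so no quotient is
-- formed: an identity with denominators is proved after multiplication by such factors, which
-- regularity then cancels. A congruence modulo Φ_n takes the form `e * x ≈ e * y`, where q^n may be
-- replaced by 1 because e² = 0. This keeps Φ_n out of the computation, which takes place in an
-- arbitrary commutative ring. That the computed Φ_n provides such a ring is the other obstacle. The
-- long division that defines it has to be shown exact, and 1 - q^k has to be regular modulo Φ_n in
-- ℤ[q], where coprime polynomials need not generate the unit ideal. The derivative of q^n - 1 gives
-- a Bézout identity whose right-hand side is the integer n, and since the factors are monic this
-- integer can be cancelled. That two sums 𝒜_n and ℬ_n occur is due to the factor 1 + q^j in [2j,j]
-- = (1 + q^j) [2j-1,j-1].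

open import Defs renaming (_≈_ to _≋_)
open import Level using (0ℓ)
open import Function using (_∘_; _$_)
open import Data.Nat as ℕ using (ℕ; zero; suc; _∸_; _≤_; _<_; z≤n; s≤s; _<?_; _≤?_)
import Data.Nat.Properties as ℕ
import Data.Nat.Divisibility as ℕ
import Data.Nat.DivMod as ℕ
import Data.Nat.Solver as ℕ
open import Data.Nat.GCD using (module Bézout; module GCD)
open import Data.Nat.Induction using (<-rec)
open import Data.Integer as ℤ using (ℤ; 0ℤ; 1ℤ; +_; -[1+_])
import Data.Integer.Properties as ℤ
import Data.Integer.Solver as ℤ
open import Data.Integer.Divisibility.Signed using (divides; ∣m∣n⇒∣m+n; ∣m⇒∣m*n; ∣m+n∣n⇒∣m; 0∣⇒≡0) renaming (_∣_ to _∣ℤ_)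
open import Data.List using ([]; _∷_; _++_; replicate; length; map; foldr; applyUpTo; upTo)
open import Data.List.Properties using (map-upTo)
import Data.Maybe as Maybe
open import Data.Product using (_,_; proj₁; proj₂; Σ; ∃)
open import Data.Sum as Sum using (inj₁; inj₂)
open import Algebra using (CommutativeRing)
import Algebra.Properties.CommutativeSemigroup
import Algebra.Properties.Ring
import Algebra.Properties.Semiring.Exp
import Algebra.Solver.Ring
open import Algebra.Solver.Ring.AlmostCommutativeRing using (fromCommutativeRing; _-Raw-AlmostCommutative⟶_)
import Relation.Binary.Reasoning.Setoid
open import Relation.Nullary using (yes; no; contradiction)
open import Relation.Nullary.Decidable using (dec⇒maybe)
open import Relation.Binary.PropositionalEquality as ≡ using (_≡_)

-- tri k is the binomial coefficient C(k,2).
tri : ℕ → ℕ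
tri zero = 0
tri (suc k) = k ℕ.+ tri k

tri*2 : ∀ k → tri k ℕ.* 2 ≡ k ℕ.* (k ∸ 1)
tri*2 zero = ≡.refl
tri*2 (suc zero) = ≡.refl
tri*2 (suc (suc k)) = ≡.trans (≡.trans (ℕ.*-distribʳ-+ 2 (suc k) (tri (suc k))) (≡.cong (suc k ℕ.* 2 ℕ.+_) (tri*2 (suc k))))
  (solve 1 (λ x → (con 1 :+ x) :* con 2 :+ (con 1 :+ x) :* x := (con 2 :+ x) :* (con 1 :+ x)) ≡.refl k)
  where open ℕ.+-*-Solver

tri+tri : ∀ k → tri k ℕ.+ tri (suc k) ≡ k ℕ.* k
tri+tri zero = ≡.refl
tri+tri (suc k) = ≡.trans
  (solve 2 (λ k t → (k :+ t) :+ (con 1 :+ k :+ (k :+ t)) := (t :+ (k :+ t)) :+ (con 1 :+ k :+ k)) ≡.refl k (tri k))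
  (≡.trans (≡.cong (ℕ._+ (1 ℕ.+ k ℕ.+ k)) (tri+tri k))
  (solve 1 (λ k → k :* k :+ (con 1 :+ k :+ k) := (con 1 :+ k) :* (con 1 :+ k)) ≡.refl k))
  where open ℕ.+-*-Solver

-- Finite sums over initial segments of ℕ.

module Sums (R : CommutativeRing 0ℓ 0ℓ) where
  open CommutativeRing R
  open Algebra.Properties.CommutativeSemigroup +-commutativeSemigroup using (interchange)

  sum : ℕ → (ℕ → Carrier) → Carrier
  sum zero f = 0#
  sum (suc k) f = f 0 + sum k (λ i → f (suc i))

  sum-cong : ∀ k {f g} → (∀ i → i < k → f i ≈ g i) → sum k f ≈ sum k g
  sum-cong zero _ = refl
  sum-cong (suc k) f≈g = +-cong (f≈g 0 (s≤s z≤n)) (sum-cong k (λ i i<k → f≈g (suc i) (s≤s i<k)))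

  sum-+ : ∀ k f g → sum k (λ i → f i + g i) ≈ sum k f + sum k g
  sum-+ zero f g = sym (+-identityˡ 0#)
  sum-+ (suc k) f g = trans (+-congˡ (sum-+ k _ _)) (interchange _ _ _ _)

  sum-*ˡ : ∀ k c f → sum k (λ i → c * f i) ≈ c * sum k f
  sum-*ˡ zero c f = sym (zeroʳ c)
  sum-*ˡ (suc k) c f = trans (+-congˡ (sum-*ˡ k c _)) (sym (distribˡ c _ _))

  sum-zero : ∀ k {f} → (∀ i → i < k → f i ≈ 0#) → sum k f ≈ 0#
  sum-zero zero _ = refl
  sum-zero (suc k) f≈0 =
    trans (+-cong (f≈0 0 (s≤s z≤n)) (sum-zero k (λ i i<k → f≈0 (suc i) (s≤s i<k)))) (+-identityˡ 0#)

  sum-last : ∀ k f → sum (suc k) f ≈ sum k f + f k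
  sum-last zero f = +-comm _ _
  sum-last (suc k) f = trans (+-congˡ (sum-last k _)) (sym (+-assoc _ _ _))

  sum-split : ∀ j k f → sum (j ℕ.+ k) f ≈ sum j f + sum k (λ i → f (j ℕ.+ i))
  sum-split zero k f = sym (+-identityˡ _)
  sum-split (suc j) k f = trans (+-congˡ (sum-split j k _)) (sym (+-assoc _ _ _))

  sum-reverse : ∀ k f → sum k f ≈ sum k (λ i → f (k ∸ suc i))
  sum-reverse zero f = refl
  sum-reverse (suc k) f = trans (sum-last k f) (trans (+-comm _ _) (+-congˡ (sum-reverse k f)))

-- Gaussian binomials in a commutative ring with a chosen element q.

module GaussianBinomials
  (R : CommutativeRing 0ℓ 0ℓ)
  (ℤ⟶R : ℤ.+-*-rawRing -Raw-AlmostCommutative⟶ fromCommutativeRing R)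
  (q : CommutativeRing.Carrier R)
  where

  open CommutativeRing R
  open Sums R public
  open Algebra.Properties.Semiring.Exp semiring public using (_^_; ^-homo-*)
  open _-Raw-AlmostCommutative⟶_ ℤ⟶R public using (-‿homo; 1-homo; 0-homo; *-homo; +-homo) renaming (⟦_⟧ to ι)

  ι-≟ : ∀ a b → Maybe.Maybe (ι a ≈ ι b)
  ι-≟ a b = Maybe.map (λ a≡b → reflexive (≡.cong ι a≡b)) (dec⇒maybe (a ℤ.≟ b))

  open Algebra.Solver.Ring ℤ.+-*-rawRing (fromCommutativeRing R) ℤ⟶R ι-≟
    public using (solve; _:=_; con; _:+_; _:*_; _:-_; :-_; _:^_; Polynomial)
  open Relation.Binary.Reasoning.Setoid setoid public

  -- ⟦ :1 ⟧ is 1# itself, whereas ⟦ con 1ℤ ⟧ is ι 1ℤ.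
  :1 : ∀ {n} → Polynomial n
  :1 = con 0ℤ :^ 0

  ^-≡ : ∀ x {a b} → a ≡ b → x ^ a ≈ x ^ b
  ^-≡ x ≡.refl = refl

  1−q^ : ℕ → Carrier
  1−q^ k = 1# - q ^ k

  ι-sgn-suc : ∀ k → ι (sgn (suc k)) ≈ - ι (sgn k)
  ι-sgn-suc k = -‿homo (sgn k)

  -- Recursion by the q-Pascal rule instead of a quotient of products, so that the binomial exists
  -- in rings where the denominators are not invertible; `qbinomℕ≐gb` ties it to the quotient.
  gb : ℕ → ℕ → Carrier
  gb n zero = 1#
  gb zero (suc k) = 0#
  gb (suc n) (suc k) = gb n k + q ^ suc k * gb n (suc k)

  gb-zero : ∀ {n k} → n < k → gb n k ≈ 0#
  gb-zero {zero} {suc k} _ = refl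
  gb-zero {suc n} {suc k} (s≤s n<k) = begin
    gb n k + q ^ suc k * gb n (suc k) ≈⟨ +-cong (gb-zero n<k) (*-congˡ (gb-zero (ℕ.m<n⇒m<1+n n<k))) ⟩
    0# + q ^ suc k * 0#              ≈⟨ trans (+-identityˡ _) (zeroʳ _) ⟩
    0#                               ∎

  gb-diag : ∀ n → gb n n ≈ 1#
  gb-diag zero = refl
  gb-diag (suc n) = begin
    gb n n + q ^ suc n * gb n (suc n) ≈⟨ +-cong (gb-diag n) (*-congˡ (gb-zero (ℕ.n<1+n n))) ⟩
    1# + q ^ suc n * 0#              ≈⟨ trans (+-congˡ (zeroʳ _)) (+-identityʳ _) ⟩
    1#                               ∎

  -- Identities between exponents involving n ∸ k need only hold for k ≤ n.
  gb-weight : ∀ {x y} n k → (k ≤ n → x ≈ y) → x * gb n k ≈ y * gb n k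
  gb-weight {x} {y} n k x≈y with ℕ.≤-<-connex k n
  ... | inj₁ k≤n = *-congʳ (x≈y k≤n)
  ... | inj₂ n<k = begin
    x * gb n k ≈⟨ trans (*-congˡ (gb-zero n<k)) (zeroʳ x) ⟩
    0#         ≈⟨ trans (*-congˡ (gb-zero n<k)) (zeroʳ y) ⟨
    y * gb n k ∎

  -- Expanding both binomials by the induction hypothesis leaves one mismatch, the weight of
  -- `gb n (suc k)`: q^(k+2) q^(n-k-1) against q^(n-k) q^(k+1). These agree when k < n, and
  -- otherwise the binomial is 0.
  gb-pascal₂ : ∀ n k → gb (suc n) (suc k) ≈ gb n (suc k) + q ^ (n ∸ k) * gb n k
  gb-pascal₂ zero zero = begin
    1# + q ^ 1 * 0# ≈⟨ trans (+-congˡ (zeroʳ _)) (+-comm _ _) ⟩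
    0# + 1#         ≈⟨ +-congˡ (*-identityʳ _) ⟨
    0# + 1# * 1#    ∎
  gb-pascal₂ zero (suc k) = +-congˡ (trans (zeroʳ _) (sym (zeroʳ _)))
  gb-pascal₂ (suc n) zero = begin
    1# + q ^ 1 * gb (suc n) 1                ≈⟨ +-congˡ (*-cong (*-identityʳ q) (gb-pascal₂ n 0)) ⟩
    1# + q * (gb n 1 + q ^ n * 1#)           ≈⟨ solve 4 (λ i q g x → i :+ q :* (g :+ x :* i) := (i :+ q :* g) :+ q :* x :* i) refl 1# q (gb n 1) (q ^ n) ⟩
    (1# + q * gb n 1) + q ^ suc n * 1#       ≈⟨ +-congʳ (+-congˡ (*-congʳ (*-identityʳ q))) ⟨
    (1# + q ^ 1 * gb n 1) + q ^ suc n * 1#   ∎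
  gb-pascal₂ (suc n) (suc k) = begin
    gb (suc n) (suc k) + Q₂ * gb (suc n) (suc (suc k))
      ≈⟨ +-cong (gb-pascal₂ n k) (*-congˡ (gb-pascal₂ n (suc k))) ⟩
    (b + q ^ (n ∸ k) * a) + Q₂ * (c + q ^ (n ∸ suc k) * b)
      ≈⟨ solve 6 (λ a b c Q₂ u v → (b :+ u :* a) :+ Q₂ :* (c :+ v :* b) := ((b :+ Q₂ :* c) :+ u :* a) :+ (Q₂ :* v) :* b)
           refl a b c Q₂ (q ^ (n ∸ k)) (q ^ (n ∸ suc k)) ⟩
    ((b + Q₂ * c) + q ^ (n ∸ k) * a) + (Q₂ * q ^ (n ∸ suc k)) * b
      ≈⟨ +-congˡ (gb-weight n (suc k) λ k<n → begin
           Q₂ * q ^ (n ∸ suc k)           ≈⟨ ^-homo-* q (2 ℕ.+ k) (n ∸ suc k) ⟨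
           q ^ (2 ℕ.+ k ℕ.+ (n ∸ suc k))  ≈⟨ ^-≡ q (≡.cong suc (≡.trans (ℕ.m+[n∸m]≡n k<n) (≡.sym (ℕ.m∸n+n≡m (ℕ.<⇒≤ k<n))))) ⟩
           q ^ suc (n ∸ k ℕ.+ k)          ≈⟨ ^-≡ q (ℕ.+-suc (n ∸ k) k) ⟨
           q ^ (n ∸ k ℕ.+ suc k)          ≈⟨ ^-homo-* q (n ∸ k) (suc k) ⟩
           q ^ (n ∸ k) * q ^ suc k        ∎) ⟩
    ((b + Q₂ * c) + q ^ (n ∸ k) * a) + (q ^ (n ∸ k) * q ^ suc k) * b
      ≈⟨ solve 5 (λ a b x u w → (x :+ u :* a) :+ (u :* w) :* b := x :+ u :* (a :+ w :* b))
           refl a b (b + Q₂ * c) (q ^ (n ∸ k)) (q ^ suc k) ⟩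
    (b + Q₂ * c) + q ^ (n ∸ k) * (a + q ^ suc k * b) ∎
    where
    a = gb n k
    b = gb n (suc k)
    c = gb n (suc (suc k))
    Q₂ = q ^ suc (suc k)

  -- The two Pascal rules expand the same `gb (suc n) (suc k)`; equating the expansions gives this
  -- ratio.
  gb-absorb₂ : ∀ n k → 1−q^ (suc k) * gb n (suc k) ≈ 1−q^ (n ∸ k) * gb n k
  gb-absorb₂ n k = begin
    (1# - Q) * b                  ≈⟨ solve 4 (λ a b Q u → (:1 :- Q) :* b := (b :+ u :* a) :- (u :* a :+ Q :* b)) refl a b Q u ⟩
    (b + u * a) - (u * a + Q * b) ≈⟨ +-congʳ (gb-pascal₂ n k) ⟨
    (a + Q * b) - (u * a + Q * b) ≈⟨ solve 4 (λ a b Q u → (a :+ Q :* b) :- (u :* a :+ Q :* b) := (:1 :- u) :* a) refl a b Q u ⟩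
    (1# - u) * a                  ∎
    where
    a = gb n k
    b = gb n (suc k)
    Q = q ^ suc k
    u = q ^ (n ∸ k)

  1−q^-+ : ∀ j k → 1−q^ (j ℕ.+ k) ≈ 1−q^ j + q ^ j * 1−q^ k
  1−q^-+ j k = begin
    1# - q ^ (j ℕ.+ k)         ≈⟨ +-congˡ (-‿cong (^-homo-* q j k)) ⟩
    1# - q ^ j * q ^ k         ≈⟨ solve 2 (λ x y → :1 :- x :* y := (:1 :- x) :+ x :* (:1 :- y)) refl (q ^ j) (q ^ k) ⟩
    1−q^ j + q ^ j * 1−q^ k   ∎

  -- The first Pascal rule and `gb-absorb₂`, with (1 - q^(k+1)) + q^(k+1) (1 - q^(n-k)) = 1 -
  -- q^(n+1). It is the division-free substitute for the quotient formula.
  gb-absorb : ∀ n k → 1−q^ (suc k) * gb (suc n) (suc k) ≈ 1−q^ (suc n) * gb n k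
  gb-absorb n k = begin
    y * (a + Q * b)          ≈⟨ solve 4 (λ y a Q b → y :* (a :+ Q :* b) := y :* a :+ Q :* (y :* b)) refl y a Q b ⟩
    y * a + Q * (y * b)      ≈⟨ +-congˡ (*-congˡ (gb-absorb₂ n k)) ⟩
    y * a + Q * (1−q^ (n ∸ k) * a) ≈⟨ solve 4 (λ y a Q b → y :* a :+ Q :* (b :* a) := (y :+ Q :* b) :* a) refl y a Q (1−q^ (n ∸ k)) ⟩
    (y + Q * 1−q^ (n ∸ k)) * a ≈⟨ gb-weight n k (λ k≤n → trans (sym (1−q^-+ (suc k) (n ∸ k))) (reflexive (≡.cong (λ i → 1−q^ (suc i)) (ℕ.m+[n∸m]≡n k≤n)))) ⟩
    1−q^ (suc n) * a         ∎
    where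
    y = 1−q^ (suc k)
    a = gb n k
    b = gb n (suc k)
    Q = q ^ suc k

  -- Induction on a: the Pascal rule splits the left side into two sums, and term j of the one joins
  -- term j + 1 of the other in the Pascal rule for `gb (suc a) (suc j)`. The truncation in `a ∸ j`
  -- does no harm, since `gb a j` is 0 for j > a.
  vandermonde : ∀ a b k →
    gb (a ℕ.+ b) k ≈ sum (suc k) (λ j → q ^ ((a ∸ j) ℕ.* (k ∸ j)) * (gb a j * gb b (k ∸ j)))
  vandermonde zero b k = sym (begin
    1# * (1# * gb b k) + sum k (λ j → q ^ (0 ℕ.* (k ∸ suc j)) * (0# * gb b (k ∸ suc j)))
      ≈⟨ +-cong (trans (*-identityˡ _) (*-identityˡ _)) (sum-zero k (λ j _ → trans (*-congˡ (zeroˡ _)) (zeroʳ _))) ⟩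
    gb b k + 0# ≈⟨ +-identityʳ _ ⟩
    gb b k ∎)
  vandermonde (suc a) b zero = sym (begin
    q ^ (suc a ℕ.* 0) * (1# * 1#) + 0# ≈⟨ +-identityʳ _ ⟩
    q ^ (suc a ℕ.* 0) * (1# * 1#)      ≈⟨ *-cong (^-≡ q (ℕ.*-zeroʳ a)) (*-identityʳ _) ⟩
    1# * 1#                            ≈⟨ *-identityʳ _ ⟩
    1#                                 ∎)
  vandermonde (suc a) b (suc k) = begin
    gb (a ℕ.+ b) k + Q * gb (a ℕ.+ b) (suc k)
      ≈⟨ +-cong (vandermonde a b k) (*-congˡ (vandermonde a b (suc k))) ⟩
    sum (suc k) s + Q * (q ^ (a ℕ.* suc k) * (1# * gb b (suc k)) + sum (suc k) t)
      ≈⟨ solve 4 (λ s Q u t → s :+ Q :* (u :+ t) := Q :* u :+ (s :+ Q :* t)) refl _ _ _ _ ⟩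
    Q * (q ^ (a ℕ.* suc k) * (1# * gb b (suc k))) + (sum (suc k) s + Q * sum (suc k) t)
      ≈⟨ +-cong (trans (sym (*-assoc _ _ _)) (*-congʳ (sym (^-homo-* q (suc k) (a ℕ.* suc k)))))
                (+-congˡ (sym (sum-*ˡ (suc k) Q t))) ⟩
    q ^ (suc a ℕ.* suc k) * (1# * gb b (suc k)) + (sum (suc k) s + sum (suc k) (λ j → Q * t j))
      ≈⟨ +-congˡ (sum-+ (suc k) s (λ j → Q * t j)) ⟨
    q ^ (suc a ℕ.* suc k) * (1# * gb b (suc k)) + sum (suc k) (λ j → s j + Q * t j)
      ≈⟨ +-congˡ (sum-cong (suc k) (λ { j (s≤s j≤k) → step j j≤k })) ⟩
    q ^ (suc a ℕ.* suc k) * (1# * gb b (suc k)) + sum (suc k) (λ j → q ^ ((a ∸ j) ℕ.* (k ∸ j)) * (gb (suc a) (suc j) * gb b (k ∸ j))) ∎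
    where
    Q = q ^ suc k
    s t : ℕ → Carrier
    s j = q ^ ((a ∸ j) ℕ.* (k ∸ j)) * (gb a j * gb b (k ∸ j))
    t j = q ^ ((a ∸ suc j) ℕ.* (k ∸ j)) * (gb a (suc j) * gb b (k ∸ j))

    exponent : ∀ j → j ≤ k → suc j ≤ a →
      suc k ℕ.+ (a ∸ suc j) ℕ.* (k ∸ j) ≡ (a ∸ j) ℕ.* (k ∸ j) ℕ.+ suc j
    exponent j j≤k j<a = ≡.trans
      (≡.cong (λ i → suc i ℕ.+ (a ∸ suc j) ℕ.* (k ∸ j)) (≡.sym (ℕ.m∸n+n≡m j≤k)))
      (≡.trans
        (ℕsolve 3 (λ u v j → ℕcon 1 ⊞ (v ⊞ j) ⊞ u ⊠ v ⊜ (ℕcon 1 ⊞ u) ⊠ v ⊞ (ℕcon 1 ⊞ j)) ≡.refl (a ∸ suc j) (k ∸ j) j)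
        (≡.cong (λ i → i ℕ.* (k ∸ j) ℕ.+ suc j) (≡.sym (ℕ.+-∸-assoc 1 j<a))))
      where open ℕ.+-*-Solver using () renaming (solve to ℕsolve; con to ℕcon; _:+_ to _⊞_; _:*_ to _⊠_; _:=_ to _⊜_)

    step : ∀ j → j ≤ k → s j + Q * t j ≈ q ^ ((a ∸ j) ℕ.* (k ∸ j)) * (gb (suc a) (suc j) * gb b (k ∸ j))
    step j j≤k = begin
      x * (g * h) + Q * (z * (g′ * h))
        ≈⟨ solve 6 (λ x g h Q z g′ → x :* (g :* h) :+ Q :* (z :* (g′ :* h)) := x :* (g :* h) :+ (Q :* z) :* g′ :* h) refl x g h Q z g′ ⟩
      x * (g * h) + (Q * z) * g′ * h
        ≈⟨ +-congˡ (*-congʳ (gb-weight a (suc j) λ j<a → begin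
             Q * z                                     ≈⟨ ^-homo-* q (suc k) ((a ∸ suc j) ℕ.* (k ∸ j)) ⟨
             q ^ (suc k ℕ.+ (a ∸ suc j) ℕ.* (k ∸ j))  ≈⟨ ^-≡ q (exponent j j≤k j<a) ⟩
             q ^ ((a ∸ j) ℕ.* (k ∸ j) ℕ.+ suc j)      ≈⟨ ^-homo-* q ((a ∸ j) ℕ.* (k ∸ j)) (suc j) ⟩
             x * q ^ suc j                             ∎)) ⟩
      x * (g * h) + (x * q ^ suc j) * g′ * h
        ≈⟨ solve 5 (λ x g h w g′ → x :* (g :* h) :+ (x :* w) :* g′ :* h := x :* ((g :+ w :* g′) :* h)) refl x g h (q ^ suc j) g′ ⟩
      x * ((g + q ^ suc j * g′) * h) ∎
      where
      x = q ^ ((a ∸ j) ℕ.* (k ∸ j))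
      z = q ^ ((a ∸ suc j) ℕ.* (k ∸ j))
      g = gb a j
      g′ = gb a (suc j)
      h = gb b (k ∸ j)

-- pentagonal r = r(3r-1)/2
pentagonal : ℕ → ℕ
pentagonal zero = 0
pentagonal (suc r) = suc (r ℕ.* 3) ℕ.+ pentagonal r

-- Alternating sums of q-Fibonacci and q-Lucas type.

module LucasSums
  (R : CommutativeRing 0ℓ 0ℓ)
  (ℤ⟶R : ℤ.+-*-rawRing -Raw-AlmostCommutative⟶ fromCommutativeRing R)
  (q : CommutativeRing.Carrier R)
  where

  open CommutativeRing R
  open GaussianBinomials R ℤ⟶R q public

  -- lucas n′ i is (1 - q^n) / (1 - q^(n-j)) · [n-j, j] for n = suc n′ and j = suc i.
  lucas : ℕ → ℕ → Carrier
  lucas n′ i = q ^ suc i * gb (n′ ∸ i) (suc i) + gb (n′ ∸ suc i) i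

  -- Rests on 1 - q^n = (1 - q^j) + q^j (1 - q^(n-j)). It trades a factor 1 - q^n before
  -- [n-j-1, j-1] for `lucas`, at the price of the factor 1 - q^j and without dividing by 1 -
  -- q^(n-j).
  lucas-absorb : ∀ n′ i → i < n′ → 1−q^ (suc i) * lucas n′ i ≈ 1−q^ (suc n′) * gb (n′ ∸ suc i) i
  lucas-absorb n′ i i<n′ = begin
    y * (Q * gb (n′ ∸ i) (suc i) + h)
      ≈⟨ *-congˡ (+-congʳ (*-congˡ (reflexive (≡.cong (λ m → gb m (suc i)) n′∸i)))) ⟩
    y * (Q * gb (suc m) (suc i) + h)
      ≈⟨ solve 4 (λ y Q g h → y :* (Q :* g :+ h) := Q :* (y :* g) :+ y :* h) refl y Q (gb (suc m) (suc i)) h ⟩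
    Q * (y * gb (suc m) (suc i)) + y * h
      ≈⟨ +-congʳ (*-congˡ (gb-absorb m i)) ⟩
    Q * (1−q^ (suc m) * h) + y * h
      ≈⟨ solve 4 (λ y Q g h → Q :* (g :* h) :+ y :* h := (y :+ Q :* g) :* h) refl y Q (1−q^ (suc m)) h ⟩
    (y + Q * 1−q^ (suc m)) * h
      ≈⟨ *-congʳ (1−q^-+ (suc i) (suc m)) ⟨
    1−q^ (suc i ℕ.+ suc m) * h
      ≈⟨ *-congʳ (reflexive (≡.cong 1−q^ (≡.trans (≡.cong (suc i ℕ.+_) (≡.sym n′∸i)) (≡.cong suc (ℕ.m+[n∸m]≡n (ℕ.<⇒≤ i<n′)))))) ⟩
    1−q^ (suc n′) * h ∎
    where
    m = n′ ∸ suc i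
    y = 1−q^ (suc i)
    Q = q ^ suc i
    h = gb m i
    n′∸i : n′ ∸ i ≡ suc m
    n′∸i = ℕ.+-∸-assoc 1 i<n′

  weightA : ℕ → Carrier
  weightA i = ι (sgn (suc i)) * q ^ tri (suc i)

  -- With n = `suc n′`, this sum and the next evaluate to 𝒜_n and ℬ_n. The leading `1#` is the term
  -- j = 0; the extra p^j of the second sum stands for q^(-j).
  lucasSumA : ℕ → Carrier
  lucasSumA n′ = 1# + sum n′ (λ i → weightA i * lucas n′ i)

  lucasSumB : Carrier → ℕ → Carrier
  lucasSumB p n′ = 1# + sum n′ (λ i → (weightA i * p ^ suc i) * lucas n′ i)

  inverse-^ : ∀ {p} → p * q ≈ 1# → ∀ k → p ^ k * q ^ k ≈ 1#
  inverse-^ pq≈1 zero = *-identityˡ 1#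
  inverse-^ {p} pq≈1 (suc k) = begin
    (p * p ^ k) * (q * q ^ k) ≈⟨ solve 4 (λ a b c d → (a :* b) :* (c :* d) := (a :* c) :* (b :* d)) refl p (p ^ k) q (q ^ k) ⟩
    (p * q) * (p ^ k * q ^ k) ≈⟨ *-cong pq≈1 (inverse-^ pq≈1 k) ⟩
    1# * 1#                   ≈⟨ *-identityˡ 1# ⟩
    1#                        ∎

  ι-sgn² : ∀ k → ι (sgn k) * ι (sgn k) ≈ 1#
  ι-sgn² zero = trans (*-cong 1-homo 1-homo) (*-identityˡ 1#)
  ι-sgn² (suc k) = begin
    ι (sgn (suc k)) * ι (sgn (suc k)) ≈⟨ *-cong (ι-sgn-suc k) (ι-sgn-suc k) ⟩
    - ι (sgn k) * - ι (sgn k)         ≈⟨ solve 1 (λ x → :- x :* :- x := x :* x) refl (ι (sgn k)) ⟩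
    ι (sgn k) * ι (sgn k)             ≈⟨ ι-sgn² k ⟩
    1#                                ∎

  -- `G` carries an extra q^j and is only a means: the two Pascal rules relate `F` and `G` in
  -- different ways, and eliminating `G` leaves a recurrence for `F` alone.
  F G : ℕ → Carrier
  F n = sum (suc n) (λ j → (ι (sgn j) * q ^ tri j) * gb (n ∸ j) j)
  G n = sum (suc n) (λ j → (ι (sgn j) * q ^ tri (suc j)) * gb (n ∸ j) j)

  weight-suc : ∀ j → weightA j ≈ - (ι (sgn j) * q ^ tri (suc j))
  weight-suc j = trans (*-congʳ (ι-sgn-suc j)) (sym (-‿distribˡ-* _ _))
    where open Algebra.Properties.Ring ring using (-‿distribˡ-*)

  sum-neg : ∀ k c f → sum k (λ i → (- c) * f i) ≈ - (c * sum k f)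
  sum-neg k c f = trans (sum-*ˡ k (- c) f) (sym (-‿distribˡ-* _ _))
    where open Algebra.Properties.Ring ring using (-‿distribˡ-*)

  1-term : ∀ x → (ι (sgn 0) * 1#) * x ≈ x
  1-term x = trans (*-congʳ (trans (*-identityʳ _) 1-homo)) (*-identityˡ x)

  -- The last summand has upper index 0 and a positive lower index, so it drops out. Every remaining
  -- upper index is a successor, ready for a Pascal rule.
  F-tail : ∀ m → F (suc (suc m)) ≈ 1# + sum (suc m) (λ i → weightA i * gb (suc (m ∸ i)) (suc i))
  F-tail m = +-cong (1-term 1#) (begin
    sum (suc (suc m)) f           ≈⟨ sum-last (suc m) f ⟩
    sum (suc m) f + f (suc m)     ≈⟨ +-congˡ (*-congˡ (reflexive (≡.cong (λ i → gb i (suc (suc m))) (ℕ.n∸n≡0 m)))) ⟩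
    sum (suc m) f + weightA (suc m) * 0# ≈⟨ trans (+-congˡ (zeroʳ _)) (+-identityʳ _) ⟩
    sum (suc m) f                 ≈⟨ sum-cong (suc m) (λ { i (s≤s i≤m) → *-congˡ {weightA i} (reflexive (≡.cong (λ k → gb k (suc i)) (ℕ.+-∸-assoc 1 i≤m))) }) ⟩
    sum (suc m) (λ i → weightA i * gb (suc (m ∸ i)) (suc i)) ∎)
    where
    f : ℕ → Carrier
    f i = weightA i * gb (suc m ∸ i) (suc i)

  -- The first Pascal rule, term by term: its weight q^(i+1) raises `tri (suc i)` to
  -- `tri (suc (suc i))`, the exponent in `G`.
  F-via-G : ∀ m → F (suc (suc m)) ≈ G (suc m) - G m
  F-via-G m = begin
    F (suc (suc m)) ≈⟨ F-tail m ⟩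
    1# + sum (suc m) (λ i → weightA i * gb (suc (m ∸ i)) (suc i))
      ≈⟨ +-congˡ (sum-cong (suc m) (λ i _ → step i)) ⟩
    1# + sum (suc m) (λ i → t i + (- 1#) * s i)
      ≈⟨ +-congˡ (sum-+ (suc m) t (λ i → (- 1#) * s i)) ⟩
    1# + (sum (suc m) t + sum (suc m) (λ i → (- 1#) * s i))
      ≈⟨ +-congˡ (+-congˡ (trans (sum-neg (suc m) 1# s) (-‿cong (*-identityˡ _)))) ⟩
    1# + (sum (suc m) t - G m)
      ≈⟨ sym (+-assoc _ _ _) ⟩
    (1# + sum (suc m) t) - G m
      ≈⟨ +-congʳ (+-congʳ (1-term 1#)) ⟨
    G (suc m) - G m ∎
    where
    s t : ℕ → Carrier
    s i = (ι (sgn i) * q ^ tri (suc i)) * gb (m ∸ i) i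
    t i = (ι (sgn (suc i)) * q ^ tri (suc (suc i))) * gb (m ∸ i) (suc i)
    step : ∀ i → weightA i * gb (suc (m ∸ i)) (suc i) ≈ t i + (- 1#) * s i
    step i = begin
      w * (a + Q * b)                 ≈⟨ solve 4 (λ w a Q b → w :* (a :+ Q :* b) := w :* Q :* b :+ w :* a) refl w a Q b ⟩
      w * Q * b + w * a               ≈⟨ +-cong (*-congʳ (trans (solve 3 (λ s x Q → s :* x :* Q := s :* (Q :* x)) refl (ι (sgn (suc i))) (q ^ tri (suc i)) Q) (*-congˡ (sym (^-homo-* q (suc i) (tri (suc i))))))) (*-congʳ (weight-suc i)) ⟩
      t i + (- u) * a                 ≈⟨ +-congˡ (solve 2 (λ u a → :- u :* a := :- :1 :* (u :* a)) refl u a) ⟩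
      t i + (- 1#) * s i              ∎
      where
      w = weightA i
      u = ι (sgn i) * q ^ tri (suc i)
      Q = q ^ suc i
      a = gb (m ∸ i) i
      b = gb (m ∸ i) (suc i)

  -- The second Pascal rule: its weight q^(m-2i) completes the exponent 2i + 1 + `tri i` to m + 1 +
  -- `tri i`, so q^(m+1) leaves the sum and `F m` remains.
  G-step : ∀ m → G (suc (suc m)) ≈ G (suc m) - q ^ suc m * F m
  G-step m = begin
    G (suc (suc m)) ≈⟨ +-cong (1-term 1#) (trans (sum-last (suc m) f) (trans (+-congˡ (trans (*-congˡ (reflexive (≡.cong (λ i → gb i (suc (suc m))) (ℕ.n∸n≡0 m)))) (zeroʳ _))) (+-identityʳ _))) ⟩
    1# + sum (suc m) f
      ≈⟨ +-congˡ (sum-cong (suc m) (λ { i (s≤s i≤m) → step i i≤m })) ⟩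
    1# + sum (suc m) (λ i → t i + (- q ^ suc m) * s i)
      ≈⟨ +-congˡ (sum-+ (suc m) t (λ i → (- q ^ suc m) * s i)) ⟩
    1# + (sum (suc m) t + sum (suc m) (λ i → (- q ^ suc m) * s i))
      ≈⟨ +-congˡ (+-congˡ (sum-neg (suc m) (q ^ suc m) s)) ⟩
    1# + (sum (suc m) t - q ^ suc m * F m)
      ≈⟨ sym (+-assoc _ _ _) ⟩
    (1# + sum (suc m) t) - q ^ suc m * F m
      ≈⟨ +-congʳ (+-congʳ (1-term 1#)) ⟨
    G (suc m) - q ^ suc m * F m ∎
    where
    f s t : ℕ → Carrier
    f i = (ι (sgn (suc i)) * q ^ tri (suc (suc i))) * gb (suc m ∸ i) (suc i)
    s i = (ι (sgn i) * q ^ tri i) * gb (m ∸ i) i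
    t i = (ι (sgn (suc i)) * q ^ tri (suc (suc i))) * gb (m ∸ i) (suc i)
    exponent : ∀ i → i ≤ m → i ≤ m ∸ i → tri (suc (suc i)) ℕ.+ (m ∸ i ∸ i) ≡ suc m ℕ.+ tri i
    exponent i i≤m i≤m∸i = ≡.trans
      (ℕsolve 3 (λ i d t → (ℕcon 1 ⊞ i ⊞ (i ⊞ t)) ⊞ d ⊜ ℕcon 1 ⊞ (i ⊞ (i ⊞ d)) ⊞ t) ≡.refl i (m ∸ i ∸ i) (tri i))
      (≡.cong (λ k → suc k ℕ.+ tri i) (≡.trans (≡.cong (i ℕ.+_) (ℕ.m+[n∸m]≡n i≤m∸i)) (ℕ.m+[n∸m]≡n i≤m)))
      where open ℕ.+-*-Solver using () renaming (solve to ℕsolve; con to ℕcon; _:+_ to _⊞_; _:=_ to _⊜_)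
    step : ∀ i → i ≤ m → f i ≈ t i + (- q ^ suc m) * s i
    step i i≤m = begin
      w * gb (suc m ∸ i) (suc i)      ≈⟨ *-congˡ (reflexive (≡.cong (λ k → gb k (suc i)) (ℕ.+-∸-assoc 1 i≤m))) ⟩
      w * gb (suc (m ∸ i)) (suc i)    ≈⟨ *-congˡ (gb-pascal₂ (m ∸ i) i) ⟩
      w * (b + Q * a)                 ≈⟨ solve 4 (λ w b Q a → w :* (b :+ Q :* a) := w :* b :+ (w :* Q) :* a) refl w b Q a ⟩
      t i + (w * Q) * a               ≈⟨ +-congˡ (gb-weight (m ∸ i) i λ i≤m∸i → begin
          ι (sgn (suc i)) * q ^ tri (suc (suc i)) * Q   ≈⟨ *-assoc _ _ _ ⟩
          ι (sgn (suc i)) * (q ^ tri (suc (suc i)) * Q) ≈⟨ *-cong (ι-sgn-suc i) (sym (^-homo-* q (tri (suc (suc i))) (m ∸ i ∸ i))) ⟩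
          - ι (sgn i) * q ^ (tri (suc (suc i)) ℕ.+ (m ∸ i ∸ i)) ≈⟨ *-congˡ (trans (^-≡ q (exponent i i≤m i≤m∸i)) (^-homo-* q (suc m) (tri i))) ⟩
          - ι (sgn i) * (q ^ suc m * q ^ tri i)         ≈⟨ solve 3 (λ s a b → :- s :* (a :* b) := :- a :* (s :* b)) refl (ι (sgn i)) (q ^ suc m) (q ^ tri i) ⟩
          - q ^ suc m * (ι (sgn i) * q ^ tri i)         ∎) ⟩
      t i + (- q ^ suc m * (ι (sgn i) * q ^ tri i)) * a ≈⟨ +-congˡ (*-assoc _ _ _) ⟩
      t i + (- q ^ suc m) * s i ∎
      where
      w = ι (sgn (suc i)) * q ^ tri (suc (suc i))
      Q = q ^ (m ∸ i ∸ i)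
      a = gb (m ∸ i) i
      b = gb (m ∸ i) (suc i)

  F-step : ∀ m → F (suc (suc (suc m))) ≈ - (q ^ suc m * F m)
  F-step m = begin
    F (suc (suc (suc m)))                      ≈⟨ F-via-G (suc m) ⟩
    G (suc (suc m)) - G (suc m)                ≈⟨ +-congʳ (G-step m) ⟩
    (G (suc m) - q ^ suc m * F m) - G (suc m)  ≈⟨ solve 2 (λ g x → (g :- x) :- g := :- x) refl (G (suc m)) (q ^ suc m * F m) ⟩
    - (q ^ suc m * F m)                        ∎

  -- The factor p^j cancels the q^j in the first half of `lucas`, which leaves F_n with n = m + 2.
  -- In the second half q^C(j,2) p^j = p q^C(j-1,2), which leaves F_(n-2) after the shift j = i + 1.
  lucasSumB≈ : ∀ {p} → p * q ≈ 1# → ∀ m → lucasSumB p (suc m) ≈ F (suc (suc m)) - p * F m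
  lucasSumB≈ {p} pq≈1 m = begin
    1# + sum (suc m) (λ i → (weightA i * p ^ suc i) * lucas (suc m) i)
      ≈⟨ +-congˡ (sum-cong (suc m) (λ { i (s≤s i≤m) → step i i≤m })) ⟩
    1# + sum (suc m) (λ i → t i + (- p) * s i)
      ≈⟨ +-congˡ (trans (sum-+ (suc m) t (λ i → (- p) * s i)) (+-congˡ (sum-neg (suc m) p s))) ⟩
    1# + (sum (suc m) t - p * F m)
      ≈⟨ sym (+-assoc _ _ _) ⟩
    (1# + sum (suc m) t) - p * F m
      ≈⟨ +-congʳ (F-tail m) ⟨
    F (suc (suc m)) - p * F m ∎
    where
    s t : ℕ → Carrier
    s i = (ι (sgn i) * q ^ tri i) * gb (m ∸ i) i
    t i = weightA i * gb (suc (m ∸ i)) (suc i)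
    step : ∀ i → i ≤ m → (weightA i * p ^ suc i) * lucas (suc m) i ≈ t i + (- p) * s i
    step i i≤m = begin
      (w * P) * (Q * gb (suc m ∸ i) (suc i) + a)
        ≈⟨ *-congˡ (+-congʳ (*-congˡ (reflexive (≡.cong (λ k → gb k (suc i)) (ℕ.+-∸-assoc 1 i≤m))))) ⟩
      (w * P) * (Q * b + a)
        ≈⟨ solve 5 (λ w P Q b a → (w :* P) :* (Q :* b :+ a) := (P :* Q) :* (w :* b) :+ (w :* P) :* a) refl w P Q b a ⟩
      (P * Q) * (w * b) + (w * P) * a
        ≈⟨ +-cong (trans (*-congʳ (inverse-^ pq≈1 (suc i))) (*-identityˡ _)) (*-congʳ (begin
             (ι (sgn (suc i)) * q ^ (i ℕ.+ tri i)) * (p * p ^ i) ≈⟨ *-congʳ (*-cong (ι-sgn-suc i) (^-homo-* q i (tri i))) ⟩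
             (- ι (sgn i) * (q ^ i * q ^ tri i)) * (p * p ^ i)   ≈⟨ solve 5 (λ s x y p z → (:- s :* (x :* y)) :* (p :* z) := (:- p :* (s :* y)) :* (z :* x)) refl (ι (sgn i)) (q ^ i) (q ^ tri i) p (p ^ i) ⟩
             (- p * (ι (sgn i) * q ^ tri i)) * (p ^ i * q ^ i)   ≈⟨ trans (*-congˡ (inverse-^ pq≈1 i)) (*-identityʳ _) ⟩
             - p * (ι (sgn i) * q ^ tri i)                       ∎)) ⟩
      t i + (- p * (ι (sgn i) * q ^ tri i)) * a ≈⟨ +-congˡ (*-assoc _ _ _) ⟩
      t i + (- p) * s i ∎
      where
      w = weightA i
      P = p ^ suc i
      Q = q ^ suc i
      a = gb (m ∸ i) i
      b = gb (suc (m ∸ i)) (suc i)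

  -- Here nothing cancels the q^j in `lucas`, so it is written as 1 - (1 - q^j) and the second part
  -- is absorbed into the smaller binomial. The result is [n-j,j] + q^(n-j) [n-j-1,j-1], whose
  -- weight turns C(j,2) into n - 1 + C(j-1,2).
  lucasSumA≈ : ∀ m → lucasSumA (suc m) ≈ F (suc (suc m)) - q ^ suc m * F m
  lucasSumA≈ m = begin
    1# + sum (suc m) (λ i → weightA i * lucas (suc m) i)
      ≈⟨ +-congˡ (sum-cong (suc m) (λ { i (s≤s i≤m) → step i i≤m })) ⟩
    1# + sum (suc m) (λ i → t i + (- q ^ suc m) * s i)
      ≈⟨ +-congˡ (trans (sum-+ (suc m) t (λ i → (- q ^ suc m) * s i)) (+-congˡ (sum-neg (suc m) (q ^ suc m) s))) ⟩
    1# + (sum (suc m) t - q ^ suc m * F m)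
      ≈⟨ sym (+-assoc _ _ _) ⟩
    (1# + sum (suc m) t) - q ^ suc m * F m
      ≈⟨ +-congʳ (F-tail m) ⟨
    F (suc (suc m)) - q ^ suc m * F m ∎
    where
    s t : ℕ → Carrier
    s i = (ι (sgn i) * q ^ tri i) * gb (m ∸ i) i
    t i = weightA i * gb (suc (m ∸ i)) (suc i)
    step : ∀ i → i ≤ m → weightA i * lucas (suc m) i ≈ t i + (- q ^ suc m) * s i
    step i i≤m = begin
      w * (Q * gb (suc m ∸ i) (suc i) + a)
        ≈⟨ *-congˡ (+-congʳ (*-congˡ (reflexive (≡.cong (λ k → gb k (suc i)) (ℕ.+-∸-assoc 1 i≤m))))) ⟩
      w * (Q * b + a)
        ≈⟨ solve 4 (λ w Q b a → w :* (Q :* b :+ a) := w :* ((b :+ a) :- (:1 :- Q) :* b)) refl w Q b a ⟩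
      w * ((b + a) - 1−q^ (suc i) * b)
        ≈⟨ *-congˡ (+-congˡ (-‿cong (gb-absorb (m ∸ i) i))) ⟩
      w * ((b + a) - (1# - T) * a)
        ≈⟨ solve 4 (λ w b T a → w :* ((b :+ a) :- (:1 :- T) :* a) := w :* b :+ (w :* T) :* a) refl w b T a ⟩
      w * b + (w * T) * a
        ≈⟨ +-congˡ (*-congʳ (begin
             (ι (sgn (suc i)) * q ^ (i ℕ.+ tri i)) * T    ≈⟨ *-congʳ (*-cong (ι-sgn-suc i) (^-homo-* q i (tri i))) ⟩
             (- ι (sgn i) * (q ^ i * q ^ tri i)) * T      ≈⟨ solve 4 (λ s x y z → (:- s :* (x :* y)) :* z := :- (x :* z) :* (s :* y)) refl (ι (sgn i)) (q ^ i) (q ^ tri i) T ⟩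
             (- (q ^ i * T)) * (ι (sgn i) * q ^ tri i)    ≈⟨ *-congʳ (-‿cong (trans (sym (^-homo-* q i (suc (m ∸ i)))) (^-≡ q (≡.trans (ℕ.+-suc i (m ∸ i)) (≡.cong suc (ℕ.m+[n∸m]≡n i≤m)))))) ⟩
             - q ^ suc m * (ι (sgn i) * q ^ tri i)        ∎)) ⟩
      t i + (- q ^ suc m * (ι (sgn i) * q ^ tri i)) * a ≈⟨ +-congˡ (*-assoc _ _ _) ⟩
      t i + (- q ^ suc m) * s i ∎
      where
      w = weightA i
      Q = q ^ suc i
      T = q ^ suc (m ∸ i)
      a = gb (m ∸ i) i
      b = gb (suc (m ∸ i)) (suc i)

  -- `F-step` advances by 3, so the residue classes separate, with initial values F_0 = F_1 = 1 and
  -- F_2 = 0. The exponents in the first two classes are the generalized pentagonal numbers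
  -- r(3r-1)/2 and r(3r+1)/2.
  F-pentagonal : ∀ r → F (r ℕ.* 3) ≈ ι (sgn r) * q ^ pentagonal r
  F-pentagonal zero = trans (+-identityʳ _) (*-identityʳ _)
  F-pentagonal (suc r) = begin
    F (3 ℕ.+ r ℕ.* 3)                                     ≈⟨ F-step (r ℕ.* 3) ⟩
    - (q ^ suc (r ℕ.* 3) * F (r ℕ.* 3))                   ≈⟨ -‿cong (*-congˡ (F-pentagonal r)) ⟩
    - (q ^ suc (r ℕ.* 3) * (ι (sgn r) * q ^ pentagonal r)) ≈⟨ solve 3 (λ x s y → :- (x :* (s :* y)) := :- s :* (x :* y)) refl (q ^ suc (r ℕ.* 3)) (ι (sgn r)) (q ^ pentagonal r) ⟩
    - ι (sgn r) * (q ^ suc (r ℕ.* 3) * q ^ pentagonal r)  ≈⟨ *-cong (ι-sgn-suc r) (^-homo-* q (suc (r ℕ.* 3)) (pentagonal r)) ⟨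
    ι (sgn (suc r)) * q ^ pentagonal (suc r)              ∎

  F-pentagonal₁ : ∀ r → F (1 ℕ.+ r ℕ.* 3) ≈ ι (sgn r) * q ^ (pentagonal r ℕ.+ r)
  F-pentagonal₁ zero = trans (+-cong (*-identityʳ _) (trans (+-identityʳ _) (zeroʳ _))) (+-identityʳ _)
  F-pentagonal₁ (suc r) = begin
    F (4 ℕ.+ r ℕ.* 3)                          ≈⟨ F-step (1 ℕ.+ r ℕ.* 3) ⟩
    - (q ^ a * F (1 ℕ.+ r ℕ.* 3))              ≈⟨ -‿cong (*-congˡ (F-pentagonal₁ r)) ⟩
    - (q ^ a * (ι (sgn r) * q ^ b))            ≈⟨ solve 3 (λ x s y → :- (x :* (s :* y)) := :- s :* (x :* y)) refl (q ^ a) (ι (sgn r)) (q ^ b) ⟩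
    - ι (sgn r) * (q ^ a * q ^ b)              ≈⟨ *-cong (sym (ι-sgn-suc r)) (trans (sym (^-homo-* q a b)) (^-≡ q exponent)) ⟩
    ι (sgn (suc r)) * q ^ (pentagonal (suc r) ℕ.+ suc r) ∎
    where
    a = suc (1 ℕ.+ r ℕ.* 3)
    b = pentagonal r ℕ.+ r
    exponent : a ℕ.+ b ≡ pentagonal (suc r) ℕ.+ suc r
    exponent = ℕsolve 2 (λ r x → ℕcon 2 ⊞ r ⊠ ℕcon 3 ⊞ (x ⊞ r) ⊜ ℕcon 1 ⊞ r ⊠ ℕcon 3 ⊞ x ⊞ (ℕcon 1 ⊞ r)) ≡.refl r (pentagonal r)
      where open ℕ.+-*-Solver using () renaming (solve to ℕsolve; con to ℕcon; _:+_ to _⊞_; _:*_ to _⊠_; _:=_ to _⊜_)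

  F-pentagonal₂ : ∀ r → F (2 ℕ.+ r ℕ.* 3) ≈ 0#
  F-pentagonal₂ zero = begin
    F 2                                        ≈⟨ F-tail 0 ⟩
    1# + (weightA 0 * (1# + q ^ 1 * 0#) + 0#)  ≈⟨ +-congˡ (trans (+-identityʳ _) (trans (*-congˡ (trans (+-congˡ (zeroʳ _)) (+-identityʳ _))) (*-identityʳ _))) ⟩
    1# + ι (sgn 1) * 1#                        ≈⟨ +-congˡ (trans (*-identityʳ _) (trans (ι-sgn-suc 0) (-‿cong 1-homo))) ⟩
    1# - 1#                                    ≈⟨ -‿inverseʳ 1# ⟩
    0#                                         ∎
  F-pentagonal₂ (suc r) = begin
    F (5 ℕ.+ r ℕ.* 3)                                          ≈⟨ F-step (2 ℕ.+ r ℕ.* 3) ⟩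
    - (q ^ suc (2 ℕ.+ r ℕ.* 3) * F (2 ℕ.+ r ℕ.* 3))            ≈⟨ -‿cong (trans (*-congˡ (F-pentagonal₂ r)) (zeroʳ _)) ⟩
    - 0#                                                       ≈⟨ -0#≈0# ⟩
    0#                                                         ∎
    where open Algebra.Properties.Ring ring using (-0#≈0#)

  private
    minus-multiple-zero : ∀ x y {z} → z ≈ 0# → x - y * z ≈ x
    minus-multiple-zero x y {z} z≈0 = begin
      x - y * z ≈⟨ +-congˡ (-‿cong (trans (*-congˡ z≈0) (zeroʳ y))) ⟩
      x - 0#    ≈⟨ trans (+-congˡ -0#≈0#) (+-identityʳ x) ⟩
      x         ∎
      where open Algebra.Properties.Ring ring using (-0#≈0#)

  -- For n = 3r + 3 both F_n and F_(n-2) contribute, which is the origin of the factor 1 + q^(r+1);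
  -- in the other residue classes one of the two vanishes.
  lucasSumA-3r : ∀ r → lucasSumA (2 ℕ.+ r ℕ.* 3) ≈ (ι (sgn (suc r)) * (1# + q ^ suc r)) * q ^ pentagonal (suc r)
  lucasSumA-3r r = begin
    lucasSumA (suc m)                             ≈⟨ lucasSumA≈ m ⟩
    F (suc (suc m)) - q ^ suc m * F m             ≈⟨ +-cong (F-pentagonal (suc r)) (-‿cong (*-congˡ (F-pentagonal₁ r))) ⟩
    S * Q - q ^ suc m * (s * q ^ (pentagonal r ℕ.+ r)) ≈⟨ +-cong (*-congʳ (ι-sgn-suc r)) (-‿cong (solve 3 (λ x s y → x :* (s :* y) := s :* (x :* y)) refl (q ^ suc m) s _)) ⟩
    - s * Q - s * (q ^ suc m * q ^ (pentagonal r ℕ.+ r)) ≈⟨ +-congˡ (-‿cong (*-congˡ (trans (sym (^-homo-* q (suc m) _)) (trans (^-≡ q exponent) (^-homo-* q (suc r) (pentagonal (suc r))))))) ⟩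
    - s * Q - s * (q ^ suc r * Q)                 ≈⟨ solve 3 (λ s Q x → :- s :* Q :- s :* (x :* Q) := (:- s :* (:1 :+ x)) :* Q) refl s Q (q ^ suc r) ⟩
    (- s * (1# + q ^ suc r)) * Q                  ≈⟨ *-congʳ (*-congʳ (ι-sgn-suc r)) ⟨
    (S * (1# + q ^ suc r)) * Q                    ∎
    where
    m = 1 ℕ.+ r ℕ.* 3
    s = ι (sgn r)
    S = ι (sgn (suc r))
    Q = q ^ pentagonal (suc r)
    exponent : suc m ℕ.+ (pentagonal r ℕ.+ r) ≡ suc r ℕ.+ pentagonal (suc r)
    exponent = ℕsolve 2 (λ r x → ℕcon 2 ⊞ r ⊠ ℕcon 3 ⊞ (x ⊞ r) ⊜ ℕcon 1 ⊞ r ⊞ (ℕcon 1 ⊞ r ⊠ ℕcon 3 ⊞ x)) ≡.refl r (pentagonal r)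
      where open ℕ.+-*-Solver using () renaming (solve to ℕsolve; con to ℕcon; _:+_ to _⊞_; _:*_ to _⊠_; _:=_ to _⊜_)

  lucasSumA-3r+1 : ∀ r → lucasSumA (r ℕ.* 3) ≈ ι (sgn r) * q ^ (pentagonal r ℕ.+ r)
  lucasSumA-3r+1 zero = trans (+-identityʳ _) (trans (sym 1-homo) (sym (*-identityʳ _)))
  lucasSumA-3r+1 (suc r) = begin
    lucasSumA (suc m)                  ≈⟨ lucasSumA≈ m ⟩
    F (suc (suc m)) - q ^ suc m * F m  ≈⟨ minus-multiple-zero _ _ (F-pentagonal₂ r) ⟩
    F (1 ℕ.+ suc r ℕ.* 3)              ≈⟨ F-pentagonal₁ (suc r) ⟩
    ι (sgn (suc r)) * q ^ (pentagonal (suc r) ℕ.+ suc r) ∎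
    where m = 2 ℕ.+ r ℕ.* 3

  lucasSumA-3r+2 : ∀ r → lucasSumA (1 ℕ.+ r ℕ.* 3) ≈ - ι (sgn r) * q ^ (suc (r ℕ.* 3) ℕ.+ pentagonal r)
  lucasSumA-3r+2 r = begin
    lucasSumA (suc m)                        ≈⟨ lucasSumA≈ m ⟩
    F (suc (suc m)) - q ^ suc m * F m        ≈⟨ +-cong (F-pentagonal₂ r) (-‿cong (*-congˡ (F-pentagonal r))) ⟩
    0# - q ^ suc m * (s * Q)                 ≈⟨ +-identityˡ _ ⟩
    - (q ^ suc m * (s * Q))                  ≈⟨ solve 3 (λ x s Q → :- (x :* (s :* Q)) := :- s :* (x :* Q)) refl (q ^ suc m) s Q ⟩
    - s * (q ^ suc m * Q)                    ≈⟨ *-congˡ (^-homo-* q (suc m) (pentagonal r)) ⟨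
    - s * q ^ (suc m ℕ.+ pentagonal r)       ∎
    where
    m = r ℕ.* 3
    s = ι (sgn r)
    Q = q ^ pentagonal r

  module _ {p : Carrier} (pq≈1 : p * q ≈ 1#) where

    lucasSumB-3r : ∀ r → lucasSumB p (2 ℕ.+ r ℕ.* 3) ≈
      (ι (sgn (suc r)) * (1# + q ^ (2 ℕ.* suc r))) * (q ^ pentagonal (suc r) * p ^ (2 ℕ.* suc r))
    lucasSumB-3r r = begin
      lucasSumB p (suc m)                        ≈⟨ lucasSumB≈ pq≈1 m ⟩
      F (suc (suc m)) - p * F m                  ≈⟨ +-cong (F-pentagonal (suc r)) (-‿cong (*-congˡ (F-pentagonal₁ r))) ⟩
      S * Q - p * (s * q ^ b)                    ≈⟨ +-cong (*-congʳ (ι-sgn-suc r)) (-‿cong (*-congˡ (*-congˡ (sym (*-identityʳ _))))) ⟩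
      -- The inserted 1 is p^c q^c with c = 2r + 1, chosen because b + c = `pentagonal (suc r)`
      -- brings both terms to the common power `Q`.
      - s * Q - p * (s * (q ^ b * 1#))           ≈⟨ +-congˡ (-‿cong (*-congˡ (*-congˡ (*-congˡ (inverse-^ pq≈1 (suc (r ℕ.+ r))))))) ⟨
      - s * Q - p * (s * (q ^ b * (p ^ c * q ^ c))) ≈⟨ solve 6 (λ s Q p x y z → :- s :* Q :- p :* (s :* (x :* (y :* z))) := :- s :* (Q :* :1 :+ (x :* z) :* (p :* y))) refl s Q p (q ^ b) (p ^ c) (q ^ c) ⟩
      - s * (Q * 1# + (q ^ b * q ^ c) * p ^ suc c)  ≈⟨ *-congˡ (+-cong (*-congˡ (sym (inverse-^ pq≈1 d))) (*-cong (trans (sym (^-homo-* q b c)) (^-≡ q exponent)) (^-≡ p (≡.sym 2r)))) ⟩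
      - s * (Q * (P * q ^ d) + Q * P)            ≈⟨ solve 4 (λ s Q P x → s :* (Q :* (P :* x) :+ Q :* P) := (s :* (:1 :+ x)) :* (Q :* P)) refl (- s) Q P (q ^ d) ⟩
      (- s * (1# + q ^ d)) * (Q * P)             ≈⟨ *-congʳ (*-congʳ (ι-sgn-suc r)) ⟨
      (S * (1# + q ^ d)) * (Q * P)               ∎
      where
      m = 1 ℕ.+ r ℕ.* 3
      b = pentagonal r ℕ.+ r
      c = suc (r ℕ.+ r)
      d = 2 ℕ.* suc r
      s = ι (sgn r)
      S = ι (sgn (suc r))
      Q = q ^ pentagonal (suc r)
      P = p ^ d
      open ℕ.+-*-Solver using () renaming (solve to ℕsolve; con to ℕcon; _:+_ to _⊞_; _:*_ to _⊠_; _:=_ to _⊜_)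
      exponent : b ℕ.+ c ≡ pentagonal (suc r)
      exponent = ℕsolve 2 (λ r x → x ⊞ r ⊞ (ℕcon 1 ⊞ (r ⊞ r)) ⊜ ℕcon 1 ⊞ r ⊠ ℕcon 3 ⊞ x) ≡.refl r (pentagonal r)
      2r : d ≡ suc c
      2r = ℕsolve 1 (λ r → ℕcon 2 ⊠ (ℕcon 1 ⊞ r) ⊜ ℕcon 2 ⊞ (r ⊞ r)) ≡.refl r

    lucasSumB-3r+1 : ∀ r → lucasSumB p (r ℕ.* 3) ≈ ι (sgn r) * q ^ (pentagonal r ℕ.+ r)
    lucasSumB-3r+1 zero = trans (+-identityʳ _) (trans (sym 1-homo) (sym (*-identityʳ _)))
    lucasSumB-3r+1 (suc r) = begin
      lucasSumB p (suc m)          ≈⟨ lucasSumB≈ pq≈1 m ⟩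
      F (suc (suc m)) - p * F m    ≈⟨ minus-multiple-zero _ _ (F-pentagonal₂ r) ⟩
      F (1 ℕ.+ suc r ℕ.* 3)        ≈⟨ F-pentagonal₁ (suc r) ⟩
      ι (sgn (suc r)) * q ^ (pentagonal (suc r) ℕ.+ suc r) ∎
      where m = 2 ℕ.+ r ℕ.* 3

    lucasSumB-3r+2 : ∀ r → lucasSumB p (1 ℕ.+ r ℕ.* 3) ≈ - ι (sgn r) * (q ^ pentagonal r * p ^ 1)
    lucasSumB-3r+2 r = begin
      lucasSumB p (suc m)          ≈⟨ lucasSumB≈ pq≈1 m ⟩
      F (suc (suc m)) - p * F m    ≈⟨ +-cong (F-pentagonal₂ r) (-‿cong (*-congˡ (F-pentagonal r))) ⟩
      0# - p * (s * Q)             ≈⟨ +-identityˡ _ ⟩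
      - (p * (s * Q))              ≈⟨ solve 3 (λ x s Q → :- (x :* (s :* Q)) := :- s :* (Q :* (x :* :1))) refl p s Q ⟩
      - s * (Q * p ^ 1)            ∎
      where
      m = r ℕ.* 3
      s = ι (sgn r)
      Q = q ^ pentagonal r

-- The trinomial sum in a ring where 1 - q^n squares to zero.

module RootOfUnity
  (R : CommutativeRing 0ℓ 0ℓ)
  (ℤ⟶R : ℤ.+-*-rawRing -Raw-AlmostCommutative⟶ fromCommutativeRing R)
  (q p : CommutativeRing.Carrier R)
  where

  open CommutativeRing R
  open LucasSums R ℤ⟶R q public

  module _
    (pq≈1 : p * q ≈ 1#)
    (n′ : ℕ)
    (e²≈0 : 1−q^ (suc n′) * 1−q^ (suc n′) ≈ 0#)
    (regular : ∀ k → 0 < k → k < suc n′ → ∀ x → 1−q^ k * x ≈ 0# → x ≈ 0#)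
    where

    n : ℕ
    n = suc n′

    e : Carrier
    e = 1−q^ n

    cancel : ∀ k → k < n′ → ∀ {x y} → 1−q^ (suc k) * x ≈ 1−q^ (suc k) * y → x ≈ y
    cancel k k<n′ {x} {y} eq = begin
      x            ≈⟨ solve 2 (λ x y → x := (x :- y) :+ y) refl x y ⟩
      (x - y) + y  ≈⟨ +-congʳ (regular (suc k) (s≤s z≤n) (s≤s k<n′) (x - y) (begin
        c * (x - y)    ≈⟨ solve 3 (λ c x y → c :* (x :- y) := c :* x :- c :* y) refl c x y ⟩
        c * x - c * y  ≈⟨ +-congʳ eq ⟩
        c * y - c * y  ≈⟨ -‿inverseʳ _ ⟩
        0#             ∎)) ⟩
      0# + y       ≈⟨ +-identityˡ y ⟩
      y            ∎
      where c = 1−q^ (suc k)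

    e² : ∀ x y → x + y * (e * e) ≈ x
    e² x y = trans (+-congˡ (trans (*-congˡ e²≈0) (zeroʳ y))) (+-identityʳ x)

    e*-zero : ∀ x → e * (e * x) ≈ 0#
    e*-zero x = trans (sym (*-assoc e e x)) (trans (*-congʳ e²≈0) (zeroˡ x))

    q^n≈ : q ^ n ≈ 1# - e
    q^n≈ = solve 1 (λ x → x := :1 :- (:1 :- x)) refl (q ^ n)

    e*q^n : e * q ^ n ≈ e
    e*q^n = trans (*-congˡ q^n≈) (trans (solve 1 (λ e → e :* (:1 :- e) := e :+ :- :1 :* (e :* e)) refl e) (e² e (- 1#)))

    e*q^ : ∀ c → e * q ^ (c ℕ.* n) ≈ e
    e*q^ zero = *-identityʳ e
    e*q^ (suc c) = begin
      e * q ^ (n ℕ.+ c ℕ.* n)         ≈⟨ *-congˡ (^-homo-* q n (c ℕ.* n)) ⟩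
      e * (q ^ n * q ^ (c ℕ.* n))     ≈⟨ *-assoc _ _ _ ⟨
      (e * q ^ n) * q ^ (c ℕ.* n)     ≈⟨ *-congʳ e*q^n ⟩
      e * q ^ (c ℕ.* n)               ≈⟨ e*q^ c ⟩
      e                               ∎

    e*p^ : ∀ c → e * p ^ (c ℕ.* n) ≈ e
    e*p^ c = begin
      e * P        ≈⟨ *-congʳ (e*q^ c) ⟨
      (e * Q) * P  ≈⟨ solve 3 (λ e Q P → (e :* Q) :* P := e :* (P :* Q)) refl e Q P ⟩
      e * (P * Q)  ≈⟨ trans (*-congˡ (inverse-^ pq≈1 (c ℕ.* n))) (*-identityʳ e) ⟩
      e            ∎
      where
      P = p ^ (c ℕ.* n)
      Q = q ^ (c ℕ.* n)

    ι-suc : ∀ c → ι (+ suc c) ≈ 1# + ι (+ c)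
    ι-suc c = trans (+-homo 1ℤ (+ c)) (+-congʳ 1-homo)

    ι-+ : ∀ a b → ι (+ (a ℕ.+ b)) ≈ ι (+ a) + ι (+ b)
    ι-+ a b = +-homo (+ a) (+ b)

    ι-* : ∀ a b → ι (+ (a ℕ.* b)) ≈ ι (+ a) * ι (+ b)
    ι-* a b = trans (reflexive (≡.cong ι (ℤ.pos-* a b))) (*-homo (+ a) (+ b))

    q^-multiple : ∀ c → q ^ (c ℕ.* n) ≈ 1# - ι (+ c) * e
    q^-multiple zero = begin
      1#               ≈⟨ solve 1 (λ e → :1 := :1 :- con 0ℤ :* e) refl e ⟩
      1# - ι 0ℤ * e    ∎
    q^-multiple (suc c) = begin
      q ^ (n ℕ.+ c ℕ.* n)          ≈⟨ ^-homo-* q n (c ℕ.* n) ⟩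
      q ^ n * q ^ (c ℕ.* n)        ≈⟨ *-cong q^n≈ (q^-multiple c) ⟩
      (1# - e) * (1# - ι (+ c) * e) ≈⟨ solve 2 (λ e c → (:1 :- e) :* (:1 :- c :* e) := (:1 :- (:1 :+ c) :* e) :+ c :* (e :* e)) refl e (ι (+ c)) ⟩
      (1# - (1# + ι (+ c)) * e) + ι (+ c) * (e * e) ≈⟨ e² _ _ ⟩
      1# - (1# + ι (+ c)) * e      ≈⟨ +-congˡ (-‿cong (*-congʳ (ι-suc c))) ⟨
      1# - ι (+ suc c) * e         ∎

    1−q^-multiple : ∀ c → 1−q^ (c ℕ.* n) ≈ ι (+ c) * e
    1−q^-multiple c = trans (+-congˡ (-‿cong (q^-multiple c))) (solve 2 (λ e c → :1 :- (:1 :- c :* e) := c :* e) refl e (ι (+ c)))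

    -- Absorption makes (1 - q^(k+1)) [n, k+1] a multiple of e, which e kills; regularity removes
    -- the factor.
    e*gb-n : ∀ k → k < n′ → e * gb n (suc k) ≈ 0#
    e*gb-n k k<n′ = regular (suc k) (s≤s z≤n) (s≤s k<n′) _ (begin
      y * (e * gb n (suc k))  ≈⟨ solve 3 (λ y e g → y :* (e :* g) := e :* (y :* g)) refl y e (gb n (suc k)) ⟩
      e * (y * gb n (suc k))  ≈⟨ *-congˡ (gb-absorb n′ k) ⟩
      e * (e * gb n′ k)       ≈⟨ e*-zero _ ⟩
      0#                      ∎)
      where y = 1−q^ (suc k)

    -- The q-Lucas congruence in the range k < n. The Pascal recursions in a run in parallel on both
    -- sides, so only a = 0 has content, and that is `e*gb-n`.
    e*gb-+n : ∀ a k → k < n → e * gb (a ℕ.+ n) k ≈ e * gb a k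
    e*gb-+n a zero _ = refl
    e*gb-+n zero (suc k) (s≤s k<n′) = trans (e*gb-n k k<n′) (sym (zeroʳ e))
    e*gb-+n (suc a) (suc k) k<n = begin
      e * (gb (a ℕ.+ n) k + Q * gb (a ℕ.+ n) (suc k))
        ≈⟨ solve 4 (λ e x Q y → e :* (x :+ Q :* y) := e :* x :+ Q :* (e :* y)) refl e _ Q _ ⟩
      e * gb (a ℕ.+ n) k + Q * (e * gb (a ℕ.+ n) (suc k))
        ≈⟨ +-cong (e*gb-+n a k (ℕ.<-trans (ℕ.n<1+n k) k<n)) (*-congˡ (e*gb-+n a (suc k) k<n)) ⟩
      e * gb a k + Q * (e * gb a (suc k))
        ≈⟨ solve 4 (λ e x Q y → e :* (x :+ Q :* y) := e :* x :+ Q :* (e :* y)) refl e (gb a k) Q (gb a (suc k)) ⟨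
      e * (gb a k + Q * gb a (suc k)) ∎
      where Q = q ^ suc k

    e*gb-period : ∀ c a k → k < n → e * gb (a ℕ.+ c ℕ.* n) k ≈ e * gb a k
    e*gb-period zero a k _ = *-congˡ (reflexive (≡.cong (λ i → gb i k) (ℕ.+-identityʳ a)))
    e*gb-period (suc c) a k k<n = begin
      e * gb (a ℕ.+ (n ℕ.+ c ℕ.* n)) k ≈⟨ *-congˡ (reflexive (≡.cong (λ i → gb i k) (≡.trans (≡.cong (a ℕ.+_) (ℕ.+-comm n (c ℕ.* n))) (≡.sym (ℕ.+-assoc a (c ℕ.* n) n))))) ⟩
      e * gb (a ℕ.+ c ℕ.* n ℕ.+ n) k   ≈⟨ e*gb-+n (a ℕ.+ c ℕ.* n) k k<n ⟩
      e * gb (a ℕ.+ c ℕ.* n) k         ≈⟨ e*gb-period c a k k<n ⟩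
      e * gb a k                       ∎

    -- Each binomial becomes a multiple of e once multiplied by 1 - q^k for its own lower index k.
    -- Together they give e², and both multipliers are regular because both lower indices lie
    -- strictly between 0 and n.
    gb-multiple*gb-n : ∀ c j → j < n′ → gb (c ℕ.* n) (suc j) * gb n (n ∸ suc j) ≈ 0#
    gb-multiple*gb-n zero j _ = zeroˡ _
    gb-multiple*gb-n (suc c) j j<n′ = cancel j j<n′ (cancel (n′ ∸ suc j) (ℕ.∸-monoʳ-< {o = 0} (s≤s z≤n) j<n′) (begin
      y′ * (y * (gb (suc a) (suc j) * gb n (n ∸ suc j)))
        ≈⟨ solve 4 (λ y′ y g h → y′ :* (y :* (g :* h)) := (y :* g) :* (y′ :* h)) refl y′ y (gb (suc a) (suc j)) (gb n (n ∸ suc j)) ⟩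
      (y * gb (suc a) (suc j)) * (y′ * gb n (n ∸ suc j))
        ≈⟨ *-cong (trans (gb-absorb a j) (*-congʳ (1−q^-multiple (suc c))))
             (trans (*-congˡ (reflexive (≡.cong (gb n) (ℕ.+-∸-assoc 1 j<n′)))) (gb-absorb n′ (n′ ∸ suc j))) ⟩
      ((ι (+ suc c) * e) * gb a j) * (e * gb n′ (n′ ∸ suc j))
        ≈⟨ solve 4 (λ c e g h → ((c :* e) :* g) :* (e :* h) := (c :* g :* h) :* (e :* e)) refl (ι (+ suc c)) e (gb a j) (gb n′ (n′ ∸ suc j)) ⟩
      (ι (+ suc c) * gb a j * gb n′ (n′ ∸ suc j)) * (e * e)
        ≈⟨ trans (*-congˡ e²≈0) (zeroʳ _) ⟩
      0#
        ≈⟨ trans (*-congˡ (zeroʳ y)) (zeroʳ y′) ⟨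
      y′ * (y * 0#) ∎))
      where
      a = n′ ℕ.+ c ℕ.* n
      y = 1−q^ (suc j)
      y′ = 1−q^ (suc (n′ ∸ suc j))

    -- Vandermonde for cn + n keeps only its two ends: a power of q equal to 1 - cn e at j = 0, and
    -- [cn, n] at j = n. Each step thus adds 1 to the value and cn to the coefficient of -e, which
    -- accumulates to n C(c,2).
    gb-multiple : ∀ c → gb (c ℕ.* n) n ≈ ι (+ c) - ι (+ (n ℕ.* tri c)) * e
    gb-multiple zero = begin
      0#                               ≈⟨ 0-homo ⟨
      ι 0ℤ                             ≈⟨ solve 1 (λ e → con 0ℤ := con 0ℤ :- con 0ℤ :* e) refl e ⟩
      ι 0ℤ - ι 0ℤ * e                  ≈⟨ +-congˡ (-‿cong (*-congʳ (reflexive (≡.cong (λ i → ι (+ i)) (ℕ.*-zeroʳ n))))) ⟨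
      ι 0ℤ - ι (+ (n ℕ.* 0)) * e       ∎
    gb-multiple (suc c) = begin
      gb (n ℕ.+ c ℕ.* n) n
        ≈⟨ reflexive (≡.cong (λ i → gb i n) (ℕ.+-comm n (c ℕ.* n))) ⟩
      gb (c ℕ.* n ℕ.+ n) n
        ≈⟨ vandermonde (c ℕ.* n) n n ⟩
      f 0 + sum n (λ j → f (suc j))
        ≈⟨ +-congˡ (sum-last n′ (λ j → f (suc j))) ⟩
      f 0 + (sum n′ (λ j → f (suc j)) + f n)
        ≈⟨ +-cong f0 (+-cong (sum-zero n′ (λ j j<n′ → trans (*-congˡ (gb-multiple*gb-n c j j<n′)) (zeroʳ _))) fn) ⟩
      (1# - ι (+ (c ℕ.* n)) * e) + (0# + (ι (+ c) - ι (+ (n ℕ.* tri c)) * e))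
        ≈⟨ +-congˡ (+-identityˡ _) ⟩
      (1# - ι (+ (c ℕ.* n)) * e) + (ι (+ c) - ι (+ (n ℕ.* tri c)) * e)
        ≈⟨ solve 4 (λ e u c v → (:1 :- u :* e) :+ (c :- v :* e) := (:1 :+ c) :- (u :+ v) :* e) refl e (ι (+ (c ℕ.* n))) (ι (+ c)) (ι (+ (n ℕ.* tri c))) ⟩
      (1# + ι (+ c)) - (ι (+ (c ℕ.* n)) + ι (+ (n ℕ.* tri c))) * e
        ≈⟨ +-cong (ι-suc c) (-‿cong (*-congʳ (ι-+ (c ℕ.* n) (n ℕ.* tri c)))) ⟨
      ι (+ suc c) - ι (+ (c ℕ.* n ℕ.+ n ℕ.* tri c)) * e
        ≈⟨ +-congˡ (-‿cong (*-congʳ (reflexive (≡.cong (λ i → ι (+ i))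
             (≡.trans (≡.cong (ℕ._+ n ℕ.* tri c) (ℕ.*-comm c n)) (≡.sym (ℕ.*-distribˡ-+ n c (tri c)))))))) ⟩
      ι (+ suc c) - ι (+ (n ℕ.* tri (suc c))) * e ∎
      where
      f : ℕ → Carrier
      f j = q ^ ((c ℕ.* n ∸ j) ℕ.* (n ∸ j)) * (gb (c ℕ.* n) j * gb n (n ∸ j))

      f0 : f 0 ≈ 1# - ι (+ (c ℕ.* n)) * e
      f0 = begin
        q ^ (c ℕ.* n ℕ.* n) * (1# * gb n n) ≈⟨ *-cong (q^-multiple (c ℕ.* n)) (trans (*-identityˡ _) (gb-diag n)) ⟩
        (1# - ι (+ (c ℕ.* n)) * e) * 1#     ≈⟨ *-identityʳ _ ⟩
        1# - ι (+ (c ℕ.* n)) * e            ∎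

      fn : f n ≈ ι (+ c) - ι (+ (n ℕ.* tri c)) * e
      fn = begin
        q ^ ((c ℕ.* n ∸ n) ℕ.* (n ∸ n)) * (gb (c ℕ.* n) n * gb n (n ∸ n))
          ≈⟨ reflexive (≡.cong (λ d → q ^ ((c ℕ.* n ∸ n) ℕ.* d) * (gb (c ℕ.* n) n * gb n d)) (ℕ.n∸n≡0 n)) ⟩
        q ^ ((c ℕ.* n ∸ n) ℕ.* 0) * (gb (c ℕ.* n) n * 1#)
          ≈⟨ *-cong (^-≡ q (ℕ.*-zeroʳ (c ℕ.* n ∸ n))) (*-identityʳ _) ⟩
        1# * gb (c ℕ.* n) n
          ≈⟨ trans (*-identityˡ _) (gb-multiple c) ⟩
        ι (+ c) - ι (+ (n ℕ.* tri c)) * e ∎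

    -- Since e [n, i+1] = 0, the Pascal rule gives [n-1, i+1] = -q^(-(i+1)) [n-1, i] next to e;
    -- iterate from [n-1, 0] = 1.
    e*gb-pred : ∀ i → i ≤ n′ → e * gb n′ i ≈ e * (ι (sgn i) * p ^ tri (suc i))
    e*gb-pred zero _ = *-congˡ (sym (trans (*-identityʳ _) 1-homo))
    e*gb-pred (suc i) i<n′ = begin
      e * g′                           ≈⟨ *-congˡ (trans (*-congʳ (inverse-^ pq≈1 (suc i))) (*-identityˡ g′)) ⟨
      e * ((P * Q) * g′)               ≈⟨ solve 5 (λ e P Q g g′ → e :* ((P :* Q) :* g′) := P :* (e :* (g :+ Q :* g′)) :- P :* (e :* g)) refl e P Q g g′ ⟩
      P * (e * gb n (suc i)) - P * (e * g) ≈⟨ +-cong (trans (*-congˡ (e*gb-n i i<n′)) (zeroʳ P)) (-‿cong (*-congˡ (e*gb-pred i (ℕ.<⇒≤ i<n′)))) ⟩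
      0# - P * (e * (ι (sgn i) * p ^ tri (suc i))) ≈⟨ +-identityˡ _ ⟩
      - (P * (e * (ι (sgn i) * p ^ tri (suc i))))  ≈⟨ solve 4 (λ P e s x → :- (P :* (e :* (s :* x))) := e :* (:- s :* (P :* x))) refl P e (ι (sgn i)) (p ^ tri (suc i)) ⟩
      e * (- ι (sgn i) * (P * p ^ tri (suc i)))    ≈⟨ *-congˡ (*-cong (ι-sgn-suc i) (^-homo-* p (suc i) (tri (suc i)))) ⟨
      e * (ι (sgn (suc i)) * p ^ tri (suc (suc i))) ∎
      where
      P = p ^ suc i
      Q = q ^ suc i
      g = gb n′ i
      g′ = gb n′ (suc i)

    C : Carrier
    C = ι (sgn n) * q ^ tri (suc n)

    -- The case i = n - 1 of `e*gb-pred`, where the binomial is 1, says that (-1)^(n-1) q^(-C(n,2))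
    -- acts as 1 on e. This avoids distinguishing even and odd n.
    e*C : e * C ≈ - e
    e*C = begin
      e * (ι (sgn n) * q ^ (n ℕ.+ tri n))  ≈⟨ *-congˡ (*-cong (ι-sgn-suc n′) (^-homo-* q n (tri n))) ⟩
      e * (- s * (q ^ n * Q))              ≈⟨ solve 4 (λ e s x Q → e :* (:- s :* (x :* Q)) := :- ((e :* x) :* (s :* Q))) refl e s (q ^ n) Q ⟩
      - ((e * q ^ n) * (s * Q))            ≈⟨ -‿cong (*-congʳ (trans e*q^n top)) ⟩
      - ((e * (s * P)) * (s * Q))          ≈⟨ solve 4 (λ e s P Q → :- ((e :* (s :* P)) :* (s :* Q)) := :- (e :* ((s :* s) :* (P :* Q)))) refl e s P Q ⟩
      - (e * ((s * s) * (P * Q)))          ≈⟨ -‿cong (*-congˡ (trans (*-cong (ι-sgn² n′) (inverse-^ pq≈1 (tri n))) (*-identityˡ 1#))) ⟩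
      - (e * 1#)                           ≈⟨ -‿cong (*-identityʳ e) ⟩
      - e                                  ∎
      where
      s = ι (sgn n′)
      P = p ^ tri n
      Q = q ^ tri n
      top : e ≈ e * (s * P)
      top = trans (sym (trans (*-congˡ (gb-diag n′)) (*-identityʳ e))) (e*gb-pred n′ ℕ.≤-refl)

    -- Next to e one has q^n = 1, so 1 - q^(a+i+1) = -q^(a+i+1) (1 - q^(n-1-a-i)). Rewriting each
    -- numerator factor in this way reverses the numerator of [a+i, i] into that of [n-1-a, i] and
    -- collects the sign and the power of q.
    e*gb-reflect : ∀ a i → i ≤ n′ → a ≤ n′ →
      e * gb (a ℕ.+ i) i ≈ e * ((ι (sgn i) * q ^ (a ℕ.* i ℕ.+ tri (suc i))) * gb (n′ ∸ a) i)
    e*gb-reflect a zero _ _ = *-congˡ (sym (trans (*-identityʳ _) (trans (*-congˡ (^-≡ q (≡.trans (ℕ.+-identityʳ (a ℕ.* 0)) (ℕ.*-zeroʳ a)))) (trans (*-identityʳ _) 1-homo))))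
    e*gb-reflect a (suc i) i<n′ a≤n′ = cancel i i<n′ (begin
      y * (e * gb (a ℕ.+ suc i) (suc i))
        ≈⟨ *-congˡ (*-congˡ (reflexive (≡.cong (λ k → gb k (suc i)) (ℕ.+-suc a i)))) ⟩
      y * (e * gb (suc (a ℕ.+ i)) (suc i))
        ≈⟨ solve 3 (λ y e g → y :* (e :* g) := e :* (y :* g)) refl y e _ ⟩
      e * (y * gb (suc (a ℕ.+ i)) (suc i))
        ≈⟨ *-congˡ (gb-absorb (a ℕ.+ i) i) ⟩
      e * ((1# - Q) * gb (a ℕ.+ i) i)
        ≈⟨ solve 3 (λ e z g → e :* (z :* g) := z :* (e :* g)) refl e _ _ ⟩
      (1# - Q) * (e * gb (a ℕ.+ i) i)
        ≈⟨ *-congˡ (e*gb-reflect a i (ℕ.<⇒≤ i<n′) a≤n′) ⟩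
      (1# - Q) * (e * ((s * x) * g))
        ≈⟨ solve 5 (λ Q e s x g → (:1 :- Q) :* (e :* ((s :* x) :* g)) := (s :* x) :* ((e :* (:1 :- Q)) :* g)) refl Q e s x g ⟩
      (s * x) * ((e * (1# - Q)) * g)
        ≈⟨ *-congˡ (gb-weight (n′ ∸ a) i reflected) ⟩
      (s * x) * ((- (e * (Q * y′))) * g)
        ≈⟨ solve 6 (λ s x e Q y′ g → (s :* x) :* ((:- (e :* (Q :* y′))) :* g) := e :* ((:- s :* (Q :* x)) :* (y′ :* g))) refl s x e Q y′ g ⟩
      e * ((- s * (Q * x)) * (y′ * g))
        ≈⟨ *-congˡ (*-cong (*-cong (sym (ι-sgn-suc i)) (trans (sym (^-homo-* q (suc (a ℕ.+ i)) (a ℕ.* i ℕ.+ tri (suc i)))) (^-≡ q exponent)))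
                           (sym (gb-absorb₂ (n′ ∸ a) i))) ⟩
      e * ((ι (sgn (suc i)) * q ^ (a ℕ.* suc i ℕ.+ tri (suc (suc i)))) * (y * gb (n′ ∸ a) (suc i)))
        ≈⟨ solve 4 (λ e u y g → e :* (u :* (y :* g)) := y :* (e :* (u :* g))) refl e _ y (gb (n′ ∸ a) (suc i)) ⟩
      y * (e * ((ι (sgn (suc i)) * q ^ (a ℕ.* suc i ℕ.+ tri (suc (suc i)))) * gb (n′ ∸ a) (suc i))) ∎)
      where
      y = 1−q^ (suc i)
      y′ = 1−q^ (n′ ∸ a ∸ i)
      Q = q ^ suc (a ℕ.+ i)
      s = ι (sgn i)
      x = q ^ (a ℕ.* i ℕ.+ tri (suc i))
      g = gb (n′ ∸ a) i
      exponent : suc (a ℕ.+ i) ℕ.+ (a ℕ.* i ℕ.+ tri (suc i)) ≡ a ℕ.* suc i ℕ.+ tri (suc (suc i))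
      exponent = ℕsolve 3 (λ a i t → ℕcon 1 ⊞ (a ⊞ i) ⊞ (a ⊠ i ⊞ t) ⊜ a ⊠ (ℕcon 1 ⊞ i) ⊞ (ℕcon 1 ⊞ i ⊞ t)) ≡.refl a i (tri (suc i))
        where open ℕ.+-*-Solver using () renaming (solve to ℕsolve; con to ℕcon; _:+_ to _⊞_; _:*_ to _⊠_; _:=_ to _⊜_)
      reflected : i ≤ n′ ∸ a → e * (1# - Q) ≈ - (e * (Q * y′))
      reflected i≤ = sym (begin
        - (e * (Q * (1# - q ^ (n′ ∸ a ∸ i))))    ≈⟨ solve 3 (λ e Q z → :- (e :* (Q :* (:1 :- z))) := e :* (Q :* z) :- e :* Q) refl e Q _ ⟩
        e * (Q * q ^ (n′ ∸ a ∸ i)) - e * Q       ≈⟨ +-congʳ (*-congˡ (trans (sym (^-homo-* q (suc (a ℕ.+ i)) (n′ ∸ a ∸ i))) (^-≡ q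
              (≡.cong suc (≡.trans (ℕ.+-assoc a i _) (≡.trans (≡.cong (a ℕ.+_) (ℕ.m+[n∸m]≡n i≤)) (ℕ.m+[n∸m]≡n a≤n′))))))) ⟩
        e * q ^ n - e * Q                        ≈⟨ +-congʳ e*q^n ⟩
        e - e * Q                                ≈⟨ solve 2 (λ e Q → e :- e :* Q := e :* (:1 :- Q)) refl e Q ⟩
        e * (1# - Q)                             ∎)

    -- Absorption, with 1 - q^(2j) = (1 - q^j) (1 + q^j). The factor 1 + q^j becomes the two weights
    -- in `lucasTerm`.
    gb-central : ∀ i → i < n′ → gb (2 ℕ.* suc i) (suc i) ≈ (1# + q ^ suc i) * gb (suc i ℕ.+ i) i
    gb-central i i<n′ = cancel i i<n′ (begin
      y * gb (2 ℕ.* suc i) (suc i)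
        ≈⟨ *-congˡ (reflexive (≡.cong (λ k → gb k (suc i)) 2i)) ⟩
      y * gb (suc (suc i ℕ.+ i)) (suc i)
        ≈⟨ gb-absorb (suc i ℕ.+ i) i ⟩
      1−q^ (suc (suc i ℕ.+ i)) * g
        ≈⟨ *-congʳ (reflexive (≡.cong 1−q^ (≡.sym (ℕ.+-suc (suc i) i)))) ⟩
      1−q^ (suc i ℕ.+ suc i) * g
        ≈⟨ *-congʳ (1−q^-+ (suc i) (suc i)) ⟩
      (y + Q * y) * g
        ≈⟨ solve 3 (λ y Q g → (y :+ Q :* y) :* g := y :* ((:1 :+ Q) :* g)) refl y Q g ⟩
      y * ((1# + Q) * g) ∎)
      where
      y = 1−q^ (suc i)
      Q = q ^ suc i
      g = gb (suc i ℕ.+ i) i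
      2i : 2 ℕ.* suc i ≡ suc (suc i ℕ.+ i)
      2i = ≡.trans (≡.cong (suc i ℕ.+_) (ℕ.+-identityʳ (suc i))) (ℕ.+-suc (suc i) i)

    -- The exponent cnk - C(k,2) is split into a power of q and a power of p, so that no truncated
    -- subtraction of exponents enters the computation.
    term : ℕ → ℕ → Carrier
    term c k = (ι (sgn k) * (q ^ (c ℕ.* n ℕ.* k) * p ^ tri k)) * (gb (c ℕ.* n) k * gb (2 ℕ.* (c ℕ.* n) ∸ 2 ℕ.* k) (n ∸ k))

    lucasTerm : ℕ → Carrier
    lucasTerm i = weightA i * lucas n′ i + (weightA i * p ^ suc i) * lucas n′ i

    -- The summand has index k + 1 and its reflected index is j = i + 1, the two adding up to n.
    -- Keeping both as variables avoids subtraction.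
    module _ (c k i : ℕ) (k+1+i≡n′ : k ℕ.+ suc i ≡ n′) where

      private
        central y y′ s g pʲ qʲ : Carrier
        central = gb (2 ℕ.* suc i) (suc i)
        y = 1−q^ (suc k)
        y′ = 1−q^ (suc i)
        s = ι (sgn i)
        g = gb (n′ ∸ suc i) i
        pʲ = p ^ suc i
        qʲ = q ^ suc i

        i<n′ : i < n′
        i<n′ = ≡.subst (suc i ≤_) k+1+i≡n′ (ℕ.m≤n+m (suc i) k)

        k<n′ : k < n′
        k<n′ = ≡.subst (suc k ≤_) (≡.trans (≡.sym (ℕ.+-suc k i)) k+1+i≡n′) (s≤s (ℕ.m≤m+n k i))

        n∸k : n ∸ suc k ≡ suc i
        n∸k = ≡.trans (≡.cong (_∸ k) (≡.sym k+1+i≡n′)) (ℕ.m+n∸m≡n k (suc i))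

        top : 2 ℕ.* (suc c ℕ.* n) ∸ 2 ℕ.* suc k ≡ 2 ℕ.* suc i ℕ.+ 2 ℕ.* c ℕ.* n
        top = ≡.trans (≡.cong (_∸ 2 ℕ.* suc k) (≡.trans
            (ℕsolve 2 (λ c n → ℕcon 2 ⊠ (n ⊞ c ⊠ n) ⊜ ℕcon 2 ⊠ c ⊠ n ⊞ ℕcon 2 ⊠ n) ≡.refl c n)
            (≡.trans (≡.cong (λ m → 2 ℕ.* c ℕ.* n ℕ.+ 2 ℕ.* suc m) (≡.sym k+1+i≡n′))
            (ℕsolve 3 (λ x k i → x ⊞ ℕcon 2 ⊠ (ℕcon 1 ⊞ (k ⊞ (ℕcon 1 ⊞ i))) ⊜ ℕcon 2 ⊠ (ℕcon 1 ⊞ i) ⊞ x ⊞ ℕcon 2 ⊠ (ℕcon 1 ⊞ k)) ≡.refl (2 ℕ.* c ℕ.* n) k i))))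
            (ℕ.m+n∸n≡m (2 ℕ.* suc i ℕ.+ 2 ℕ.* c ℕ.* n) (2 ℕ.* suc k))
          where open ℕ.+-*-Solver using () renaming (solve to ℕsolve; con to ℕcon; _:+_ to _⊞_; _:*_ to _⊠_; _:=_ to _⊜_)

      -- With m = `suc c`, absorbing 1 - q^(k+1) into [mn, k+1] produces m e. Next to e the upper
      -- indices reduce modulo n, and [mn-1, k] becomes [n-1, k]. Its value from `e*gb-pred`
      -- supplies the second power of p, and its sign combines with that of the summand to -1.
      term-residue : y * term (suc c) (suc k) ≈ ι (+ suc c) * (- (e * ((p ^ tri (suc k) * p ^ tri (suc k)) * central)))
      term-residue = begin
        y * ((S * (Q * P)) * (gb (suc a) (suc k) * gb (2 ℕ.* (suc c ℕ.* n) ∸ 2 ℕ.* suc k) (n ∸ suc k)))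
          ≈⟨ *-congˡ (*-congˡ (*-congˡ (reflexive (≡.cong₂ gb top n∸k)))) ⟩
        y * ((S * (Q * P)) * (gb (suc a) (suc k) * h))
          ≈⟨ solve 6 (λ y S Q P u h → y :* ((S :* (Q :* P)) :* (u :* h)) := (S :* (Q :* P)) :* ((y :* u) :* h)) refl y S Q P (gb (suc a) (suc k)) h ⟩
        (S * (Q * P)) * ((y * gb (suc a) (suc k)) * h)
          ≈⟨ *-congˡ (*-congʳ (trans (gb-absorb a k) (*-congʳ (1−q^-multiple (suc c))))) ⟩
        (S * (Q * P)) * (((c′ * e) * gb a k) * h)
          ≈⟨ solve 7 (λ S Q P c′ e u h → (S :* (Q :* P)) :* (((c′ :* e) :* u) :* h) := (c′ :* S :* P :* u :* h) :* (e :* Q)) refl S Q P c′ e (gb a k) h ⟩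
        (c′ * S * P * gb a k * h) * (e * Q)
          ≈⟨ *-congˡ (trans (*-congˡ (^-≡ q (≡.trans (ℕ.*-assoc (suc c) n (suc k)) (≡.trans (≡.cong (suc c ℕ.*_) (ℕ.*-comm n (suc k))) (≡.sym (ℕ.*-assoc (suc c) (suc k) n)))))) (e*q^ (suc c ℕ.* suc k))) ⟩
        (c′ * S * P * gb a k * h) * e
          ≈⟨ solve 6 (λ c S P u h e → (c :* S :* P :* u :* h) :* e := (c :* S :* P :* u) :* (e :* h)) refl c′ S P (gb a k) h e ⟩
        (c′ * S * P * gb a k) * (e * h)
          ≈⟨ *-congˡ (e*gb-period (2 ℕ.* c) (2 ℕ.* suc i) (suc i) (s≤s i<n′)) ⟩
        (c′ * S * P * gb a k) * (e * central)
          ≈⟨ solve 6 (λ c S P u central e → (c :* S :* P :* u) :* (e :* central) := (c :* S :* P :* central) :* (e :* u)) refl c′ S P (gb a k) central e ⟩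
        (c′ * S * P * central) * (e * gb a k)
          ≈⟨ *-congˡ (trans (e*gb-period c n′ k (s≤s (ℕ.<⇒≤ k<n′))) (e*gb-pred k (ℕ.<⇒≤ k<n′))) ⟩
        (c′ * S * P * central) * (e * (S′ * P))
          ≈⟨ *-congʳ (*-congʳ (*-congʳ (*-congˡ (ι-sgn-suc k)))) ⟩
        (c′ * (- S′) * P * central) * (e * (S′ * P))
          ≈⟨ solve 5 (λ c S P central e → (c :* (:- S) :* P :* central) :* (e :* (S :* P)) := (S :* S) :* (c :* :- (e :* ((P :* P) :* central)))) refl c′ S′ P central e ⟩
        (S′ * S′) * (c′ * - (e * ((P * P) * central)))
          ≈⟨ trans (*-congʳ (ι-sgn² k)) (*-identityˡ _) ⟩
        c′ * - (e * ((P * P) * central)) ∎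
        where
        a = n′ ℕ.+ c ℕ.* n
        c′ = ι (+ suc c)
        S = ι (sgn (suc k))
        S′ = ι (sgn k)
        Q = q ^ (suc c ℕ.* n ℕ.* suc k)
        P = p ^ tri (suc k)
        h = gb (2 ℕ.* suc i ℕ.+ 2 ℕ.* c ℕ.* n) (suc i)

      -- With k + 1 = n - j, the exponent k(k+1) is congruent to j(j+1) modulo n. The multiples
      -- (j+1) n and (k+1) n, which e ignores, turn this congruence into an equation of natural
      -- numbers.
      e*p^tri : e * (p ^ tri (suc k) * p ^ tri (suc k)) ≈ e * p ^ (suc i ℕ.* suc (suc i))
      e*p^tri = begin
        e * (p ^ tri (suc k) * p ^ tri (suc k))      ≈⟨ *-congˡ (^-homo-* p (tri (suc k)) (tri (suc k))) ⟨
        e * P                                        ≈⟨ *-congʳ (e*p^ (suc (suc i))) ⟨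
        (e * p ^ (suc (suc i) ℕ.* n)) * P            ≈⟨ trans (*-assoc _ _ _) (*-congˡ (sym (^-homo-* p (suc (suc i) ℕ.* n) _))) ⟩
        e * p ^ (suc (suc i) ℕ.* n ℕ.+ (tri (suc k) ℕ.+ tri (suc k))) ≈⟨ *-congˡ (^-≡ p exponent) ⟩
        e * p ^ (suc k ℕ.* n ℕ.+ suc i ℕ.* suc (suc i))  ≈⟨ trans (*-congˡ (^-homo-* p (suc k ℕ.* n) (suc i ℕ.* suc (suc i)))) (sym (*-assoc _ _ _)) ⟩
        (e * p ^ (suc k ℕ.* n)) * p ^ (suc i ℕ.* suc (suc i)) ≈⟨ *-congʳ (e*p^ (suc k)) ⟩
        e * p ^ (suc i ℕ.* suc (suc i))              ∎
        where
        P = p ^ (tri (suc k) ℕ.+ tri (suc k))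
        2tri : tri (suc k) ℕ.+ tri (suc k) ≡ suc k ℕ.* k
        2tri = ≡.trans (≡.trans (≡.cong (tri (suc k) ℕ.+_) (≡.sym (ℕ.+-identityʳ _))) (ℕ.*-comm 2 (tri (suc k)))) (tri*2 (suc k))
        exponent : suc (suc i) ℕ.* n ℕ.+ (tri (suc k) ℕ.+ tri (suc k)) ≡ suc k ℕ.* n ℕ.+ suc i ℕ.* suc (suc i)
        exponent = ≡.trans (≡.cong (suc (suc i) ℕ.* n ℕ.+_) 2tri)
          (≡.subst (λ m → suc (suc i) ℕ.* suc m ℕ.+ suc k ℕ.* k ≡ suc k ℕ.* suc m ℕ.+ suc i ℕ.* suc (suc i)) k+1+i≡n′
          (ℕsolve 2 (λ k i → (ℕcon 2 ⊞ i) ⊠ (ℕcon 1 ⊞ (k ⊞ (ℕcon 1 ⊞ i))) ⊞ (ℕcon 1 ⊞ k) ⊠ k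
                           ⊜ (ℕcon 1 ⊞ k) ⊠ (ℕcon 1 ⊞ (k ⊞ (ℕcon 1 ⊞ i))) ⊞ (ℕcon 1 ⊞ i) ⊠ (ℕcon 2 ⊞ i)) ≡.refl k i))
          where open ℕ.+-*-Solver using () renaming (solve to ℕsolve; con to ℕcon; _:+_ to _⊞_; _:*_ to _⊠_; _:=_ to _⊜_)

      -- Next to e, q^(k+1) = q^(n-j) is the inverse of q^j.
      e*y : e * y ≈ - (e * (pʲ * y′))
      e*y = begin
        e * (1# - q ^ suc k)             ≈⟨ solve 2 (λ e x → e :* (:1 :- x) := e :- (e :* x) :* :1) refl e (q ^ suc k) ⟩
        e - (e * q ^ suc k) * 1#         ≈⟨ +-congˡ (-‿cong (*-congˡ (inverse-^ pq≈1 (suc i)))) ⟨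
        e - (e * q ^ suc k) * (pʲ * qʲ)  ≈⟨ +-congˡ (-‿cong (solve 4 (λ e x p q → (e :* x) :* (p :* q) := p :* (e :* (x :* q))) refl e (q ^ suc k) pʲ qʲ)) ⟩
        e - pʲ * (e * (q ^ suc k * qʲ))  ≈⟨ +-congˡ (-‿cong (*-congˡ (trans (*-congˡ (trans (sym (^-homo-* q (suc k) (suc i))) (^-≡ q (≡.cong suc k+1+i≡n′)))) e*q^n))) ⟩
        e - pʲ * e                       ≈⟨ solve 2 (λ e p → e :- p :* e := e :* :1 :- p :* e) refl e pʲ ⟩
        e * 1# - pʲ * e                  ≈⟨ +-congʳ (*-congˡ (inverse-^ pq≈1 (suc i))) ⟨
        e * (pʲ * qʲ) - pʲ * e           ≈⟨ solve 3 (λ e p q → e :* (p :* q) :- p :* e := :- (e :* (p :* (:1 :- q)))) refl e pʲ qʲ ⟩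
        - (e * (pʲ * (1# - qʲ)))         ∎

      p^-collect : p ^ (suc i ℕ.* suc (suc i)) * q ^ (suc i ℕ.* i) ≈ pʲ * pʲ
      p^-collect = begin
        p ^ (suc i ℕ.* suc (suc i)) * X  ≈⟨ *-congʳ (trans (^-≡ p exponent) (trans (^-homo-* p (suc i) _) (*-congˡ (^-homo-* p (suc i) (suc i ℕ.* i))))) ⟩
        (pʲ * (pʲ * Y)) * X              ≈⟨ solve 3 (λ p Y X → (p :* (p :* Y)) :* X := (p :* p) :* (Y :* X)) refl pʲ Y X ⟩
        (pʲ * pʲ) * (Y * X)              ≈⟨ trans (*-congˡ (inverse-^ pq≈1 (suc i ℕ.* i))) (*-identityʳ _) ⟩
        pʲ * pʲ                          ∎
        where
        X = q ^ (suc i ℕ.* i)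
        Y = p ^ (suc i ℕ.* i)
        exponent : suc i ℕ.* suc (suc i) ≡ suc i ℕ.+ (suc i ℕ.+ suc i ℕ.* i)
        exponent = ≡.trans (ℕ.*-suc (suc i) (suc i)) (≡.cong (suc i ℕ.+_) (ℕ.*-suc (suc i) i))

      -- Two regular factors are needed: 1 - q^(k+1) clears [mn, k+1], and 1 - q^j clears `lucas`.
      -- Next to e, `e*y` exchanges the one for the other and `e*C` introduces `C`.
      middle : term (suc c) (suc k) ≈ (ι (+ suc c) * C) * lucasTerm i
      middle = cancel k k<n′ (cancel i i<n′ (begin
        y′ * (y * term (suc c) (suc k))
          ≈⟨ *-congˡ term-residue ⟩
        y′ * (c′ * - (e * ((P * P) * central)))
          ≈⟨ solve 5 (λ y c e P central → y :* (c :* :- (e :* (P :* central))) := (:- (y :* c)) :* ((e :* P) :* central)) refl y′ c′ e (P * P) central ⟩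
        (- (y′ * c′)) * ((e * (P * P)) * central)
          ≈⟨ *-congˡ (*-cong e*p^tri (gb-central i i<n′)) ⟩
        (- (y′ * c′)) * ((e * P₂) * ((1# + qʲ) * gb (suc i ℕ.+ i) i))
          ≈⟨ solve 6 (λ y c e P q g → (:- (y :* c)) :* ((e :* P) :* ((:1 :+ q) :* g)) := (:- (y :* c :* P :* (:1 :+ q))) :* (e :* g)) refl y′ c′ e P₂ qʲ (gb (suc i ℕ.+ i) i) ⟩
        (- (y′ * c′ * P₂ * (1# + qʲ))) * (e * gb (suc i ℕ.+ i) i)
          ≈⟨ *-congˡ (trans (e*gb-reflect (suc i) i (ℕ.<⇒≤ i<n′) i<n′) (*-congˡ (*-congʳ (*-congˡ (^-homo-* q (suc i ℕ.* i) (tri (suc i))))))) ⟩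
        (- (y′ * c′ * P₂ * (1# + qʲ))) * (e * ((s * (X * T)) * g))
          ≈⟨ solve 9 (λ y c P q e s X T g → (:- (y :* c :* P :* (:1 :+ q))) :* (e :* ((s :* (X :* T)) :* g)) := (P :* X) :* ((:1 :+ q) :* (c :* (:- s) :* T :* g :* (e :* y)))) refl y′ c′ P₂ qʲ e s X T g ⟩
        (P₂ * X) * ((1# + qʲ) * Z)
          ≈⟨ *-congʳ p^-collect ⟩
        -- Here p^(2j) (1 + q^j) = p^j (p^j + 1). One p^j is spent on `e*y`; the remaining 1 + p^j
        -- puts the weight of `lucasSumA` beside that of `lucasSumB`.
        (pʲ * pʲ) * ((1# + qʲ) * Z)
          ≈⟨ solve 3 (λ p q Z → (p :* p) :* ((:1 :+ q) :* Z) := (p :* (p :+ (p :* q))) :* Z) refl pʲ qʲ Z ⟩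
        (pʲ * (pʲ + (pʲ * qʲ))) * Z
          ≈⟨ *-congʳ (*-congˡ (+-congˡ (inverse-^ pq≈1 (suc i)))) ⟩
        (pʲ * (pʲ + 1#)) * (c′ * (- s) * T * g * (e * y′))
          ≈⟨ solve 7 (λ p c s T g e y → (p :* (p :+ :1)) :* (c :* s :* T :* g :* (e :* y)) := :- (c :* (s :* T :* (:1 :+ p) :* g) :* (:- (e :* (p :* y))))) refl pʲ c′ (- s) T g e y′ ⟩
        - (c′ * V * (- (e * (pʲ * y′))))
          ≈⟨ -‿cong (*-congˡ e*y) ⟨
        - (c′ * V * (e * y))
          ≈⟨ solve 4 (λ c V e y → :- (c :* V :* (e :* y)) := c :* V :* (:- e :* y)) refl c′ V e y ⟩
        c′ * V * (- e * y)
          ≈⟨ *-congˡ (*-congʳ e*C) ⟨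
        c′ * V * (e * C * y)
          ≈⟨ *-congʳ (*-congˡ (*-congʳ (*-congʳ (*-congʳ (ι-sgn-suc i))))) ⟨
        c′ * (weightA i * (1# + pʲ) * g) * (e * C * y)
          ≈⟨ solve 7 (λ c w p g e C y → c :* (w :* (:1 :+ p) :* g) :* (e :* C :* y) := y :* ((c :* C) :* (w :* (:1 :+ p))) :* (e :* g)) refl c′ (weightA i) pʲ g e C y ⟩
        y * ((c′ * C) * (weightA i * (1# + pʲ))) * (e * g)
          ≈⟨ *-congˡ (lucas-absorb n′ i i<n′) ⟨
        y * ((c′ * C) * (weightA i * (1# + pʲ))) * (y′ * lucas n′ i)
          ≈⟨ solve 6 (λ y c w p y′ l → y :* (c :* (w :* (:1 :+ p))) :* (y′ :* l) := y′ :* (y :* (c :* (w :* l :+ (w :* p) :* l)))) refl y (c′ * C) (weightA i) pʲ y′ (lucas n′ i) ⟩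
        y′ * (y * ((c′ * C) * lucasTerm i)) ∎))
        where
        c′ = ι (+ suc c)
        P = p ^ tri (suc k)
        P₂ = p ^ (suc i ℕ.* suc (suc i))
        X = q ^ (suc i ℕ.* i)
        T = q ^ tri (suc i)
        Z = c′ * (- s) * T * g * (e * y′)
        V = (- s) * T * (1# + pʲ) * g

    middle-sum : ∀ c → sum n′ (λ k → term (suc c) (suc k)) ≈ (ι (+ suc c) * C) * ((lucasSumA n′ - 1#) + (lucasSumB p n′ - 1#))
    middle-sum c = begin
      sum n′ (λ k → term (suc c) (suc k))
        ≈⟨ sum-reverse n′ (λ k → term (suc c) (suc k)) ⟩
      sum n′ (λ i → term (suc c) (suc (n′ ∸ suc i)))
        ≈⟨ sum-cong n′ (λ i i<n′ → middle c (n′ ∸ suc i) i (ℕ.m∸n+n≡m i<n′)) ⟩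
      sum n′ (λ i → (ι (+ suc c) * C) * lucasTerm i)
        ≈⟨ trans (sum-*ˡ n′ _ lucasTerm) (*-congˡ (sum-+ n′ _ _)) ⟩
      (ι (+ suc c) * C) * (a + b)
        ≈⟨ *-congˡ (solve 2 (λ a b → a :+ b := (:1 :+ a :- :1) :+ (:1 :+ b :- :1)) refl a b) ⟩
      (ι (+ suc c) * C) * ((lucasSumA n′ - 1#) + (lucasSumB p n′ - 1#)) ∎
      where
      a = sum n′ (λ i → weightA i * lucas n′ i)
      b = sum n′ (λ i → (weightA i * p ^ suc i) * lucas n′ i)

    first-term : ∀ c → term c 0 ≈ ι (+ (2 ℕ.* c)) - ι (+ (n ℕ.* tri (2 ℕ.* c))) * e
    first-term c = begin
      (ι (sgn 0) * (q ^ (c ℕ.* n ℕ.* 0) * 1#)) * (1# * gb (2 ℕ.* (c ℕ.* n)) n)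
        ≈⟨ *-cong (*-cong 1-homo (trans (*-identityʳ _) (^-≡ q (ℕ.*-zeroʳ (c ℕ.* n))))) (*-identityˡ _) ⟩
      (1# * 1#) * gb (2 ℕ.* (c ℕ.* n)) n
        ≈⟨ trans (*-congʳ (*-identityˡ 1#)) (*-identityˡ _) ⟩
      gb (2 ℕ.* (c ℕ.* n)) n
        ≈⟨ trans (reflexive (≡.cong (λ i → gb i n) (≡.sym (ℕ.*-assoc 2 c n)))) (gb-multiple (2 ℕ.* c)) ⟩
      ι (+ (2 ℕ.* c)) - ι (+ (n ℕ.* tri (2 ℕ.* c))) * e ∎

    -- With m = c + 1, the square n² = C(n,2) + C(n+1,2) splits off two powers: the first cancels
    -- the power of p, the second goes into `C`, and 1 - (m-1)n e is left. Multiplied by m, its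
    -- coefficient is 2n C(m,2), which with the n C(m,2) of [mn, n] makes the 3.
    last-term : ∀ c → term (suc c) n ≈ C * (ι (+ suc c) - ι (+ (3 ℕ.* n ℕ.* tri (suc c))) * e)
    last-term c = begin
      (s * (q ^ (suc c ℕ.* n ℕ.* n) * P)) * (gb (suc c ℕ.* n) n * gb (2 ℕ.* (suc c ℕ.* n) ∸ 2 ℕ.* n) (n ∸ n))
        ≈⟨ *-congˡ (trans (*-congˡ (reflexive (≡.cong (gb (2 ℕ.* (suc c ℕ.* n) ∸ 2 ℕ.* n)) (ℕ.n∸n≡0 n)))) (*-identityʳ _)) ⟩
      (s * (q ^ (suc c ℕ.* n ℕ.* n) * P)) * gb (suc c ℕ.* n) n
        ≈⟨ *-cong (*-congˡ (*-congʳ (trans (^-≡ q exponent) (trans (^-homo-* q (tri n) _) (*-congˡ (^-homo-* q (tri (suc n)) _)))))) (gb-multiple (suc c)) ⟩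
      (s * ((q ^ tri n * (T * q ^ (c ℕ.* n ℕ.* n))) * P)) * (c′ - t * e)
        ≈⟨ *-congʳ (solve 5 (λ s x T y P → s :* ((x :* (T :* y)) :* P) := (s :* T) :* ((P :* x) :* y)) refl s (q ^ tri n) T (q ^ (c ℕ.* n ℕ.* n)) P) ⟩
      (C * ((P * q ^ tri n) * q ^ (c ℕ.* n ℕ.* n))) * (c′ - t * e)
        ≈⟨ *-congʳ (*-congˡ (trans (*-congʳ (inverse-^ pq≈1 (tri n))) (trans (*-identityˡ _) (q^-multiple (c ℕ.* n))))) ⟩
      (C * (1# - u * e)) * (c′ - t * e)
        ≈⟨ solve 5 (λ C u e c t → (C :* (:1 :- u :* e)) :* (c :- t :* e) := C :* (c :- (c :* u :+ t) :* e) :+ (C :* u :* t) :* (e :* e)) refl C u e c′ t ⟩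
      C * (c′ - (c′ * u + t) * e) + (C * u * t) * (e * e)
        ≈⟨ e² _ _ ⟩
      C * (c′ - (c′ * u + t) * e)
        ≈⟨ *-congˡ (+-congˡ (-‿cong (*-congʳ coefficient))) ⟩
      C * (c′ - ι (+ (3 ℕ.* n ℕ.* tri (suc c))) * e) ∎
      where
      s = ι (sgn n)
      P = p ^ tri n
      T = q ^ tri (suc n)
      c′ = ι (+ suc c)
      t = ι (+ (n ℕ.* tri (suc c)))
      u = ι (+ (c ℕ.* n))
      open ℕ.+-*-Solver using () renaming (solve to ℕsolve; con to ℕcon; _:+_ to _⊞_; _:*_ to _⊠_; _:=_ to _⊜_)
      exponent : suc c ℕ.* n ℕ.* n ≡ tri n ℕ.+ (tri (suc n) ℕ.+ c ℕ.* n ℕ.* n)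
      exponent = ≡.trans (ℕsolve 2 (λ c n → (n ⊞ c ⊠ n) ⊠ n ⊜ n ⊠ n ⊞ c ⊠ n ⊠ n) ≡.refl c n)
        (≡.trans (≡.cong (ℕ._+ c ℕ.* n ℕ.* n) (≡.sym (tri+tri n))) (ℕ.+-assoc (tri n) (tri (suc n)) _))
      coefficient : c′ * u + t ≈ ι (+ (3 ℕ.* n ℕ.* tri (suc c)))
      coefficient = trans (+-congʳ (sym (ι-* (suc c) (c ℕ.* n)))) (trans (sym (ι-+ (suc c ℕ.* (c ℕ.* n)) (n ℕ.* tri (suc c)))) (reflexive (≡.cong (λ i → ι (+ i))
        (≡.trans (≡.cong (ℕ._+ n ℕ.* tri (suc c)) (≡.trans (≡.sym (ℕ.*-assoc (suc c) c n)) (≡.cong (ℕ._* n) (≡.sym (tri*2 (suc c))))))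
          (ℕsolve 2 (λ n t → t ⊠ ℕcon 2 ⊠ n ⊞ n ⊠ t ⊜ ℕcon 3 ⊠ n ⊠ t) ≡.refl n (tri (suc c)))))))

    -- The middle sum lacks the term j = 0 of both `lucasSumA` and `lucasSumB`. The last summand
    -- restores one of them, which explains the single -1.
    sum-terms : ∀ c → sum (suc n) (term (suc c)) ≈
      (ι (+ (2 ℕ.* suc c)) - ι (+ (n ℕ.* tri (2 ℕ.* suc c))) * e) +
      C * (ι (+ suc c) * ((lucasSumA n′ + lucasSumB p n′) - 1#) - ι (+ (3 ℕ.* n ℕ.* tri (suc c))) * e)
    sum-terms c = begin
      term (suc c) 0 + sum n (λ k → term (suc c) (suc k))
        ≈⟨ +-cong (first-term (suc c)) (trans (sum-last n′ (λ k → term (suc c) (suc k))) (+-cong (middle-sum c) (last-term c))) ⟩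
      f + ((c′ * C) * ((a - 1#) + (b - 1#)) + C * (c′ - t * e))
        ≈⟨ solve 7 (λ f c C a b t e → f :+ ((c :* C) :* ((a :- :1) :+ (b :- :1)) :+ C :* (c :- t :* e)) := f :+ C :* (c :* ((a :+ b) :- :1) :- t :* e)) refl f c′ C a b t e ⟩
      f + C * (c′ * ((a + b) - 1#) - t * e) ∎
      where
      f = ι (+ (2 ℕ.* suc c)) - ι (+ (n ℕ.* tri (2 ℕ.* suc c))) * e
      c′ = ι (+ suc c)
      a = lucasSumA n′
      b = lucasSumB p n′
      t = ι (+ (3 ℕ.* n ℕ.* tri (suc c)))

-- The ring ℤ[q] of coefficient lists up to trailing zeros.

coeff-⊕ : ∀ p r i → coeff (p ⊕ r) i ≡ coeff p i ℤ.+ coeff r i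
coeff-⊕ [] r i = ≡.sym (ℤ.+-identityˡ _)
coeff-⊕ (a ∷ p) [] i = ≡.sym (ℤ.+-identityʳ _)
coeff-⊕ (a ∷ p) (b ∷ r) zero = ≡.refl
coeff-⊕ (a ∷ p) (b ∷ r) (suc i) = coeff-⊕ p r i

coeff-negP : ∀ p i → coeff (negP p) i ≡ ℤ.- coeff p i
coeff-negP [] i = ≡.refl
coeff-negP (a ∷ p) zero = ≡.refl
coeff-negP (a ∷ p) (suc i) = coeff-negP p i

coeff-scale : ∀ c p i → coeff (scale c p) i ≡ c ℤ.* coeff p i
coeff-scale c [] i = ≡.sym (ℤ.*-zeroʳ c)
coeff-scale c (a ∷ p) zero = ≡.refl
coeff-scale c (a ∷ p) (suc i) = coeff-scale c p i

coeff-⊖ : ∀ p r i → coeff (p ⊖ r) i ≡ coeff p i ℤ.- coeff r i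
coeff-⊖ p r i = ≡.trans (coeff-⊕ p (negP r) i) (≡.cong (ℤ._+_ (coeff p i)) (coeff-negP r i))

-- A wrapper around _≋_ from which Agda can infer both polynomials.
infix 4 _≐_
record _≐_ (p r : Poly) : Set where
  constructor by-coeff
  field at : p ≋ r
open _≐_ public

∷-cong : ∀ {a b p r} → a ≡ b → p ≐ r → a ∷ p ≐ b ∷ r
∷-cong a≡b p≐r .at zero = a≡b
∷-cong a≡b p≐r .at (suc i) = p≐r .at i

0∷-cong : ∀ {p r} → p ≐ r → 0ℤ ∷ p ≐ 0ℤ ∷ r
0∷-cong = ∷-cong ≡.refl

∷-zero : 0ℤ ∷ [] ≐ []
∷-zero .at zero = ≡.refl
∷-zero .at (suc i) = ≡.refl

≐-refl : ∀ {p} → p ≐ p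
≐-refl .at i = ≡.refl

≐-sym : ∀ {p r} → p ≐ r → r ≐ p
≐-sym p≐r .at i = ≡.sym (p≐r .at i)

≐-trans : ∀ {p r s} → p ≐ r → r ≐ s → p ≐ s
≐-trans p≐r r≐s .at i = ≡.trans (p≐r .at i) (r≐s .at i)

⊕-cong : ∀ {p p′ r r′} → p ≐ p′ → r ≐ r′ → p ⊕ r ≐ p′ ⊕ r′
⊕-cong {p} {p′} {r} {r′} e f .at i =
  ≡.trans (coeff-⊕ p r i) (≡.trans (≡.cong₂ ℤ._+_ (e .at i) (f .at i)) (≡.sym (coeff-⊕ p′ r′ i)))

⊕-congˡ : ∀ p {r r′} → r ≐ r′ → p ⊕ r ≐ p ⊕ r′
⊕-congˡ p = ⊕-cong (≐-refl {p})

⊕-congʳ : ∀ r {p p′} → p ≐ p′ → p ⊕ r ≐ p′ ⊕ r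
⊕-congʳ r e = ⊕-cong e (≐-refl {r})

⊕-assoc : ∀ p r s → (p ⊕ r) ⊕ s ≐ p ⊕ (r ⊕ s)
⊕-assoc p r s .at i rewrite coeff-⊕ (p ⊕ r) s i | coeff-⊕ p r i | coeff-⊕ p (r ⊕ s) i | coeff-⊕ r s i =
  ℤ.+-assoc (coeff p i) (coeff r i) (coeff s i)

⊕-comm : ∀ p r → p ⊕ r ≐ r ⊕ p
⊕-comm p r .at i rewrite coeff-⊕ p r i | coeff-⊕ r p i = ℤ.+-comm (coeff p i) (coeff r i)

⊕-identityʳ : ∀ p → p ⊕ [] ≐ p
⊕-identityʳ [] = ≐-refl
⊕-identityʳ (a ∷ p) = ≐-refl

negP-cong : ∀ {p r} → p ≐ r → negP p ≐ negP r
negP-cong {p} {r} e .at i rewrite coeff-negP p i | coeff-negP r i = ≡.cong ℤ.-_ (e .at i)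

⊕-inverseʳ : ∀ p → p ⊕ negP p ≐ []
⊕-inverseʳ p .at i rewrite coeff-⊕ p (negP p) i | coeff-negP p i = ℤ.+-inverseʳ (coeff p i)

scale-cong : ∀ c {p r} → p ≐ r → scale c p ≐ scale c r
scale-cong c {p} {r} e .at i rewrite coeff-scale c p i | coeff-scale c r i = ≡.cong (c ℤ.*_) (e .at i)

scale-⊕ : ∀ c p r → scale c (p ⊕ r) ≐ scale c p ⊕ scale c r
scale-⊕ c p r .at i rewrite coeff-scale c (p ⊕ r) i | coeff-⊕ p r i | coeff-⊕ (scale c p) (scale c r) i
  | coeff-scale c p i | coeff-scale c r i = ℤ.*-distribˡ-+ c (coeff p i) (coeff r i)

scale-scale : ∀ c d p → scale c (scale d p) ≐ scale (c ℤ.* d) p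
scale-scale c d p .at i rewrite coeff-scale c (scale d p) i | coeff-scale d p i | coeff-scale (c ℤ.* d) p i =
  ≡.sym (ℤ.*-assoc c d (coeff p i))

scale-zero : ∀ p → scale 0ℤ p ≐ []
scale-zero p .at i rewrite coeff-scale 0ℤ p i = ≡.refl

scale-one : ∀ p → scale 1ℤ p ≐ p
scale-one p .at i rewrite coeff-scale 1ℤ p i = ℤ.*-identityˡ _

0∷-⊕ : ∀ p r → 0ℤ ∷ (p ⊕ r) ≐ (0ℤ ∷ p) ⊕ (0ℤ ∷ r)
0∷-⊕ p r = ≐-refl

⊕-interchange : ∀ p r s t → (p ⊕ r) ⊕ (s ⊕ t) ≐ (p ⊕ s) ⊕ (r ⊕ t)
⊕-interchange p r s t .at i rewrite coeff-⊕ (p ⊕ r) (s ⊕ t) i | coeff-⊕ p r i | coeff-⊕ s t i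
  | coeff-⊕ (p ⊕ s) (r ⊕ t) i | coeff-⊕ p s i | coeff-⊕ r t i =
  solve 4 (λ p r s t → (p :+ r) :+ (s :+ t) := (p :+ s) :+ (r :+ t)) ≡.refl (coeff p i) (coeff r i) (coeff s i) (coeff t i)
  where open ℤ.+-*-Solver

⊗-zeroʳ : ∀ p → p ⊗ [] ≐ []
⊗-zeroʳ [] = ≐-refl
⊗-zeroʳ (a ∷ p) = ≐-trans (0∷-cong (⊗-zeroʳ p)) ∷-zero

⊗-congˡ : ∀ p {r r′} → r ≐ r′ → p ⊗ r ≐ p ⊗ r′
⊗-congˡ [] e = ≐-refl
⊗-congˡ (a ∷ p) e = ⊕-cong (scale-cong a e) (0∷-cong (⊗-congˡ p e))

⊗-distribˡ : ∀ p r s → p ⊗ (r ⊕ s) ≐ (p ⊗ r) ⊕ (p ⊗ s)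
⊗-distribˡ [] r s = ≐-refl
⊗-distribˡ (a ∷ p) r s = ≐-trans
  (⊕-cong (scale-⊕ a r s) (≐-trans (0∷-cong (⊗-distribˡ p r s)) (0∷-⊕ (p ⊗ r) (p ⊗ s))))
  (⊕-interchange (scale a r) (scale a s) (0ℤ ∷ (p ⊗ r)) (0ℤ ∷ (p ⊗ s)))

-- The product recurses on its left factor; this is the matching recursion on the right one, and
-- comparing the two yields commutativity.
⊗-∷ : ∀ p b r → p ⊗ (b ∷ r) ≐ scale b p ⊕ (0ℤ ∷ (p ⊗ r))
⊗-∷ [] b r = ≐-sym ∷-zero
⊗-∷ (a ∷ p) b r = ∷-cong (≡.cong (ℤ._+ 0ℤ) (ℤ.*-comm a b))
  (≐-trans (⊕-congˡ (scale a r) (⊗-∷ p b r))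
  (≐-trans (≐-sym (⊕-assoc (scale a r) (scale b p) (0ℤ ∷ (p ⊗ r))))
  (≐-trans (⊕-congʳ (0ℤ ∷ (p ⊗ r)) (⊕-comm (scale a r) (scale b p))) (⊕-assoc (scale b p) (scale a r) (0ℤ ∷ (p ⊗ r))))))

⊗-comm : ∀ p r → p ⊗ r ≐ r ⊗ p
⊗-comm [] r = ≐-sym (⊗-zeroʳ r)
⊗-comm (a ∷ p) r = ≐-trans (⊕-congˡ (scale a r) (0∷-cong (⊗-comm p r))) (≐-sym (⊗-∷ r a p))

⊗-congʳ : ∀ r {p p′} → p ≐ p′ → p ⊗ r ≐ p′ ⊗ r
⊗-congʳ r {p} {p′} e = ≐-trans (⊗-comm p r) (≐-trans (⊗-congˡ r e) (⊗-comm r p′))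

⊗-distribʳ : ∀ s p r → (p ⊕ r) ⊗ s ≐ (p ⊗ s) ⊕ (r ⊗ s)
⊗-distribʳ s p r = ≐-trans (⊗-comm (p ⊕ r) s)
  (≐-trans (⊗-distribˡ s p r) (⊕-cong (⊗-comm s p) (⊗-comm s r)))

0∷-⊗ : ∀ p r → (0ℤ ∷ p) ⊗ r ≐ 0ℤ ∷ (p ⊗ r)
0∷-⊗ p r = ⊕-congʳ (0ℤ ∷ (p ⊗ r)) (scale-zero r)

scale-⊗ : ∀ c p r → scale c p ⊗ r ≐ scale c (p ⊗ r)
scale-⊗ c [] r = ≐-refl
scale-⊗ c (a ∷ p) r = ≐-sym (≐-trans (scale-⊕ c (scale a r) (0ℤ ∷ (p ⊗ r)))
  (⊕-cong (scale-scale c a r) (∷-cong (ℤ.*-zeroʳ c) (≐-sym (scale-⊗ c p r)))))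

⊗-assoc : ∀ p r s → (p ⊗ r) ⊗ s ≐ p ⊗ (r ⊗ s)
⊗-assoc [] r s = ≐-refl
⊗-assoc (a ∷ p) r s = ≐-trans (⊗-distribʳ s (scale a r) (0ℤ ∷ (p ⊗ r)))
  (⊕-cong (scale-⊗ a r s) (≐-trans (0∷-⊗ (p ⊗ r) s) (0∷-cong (⊗-assoc p r s))))

cst-⊗ : ∀ c p → cst c ⊗ p ≐ scale c p
cst-⊗ c p = ≐-trans (⊕-congˡ (scale c p) ∷-zero) (⊕-identityʳ (scale c p))

⊗-identityˡ : ∀ p → cst 1ℤ ⊗ p ≐ p
⊗-identityˡ p = ≐-trans (cst-⊗ 1ℤ p) (scale-one p)

ℤ[q] : CommutativeRing 0ℓ 0ℓ
ℤ[q] = record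
  { Carrier = Poly ; _≈_ = _≐_ ; _+_ = _⊕_ ; _*_ = _⊗_ ; -_ = negP ; 0# = [] ; 1# = cst 1ℤ
  ; isCommutativeRing = record
    { isRing = record
      { +-isAbelianGroup = record
        { isGroup = record
          { isMonoid = record
            { isSemigroup = record
              { isMagma = record
                { isEquivalence = record { refl = ≐-refl ; sym = ≐-sym ; trans = ≐-trans }
                ; ∙-cong = ⊕-cong }
              ; assoc = ⊕-assoc }
            ; identity = (λ p → ≐-refl) , ⊕-identityʳ }
          ; inverse = (λ p → ≐-trans (⊕-comm (negP p) p) (⊕-inverseʳ p)) , ⊕-inverseʳ
          ; ⁻¹-cong = negP-cong }
        ; comm = ⊕-comm }
      ; *-cong = λ {p} {p′} {r} {r′} e f → ≐-trans (⊗-congʳ r e) (⊗-congˡ p′ f)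
      ; *-assoc = ⊗-assoc
      ; *-identity = ⊗-identityˡ , (λ p → ≐-trans (⊗-comm p (cst 1ℤ)) (⊗-identityˡ p))
      ; distrib = ⊗-distribˡ , ⊗-distribʳ }
    ; *-comm = ⊗-comm }
  }

ℤ⟶ℤ[q] : ℤ.+-*-rawRing -Raw-AlmostCommutative⟶ fromCommutativeRing ℤ[q]
ℤ⟶ℤ[q] = record
  { ⟦_⟧ = cst
  ; +-homo = λ a b → ≐-refl
  ; *-homo = λ a b → ∷-cong (≡.sym (ℤ.+-identityʳ (a ℤ.* b))) ≐-refl
  ; -‿homo = λ a → ≐-refl
  ; 0-homo = ∷-zero
  ; 1-homo = ≐-refl
  }

-- Quotients by principal ideals.

module Quotient
  (R : CommutativeRing 0ℓ 0ℓ)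
  (ℤ⟶R : ℤ.+-*-rawRing -Raw-AlmostCommutative⟶ fromCommutativeRing R)
  (P : CommutativeRing.Carrier R)
  where
  open CommutativeRing R
  open GaussianBinomials R ℤ⟶R 1# using (solve; _:=_; _:+_; _:*_; _:-_; :-_; ι; +-homo; *-homo; -‿homo; 0-homo; 1-homo)

  infix 4 _∼_
  -- The quotient keeps carrier and operations and coarsens only the equality, so polynomials need
  -- no conversion. The cofactor is oriented as in `_∣ₚ_`, so a proof of congruence contains the
  -- witness for the final statement.
  record _∼_ (x y : Carrier) : Set where
    constructor congruent
    field
      quotient : Carrier
      equality : quotient * P ≈ x - y

  ≈⇒∼ : ∀ {x y} → x ≈ y → x ∼ y
  ≈⇒∼ {x} {y} x≈y = congruent 0# (trans (zeroˡ P) (sym (trans (+-congʳ x≈y) (-‿inverseʳ y))))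

  R/P : CommutativeRing 0ℓ 0ℓ
  R/P = record
    { Carrier = Carrier ; _≈_ = _∼_ ; _+_ = _+_ ; _*_ = _*_ ; -_ = -_ ; 0# = 0# ; 1# = 1#
    ; isCommutativeRing = record
      { isRing = record
        { +-isAbelianGroup = record
          { isGroup = record
            { isMonoid = record
              { isSemigroup = record
                { isMagma = record
                  { isEquivalence = record
                    { refl = ≈⇒∼ refl
                    ; sym = λ { {x} {y} (congruent c e) → congruent (- c) $ trans (solve 2 (λ c P → :- c :* P := :- (c :* P)) refl c P)
                        (trans (-‿cong e) (solve 2 (λ x y → :- (x :- y) := y :- x) refl x y)) }
                    ; trans = λ { {x} {y} {z} (congruent c e) (congruent d f) → congruent (c + d) $ trans (distribʳ P c d)
                        (trans (+-cong e f) (solve 3 (λ x y z → (x :- y) :+ (y :- z) := x :- z) refl x y z)) } }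
                  ; ∙-cong = λ { {x} {y} {u} {v} (congruent c e) (congruent d f) → congruent (c + d) $ trans (distribʳ P c d)
                        (trans (+-cong e f) (solve 4 (λ x y u v → (x :- y) :+ (u :- v) := (x :+ u) :- (y :+ v)) refl x y u v)) } }
                ; assoc = λ x y z → ≈⇒∼ (+-assoc x y z) }
              ; identity = (λ x → ≈⇒∼ (+-identityˡ x)) , (λ x → ≈⇒∼ (+-identityʳ x)) }
            ; inverse = (λ x → ≈⇒∼ (-‿inverseˡ x)) , (λ x → ≈⇒∼ (-‿inverseʳ x))
            ; ⁻¹-cong = λ { {x} {y} (congruent c e) → congruent (- c) $ trans (solve 2 (λ c P → :- c :* P := :- (c :* P)) refl c P)
                (trans (-‿cong e) (solve 2 (λ x y → :- (x :- y) := :- x :- :- y) refl x y)) } }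
          ; comm = λ x y → ≈⇒∼ (+-comm x y) }
        ; *-cong = λ { {x} {y} {u} {v} (congruent c e) (congruent d f) → congruent (c * u + y * d) $
            trans (solve 5 (λ c u y d P → (c :* u :+ y :* d) :* P := (c :* P) :* u :+ y :* (d :* P)) refl c u y d P)
            (trans (+-cong (*-congʳ e) (*-congˡ f))
            (solve 4 (λ x y u v → (x :- y) :* u :+ y :* (u :- v) := x :* u :- y :* v) refl x y u v)) }
        ; *-assoc = λ x y z → ≈⇒∼ (*-assoc x y z)
        ; *-identity = (λ x → ≈⇒∼ (*-identityˡ x)) , (λ x → ≈⇒∼ (*-identityʳ x))
        ; distrib = (λ x y z → ≈⇒∼ (distribˡ x y z)) , (λ x y z → ≈⇒∼ (distribʳ x y z)) }
      ; *-comm = λ x y → ≈⇒∼ (*-comm x y) }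
    }

  ℤ⟶R/P : ℤ.+-*-rawRing -Raw-AlmostCommutative⟶ fromCommutativeRing R/P
  ℤ⟶R/P = record
    { ⟦_⟧ = ι
    ; +-homo = λ a b → ≈⇒∼ (+-homo a b)
    ; *-homo = λ a b → ≈⇒∼ (*-homo a b)
    ; -‿homo = λ a → ≈⇒∼ (-‿homo a)
    ; 0-homo = ≈⇒∼ 0-homo
    ; 1-homo = ≈⇒∼ 1-homo
    }

-- The helpers of divMonic (and the local functions of cycTable) are not exported by Defs.
-- Generalising the functions around them by `with` puts them in a position where unification
-- solves the `_` in these definitions, which thereby become names for them.
data Exposed : Poly → Set where
  expose : ∀ x → Exposed x

mutual
  strip : Poly → Poly
  strip = _

  expose-strip : ∀ p → Exposed (divMonic p [])
  -- For the empty divisor the length comparison reduces, so the leading term of the quotient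
  -- appears, shifted by the length of the stripped dividend. That length is a `foldr`; with
  -- `foldr`, `_++_` and `_⊕_` abstracted, unification compares arguments and meets `strip p`.
  expose-strip p with _⊕_ | _++_ {A = ℤ} | foldr {A = ℤ} {B = ℕ} | length p
  ... | _⊕′_ | _++′_ | foldr′ | l =
    expose ((replicate (foldr′ (λ _ → suc) 0 (strip p)) 0ℤ ++′ _) ⊕′ _)

mutual
  lead : Poly → ℤ
  lead = _

  expose-lead : ∀ p → Exposed (divMonic p [])
  expose-lead p with strip p | _⊕_ | _++_ {A = ℤ} | length p
  ... | p′ | _⊕′_ | _++′_ | l = expose ((_ ++′ (lead p′ ∷ [])) ⊕′ _)

-- divLoop l p s p′ is one round of the division loop of divMonic, with fuel l left
-- afterwards, divisor s and stripped dividend p′.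
mutual
  divLoop : ℕ → Poly → Poly → Poly → Poly
  divLoop = _

  expose-divLoop : ∀ p d → Exposed (divMonic p d)
  expose-divLoop p d with strip p | strip d | length p
  ... | p′ | s | l = expose (divLoop l p s p′)

-- Φ (suc n) is q^(n+1) - 1 divided by the product of factor n d over d ≤ n; the odd shape of
-- the divisor is the product after evaluation of its trivial factor at d = 0.
mutual
  factor : ℕ → ℕ → Poly
  factor = _

  Φ-unfold : ∀ n → Φ (suc n) ≡ divMonic (X^ (suc n) ⊖ cst 1ℤ)
    (map (1ℤ ℤ.*_) (prodP (map (factor n) (applyUpTo suc n))) ⊕ (0ℤ ∷ []))
  Φ-unfold n with suc n ℕ.≟ suc n | ℕ.≟-diag {suc n} ≡.refl
  ... | yes ≡.refl | ≡.refl = ≡.refl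

Φ-divMonic : ∀ n → Φ (suc n) ≡ divMonic (X^ (suc n) ⊖ cst 1ℤ) (prodP (map (factor n) (upTo (suc n))))
Φ-divMonic = Φ-unfold

-- Monic polynomials and long division.

_∣0 : ∀ z → z ∣ℤ 0ℤ
z ∣0 = divides 0ℤ ≡.refl

coeff-length : ∀ p i → length p ≤ i → coeff p i ≡ 0ℤ
coeff-length [] i _ = ≡.refl
coeff-length (a ∷ p) (suc i) (s≤s l) = coeff-length p i l

strip-coeff : ∀ p → strip p ≐ p
strip-coeff [] = ≐-refl
strip-coeff (a ∷ p) with strip p | strip-coeff p
strip-coeff (+ zero ∷ p) | [] | e = ≐-sym (≐-trans (0∷-cong (≐-sym e)) ∷-zero)
strip-coeff (+ suc _ ∷ p) | [] | e = ∷-cong ≡.refl e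
strip-coeff (-[1+ _ ] ∷ p) | [] | e = ∷-cong ≡.refl e
strip-coeff (+ zero ∷ p) | b ∷ r | e = ∷-cong ≡.refl e
strip-coeff (+ suc _ ∷ p) | b ∷ r | e = ∷-cong ≡.refl e
strip-coeff (-[1+ _ ] ∷ p) | b ∷ r | e = ∷-cong ≡.refl e

-- Turns information on coefficients, which is invariant under `_≐_`, into a bound on the list
-- length that the division loop compares.
strip-minimal : ∀ p k → (∀ i → k ≤ i → coeff p i ≡ 0ℤ) → length (strip p) ≤ k
strip-minimal [] k _ = z≤n
strip-minimal (a ∷ p) zero z with strip p | strip-minimal p 0 (λ i _ → z (suc i) z≤n) | z 0 z≤n
strip-minimal (.0ℤ ∷ p) zero z | [] | _ | ≡.refl = z≤n
strip-minimal (a ∷ p) (suc k) z with strip p | strip-minimal p k (λ i k≤i → z (suc i) (s≤s k≤i))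
strip-minimal (+ zero ∷ p) (suc k) z | [] | l = z≤n
strip-minimal (+ suc _ ∷ p) (suc k) z | [] | l = s≤s z≤n
strip-minimal (-[1+ _ ] ∷ p) (suc k) z | [] | l = s≤s z≤n
strip-minimal (+ zero ∷ p) (suc k) z | b ∷ r | l = s≤s l
strip-minimal (+ suc _ ∷ p) (suc k) z | b ∷ r | l = s≤s l
strip-minimal (-[1+ _ ] ∷ p) (suc k) z | b ∷ r | l = s≤s l

lead-coeff : ∀ p k → length p ≡ suc k → lead p ≡ coeff p k
lead-coeff (a ∷ []) zero _ = ≡.refl
lead-coeff (a ∷ b ∷ p) (suc k) e = lead-coeff (b ∷ p) k (ℕ.suc-injective e)

-- Stated through coefficients because a list may end in zeros; `D` is the degree and not a length.
record Monic (p : Poly) (D : ℕ) : Set where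
  constructor monic
  field
    top : coeff p D ≡ 1ℤ
    above : ∀ i → D < i → coeff p i ≡ 0ℤ
open Monic

Monic-cong : ∀ {p r D} → p ≐ r → Monic p D → Monic r D
Monic-cong p≐r m = monic (≡.trans (≡.sym (p≐r .at _)) (m .top)) (λ i D<i → ≡.trans (≡.sym (p≐r .at i)) (m .above i D<i))

coeff-∷⊗-suc : ∀ a c d i → coeff ((a ∷ c) ⊗ d) (suc i) ≡ a ℤ.* coeff d (suc i) ℤ.+ coeff (c ⊗ d) i
coeff-∷⊗-suc a c d i = ≡.trans (coeff-⊕ (scale a d) (0ℤ ∷ (c ⊗ d)) (suc i)) (≡.cong (ℤ._+ coeff (c ⊗ d) i) (coeff-scale a d (suc i)))

coeff-∷⊗-above : ∀ a c {d D} → Monic d D → ∀ i → D ≤ i → coeff ((a ∷ c) ⊗ d) (suc i) ≡ coeff (c ⊗ d) i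
coeff-∷⊗-above a c {d} m i D≤i = ≡.trans (coeff-∷⊗-suc a c d i)
  (≡.trans (≡.cong (λ x → a ℤ.* x ℤ.+ coeff (c ⊗ d) i) (m .above (suc i) (s≤s D≤i)))
  (≡.trans (≡.cong (ℤ._+ coeff (c ⊗ d) i) (ℤ.*-zeroʳ a)) (ℤ.+-identityˡ _)))

coeff-∷⊗-top : ∀ a c {d D} → Monic d D → coeff ((a ∷ c) ⊗ d) D ≡ a ℤ.+ coeff (0ℤ ∷ (c ⊗ d)) D
coeff-∷⊗-top a c {d} {D} m = ≡.trans (coeff-⊕ (scale a d) (0ℤ ∷ (c ⊗ d)) D)
  (≡.cong (ℤ._+ coeff (0ℤ ∷ (c ⊗ d)) D) (≡.trans (coeff-scale a d D) (≡.trans (≡.cong (a ℤ.*_) (m .top)) (ℤ.*-identityʳ a))))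

⊗-divisible : ∀ z c d → (∀ i → z ∣ℤ coeff c i) → ∀ i → z ∣ℤ coeff (c ⊗ d) i
⊗-divisible z [] d _ i = z ∣0
⊗-divisible z (a ∷ c) d z∣c i rewrite coeff-⊕ (scale a d) (0ℤ ∷ (c ⊗ d)) i | coeff-scale a d i =
  ∣m∣n⇒∣m+n (∣m⇒∣m*n (coeff d i) (z∣c 0)) (shifted i)
  where
  shifted : ∀ i → z ∣ℤ coeff (0ℤ ∷ (c ⊗ d)) i
  shifted zero = z ∣0
  shifted (suc i) = ⊗-divisible z c d (λ i → z∣c (suc i)) i

-- The case z = 0 says that a monic polynomial is regular.
monic-divisible : ∀ z {d D} → Monic d D → ∀ c → (∀ i → D ≤ i → z ∣ℤ coeff (c ⊗ d) i) → ∀ i → z ∣ℤ coeff c i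
monic-divisible z m [] _ i = z ∣0
monic-divisible z {d} {D} m (a ∷ c) h = λ { zero → z∣a ; (suc i) → z∣c i }
  where
  z∣c : ∀ i → z ∣ℤ coeff c i
  z∣c = monic-divisible z m c (λ i D≤i → ≡.subst (z ∣ℤ_) (coeff-∷⊗-above a c m i D≤i) (h (suc i) (ℕ.m≤n⇒m≤1+n D≤i)))
  shifted : ∀ i → z ∣ℤ coeff (0ℤ ∷ (c ⊗ d)) i
  shifted zero = z ∣0
  shifted (suc i) = ⊗-divisible z c d z∣c i
  z∣a : z ∣ℤ a
  z∣a = ∣m+n∣n⇒∣m (≡.subst (z ∣ℤ_) (coeff-∷⊗-top a c m) (h D ℕ.≤-refl)) (shifted D)

-- A nonzero cofactor would leave a nonzero coefficient at degree D or above, so only those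
-- coefficients are asked to vanish. This is the uniqueness of quotients in division with remainder.
monic-zero : ∀ {d D} → Monic d D → ∀ c → (∀ i → D ≤ i → coeff (c ⊗ d) i ≡ 0ℤ) → c ≐ []
monic-zero m c h .at i = 0∣⇒≡0 (monic-divisible 0ℤ m c (λ i D≤i → ≡.subst (0ℤ ∣ℤ_) (≡.sym (h i D≤i)) (0ℤ ∣0)) i)

⊖-zero : ∀ {p r} → p ⊖ r ≐ [] → p ≐ r
⊖-zero {p} {r} e .at i = ℤ.i-j≡0⇒i≡j (coeff p i) (coeff r i) (≡.trans (≡.sym (coeff-⊖ p r i)) (e .at i))

⊖-⊗ : ∀ c c′ d → (c ⊖ c′) ⊗ d ≐ c ⊗ d ⊖ c′ ⊗ d
⊖-⊗ c c′ d = solve 3 (λ c c′ d → (c :- c′) :* d := c :* d :- c′ :* d) ≐-refl c c′ d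
  where open GaussianBinomials ℤ[q] ℤ⟶ℤ[q] [] using (solve; _:=_; _:*_; _:-_)

monic-cancel : ∀ {d D} → Monic d D → ∀ c c′ → c ⊗ d ≐ c′ ⊗ d → c ≐ c′
monic-cancel {d} m c c′ e = ⊖-zero (monic-zero m (c ⊖ c′) (λ i _ → zero-diff .at i))
  where
  zero-diff : (c ⊖ c′) ⊗ d ≐ []
  zero-diff = ≐-trans (⊖-⊗ c c′ d) (≐-trans (⊕-congʳ (negP (c′ ⊗ d)) e) (⊕-inverseʳ (c′ ⊗ d)))

Monic-⊗ : ∀ c {E d D} → Monic c E → Monic d D → Monic (c ⊗ d) (E ℕ.+ D)
Monic-⊗ [] mc md with () ← mc .top
Monic-⊗ (a ∷ c) {zero} {d} {D} mc md = monic
  (≡.trans (coeff-∷⊗-top a c md) (≡.trans (≡.cong₂ ℤ._+_ (mc .top) (shifted-zero .at D)) ≡.refl))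
  (λ { (suc i) (s≤s D≤i) → ≡.trans (coeff-∷⊗-above a c md i D≤i) (product-zero .at i) })
  where
  product-zero : c ⊗ d ≐ []
  product-zero = ⊗-congʳ d {c} {[]} (by-coeff (λ i → mc .above (suc i) (s≤s z≤n)))
  shifted-zero : 0ℤ ∷ (c ⊗ d) ≐ []
  shifted-zero = ≐-trans (0∷-cong product-zero) ∷-zero
Monic-⊗ (a ∷ c) {suc E} {d} {D} mc md = monic
  (≡.trans (coeff-∷⊗-above a c md (E ℕ.+ D) (ℕ.m≤n+m D E)) (ih .top))
  (λ { (suc i) (s≤s lt) → ≡.trans (coeff-∷⊗-above a c md i (ℕ.≤-trans (ℕ.m≤n+m D E) (ℕ.<⇒≤ lt))) (ih .above i lt) })
  where
  ih : Monic (c ⊗ d) (E ℕ.+ D)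
  ih = Monic-⊗ c (monic (mc .top) (λ i lt → mc .above (suc i) (s≤s lt))) md

-- Agreement is required only from degree D on, since that is what survives when the constant
-- coefficients of `c` and `u` are dropped for the induction.
Monic-quotient′ : ∀ {d D} → Monic d D → ∀ c u U → D ≤ U → Monic u U →
  (∀ i → D ≤ i → coeff (c ⊗ d) i ≡ coeff u i) → ∃ (Monic c)
Monic-quotient′ md [] u U D≤U t h with () ← ≡.trans (h U D≤U) (t .top)
Monic-quotient′ md (a ∷ c) [] U D≤U t h with () ← t .top
Monic-quotient′ {d} {D} md (a ∷ c) (b ∷ u) U D≤U t h with ℕ.m≤n⇒m<n∨m≡n D≤U
Monic-quotient′ {d} {D} md (a ∷ c) (b ∷ u) (suc U) _ t h | inj₁ (s≤s D≤U)
  with E , monic mt ma ← Monic-quotient′ md c u U D≤U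
    (monic (t .top) (λ i lt → t .above (suc i) (s≤s lt)))
    (λ i D≤i → ≡.trans (≡.sym (coeff-∷⊗-above a c md i D≤i)) (h (suc i) (ℕ.m≤n⇒m≤1+n D≤i)))
  = suc E , monic mt (λ { (suc i) (s≤s lt) → ma i lt })
Monic-quotient′ {d} {D} md (a ∷ c) (b ∷ u) .D _ t h | inj₂ ≡.refl = 0 , monic a≡1 (λ { (suc i) _ → c-zero .at i })
  where
  c-zero : c ≐ []
  c-zero = monic-zero md c (λ i D≤i → ≡.trans (≡.sym (coeff-∷⊗-above a c md i D≤i))
    (≡.trans (h (suc i) (ℕ.m≤n⇒m≤1+n D≤i)) (t .above (suc i) (s≤s D≤i))))
  shifted-zero : 0ℤ ∷ (c ⊗ d) ≐ []
  shifted-zero = ≐-trans (0∷-cong (⊗-congʳ d c-zero)) ∷-zero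
  a≡1 : a ≡ 1ℤ
  a≡1 = ≡.trans (≡.sym (ℤ.+-identityʳ a)) (≡.trans (≡.cong (ℤ._+_ a) (≡.sym (shifted-zero .at D)))
    (≡.trans (≡.sym (coeff-∷⊗-top a c md)) (≡.trans (h D ℕ.≤-refl) (t .top))))

Monic-quotient : ∀ {d D} → Monic d D → ∀ c {u U} → Monic u U → c ⊗ d ≐ u → ∃ (Monic c)
Monic-quotient {d} {D} md c {u} {U} mu e with ℕ.≤-<-connex D U
... | inj₁ D≤U = Monic-quotient′ md c u U D≤U mu (λ i _ → e .at i)
... | inj₂ U<D = contradiction (≡.trans (≡.sym (⊗-congʳ d c-zero .at U)) (≡.trans (e .at U) (mu .top))) λ ()
  where
  c-zero : c ≐ []
  c-zero = monic-zero md c (λ i D≤i → ≡.trans (e .at i) (mu .above i (ℕ.≤-trans U<D D≤i)))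

coeff-shifted-⊗ : ∀ e a s j → coeff (shiftP e (cst a) ⊗ s) (e ℕ.+ j) ≡ a ℤ.* coeff s j
coeff-shifted-⊗ zero a s j = ≡.trans (cst-⊗ a s .at j) (coeff-scale a s j)
coeff-shifted-⊗ (suc e) a s j = ≡.trans (0∷-⊗ (shiftP e (cst a)) s .at (suc (e ℕ.+ j))) (coeff-shifted-⊗ e a s j)

leadTerm : Poly → Poly → Poly
leadTerm p s = shiftP (length p ∸ length s) (cst (lead p))

⊕-⊖ : ∀ t c → t ⊕ (c ⊖ t) ≐ c
⊕-⊖ t c = solve 2 (λ t c → t :+ (c :- t) := c) ≐-refl t c
  where open GaussianBinomials ℤ[q] ℤ⟶ℤ[q] [] using (solve; _:=_; _:+_; _:-_)

-- As `s` is monic, the leading coefficients cancel exactly over ℤ; the coefficient lost in this way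
-- pays for one unit of fuel.
leadTerm-cancels : ∀ p s D → Monic s D → length s ≡ suc D → length s ≤ length p →
  ∀ i → length p ≤ suc i → coeff (p ⊖ leadTerm p s ⊗ s) i ≡ 0ℤ
leadTerm-cancels p s D m ls s≤p i p≤i+1 = ≡.trans (coeff-⊖ p (leadTerm p s ⊗ s) i)
  (≡.trans (≡.cong (λ x → coeff p i ℤ.- x) top-term) difference)
  where
  e = length p ∸ length s
  lp : length p ≡ suc (e ℕ.+ D)
  lp = ≡.trans (≡.sym (ℕ.m∸n+n≡m s≤p)) (≡.trans (≡.cong (e ℕ.+_) ls) (ℕ.+-suc e D))
  e+D≤i : e ℕ.+ D ≤ i
  e+D≤i = ℕ.s≤s⁻¹ (≡.subst (_≤ suc i) lp p≤i+1)
  e≤i : e ≤ i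
  e≤i = ℕ.≤-trans (ℕ.m≤m+n e D) e+D≤i
  D≤j : D ≤ i ∸ e
  D≤j = ≡.subst (_≤ i ∸ e) (ℕ.m+n∸m≡n e D) (ℕ.∸-monoˡ-≤ e e+D≤i)
  top-term : coeff (leadTerm p s ⊗ s) i ≡ lead p ℤ.* coeff s (i ∸ e)
  top-term = ≡.trans (≡.cong (coeff (leadTerm p s ⊗ s)) (≡.sym (ℕ.m+[n∸m]≡n e≤i))) (coeff-shifted-⊗ e (lead p) s (i ∸ e))
  difference : coeff p i ℤ.- lead p ℤ.* coeff s (i ∸ e) ≡ 0ℤ
  difference with ℕ.m≤n⇒m<n∨m≡n D≤j
  ... | inj₁ D<j = ≡.trans (≡.cong₂ (λ x y → x ℤ.- lead p ℤ.* y) p-zero (m .above (i ∸ e) D<j))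
                     (≡.cong (λ x → 0ℤ ℤ.- x) (ℤ.*-zeroʳ (lead p)))
    where
    p-zero : coeff p i ≡ 0ℤ
    p-zero = coeff-length p i (≡.subst₂ _≤_ (≡.trans (ℕ.+-suc e D) (≡.sym lp)) (ℕ.m+[n∸m]≡n e≤i) (ℕ.+-monoʳ-≤ e D<j))
  ... | inj₂ D≡j = ≡.trans (≡.cong₂ (λ x y → x ℤ.- y) (≡.sym p-lead) (≡.trans (≡.cong (λ j → lead p ℤ.* coeff s j) (≡.sym D≡j)) (≡.trans (≡.cong (lead p ℤ.*_) (m .top)) (ℤ.*-identityʳ (lead p))))) (ℤ.+-inverseʳ (lead p))
    where
    p-lead : lead p ≡ coeff p i
    p-lead = ≡.trans (lead-coeff p (e ℕ.+ D) lp) (≡.cong (coeff p) (≡.trans (≡.cong (e ℕ.+_) D≡j) (ℕ.m+[n∸m]≡n e≤i)))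

-- The exact quotient `c` is carried along: a round replaces it by c - t. The loop stops when the
-- dividend is shorter than `s`, and a multiple of the monic `s` that short is 0. The bound `suc l`
-- matches the fuel, so nothing is left after the last round.
divLoop-correct : ∀ l p s c D → Monic s D → length s ≡ suc D → p ≐ c ⊗ s →
  (∀ i → suc l ≤ i → coeff p i ≡ 0ℤ) → divLoop l p s (strip p) ≐ c
divLoop-correct l p s c D m ls p≐cs small with length (strip p) <? length s
... | yes lt = ≐-sym (monic-zero m c (λ i D≤i →
      ≡.trans (≡.sym (p≐cs .at i)) (≡.trans (≡.sym (strip-coeff p .at i))
      (coeff-length (strip p) i (ℕ.≤-trans (ℕ.s≤s⁻¹ (≡.subst (length (strip p) <_) ls lt)) D≤i)))))
divLoop-correct zero p s c D m ls p≐cs small | no ¬lt =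
  ≐-trans (⊕-identityʳ t) (≐-sym (⊖-zero (monic-zero m (c ⊖ t) (λ i _ →
    ≡.trans (≡.sym (remainder .at i)) (leadTerm-cancels (strip p) s D m ls (ℕ.≮⇒≥ ¬lt) i (ℕ.≤-trans (strip-minimal p 1 small) (s≤s z≤n)))))))
  where
  t = leadTerm (strip p) s
  remainder : strip p ⊖ t ⊗ s ≐ (c ⊖ t) ⊗ s
  remainder = ≐-trans (⊕-congʳ (negP (t ⊗ s)) (≐-trans (strip-coeff p) p≐cs)) (≐-sym (⊖-⊗ c t s))
divLoop-correct (suc l) p s c D m ls p≐cs small | no ¬lt =
  ≐-trans (⊕-congˡ t (divLoop-correct l (strip p ⊖ t ⊗ s) s (c ⊖ t) D m ls remainder
    (λ i l<i → leadTerm-cancels (strip p) s D m ls (ℕ.≮⇒≥ ¬lt) i (ℕ.≤-trans (strip-minimal p (suc (suc l)) small) (s≤s l<i)))))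
    (⊕-⊖ t c)
  where
  t = leadTerm (strip p) s
  remainder : strip p ⊖ t ⊗ s ≐ (c ⊖ t) ⊗ s
  remainder = ≐-trans (⊕-congʳ (negP (t ⊗ s)) (≐-trans (strip-coeff p) p≐cs)) (≐-sym (⊖-⊗ c t s))

divMonic-correct : ∀ p d c {D} → Monic d D → p ≐ c ⊗ d → divMonic p d ≐ c
divMonic-correct p d c {D} m e = divLoop-correct (length p) p (strip d) c D ms ls
  (≐-trans e (⊗-congˡ c (≐-sym (strip-coeff d)))) (λ i l<i → coeff-length p i (ℕ.<⇒≤ l<i))
  where
  ms : Monic (strip d) D
  ms = Monic-cong (≐-sym (strip-coeff d)) m
  D<length : D < length (strip d)
  D<length with ℕ.≤-<-connex (length (strip d)) D
  ... | inj₂ lt = lt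
  ... | inj₁ le with () ← ≡.trans (≡.sym (coeff-length (strip d) D le)) (ms .top)
  ls : length (strip d) ≡ suc D
  ls = ℕ.≤-antisym (strip-minimal d (suc D) (m .above)) D<length

-- Divisibility, and regularity modulo an element.

module Divisibility
  (R : CommutativeRing 0ℓ 0ℓ)
  (ℤ⟶R : ℤ.+-*-rawRing -Raw-AlmostCommutative⟶ fromCommutativeRing R)
  (q : CommutativeRing.Carrier R)
  where
  open CommutativeRing R
  open GaussianBinomials R ℤ⟶R q

  infix 4 _∣_
  record _∣_ (x y : Carrier) : Set where
    constructor divides-by
    field
      quotient : Carrier
      equality : quotient * x ≈ y

  ∣-refl : ∀ {x} → x ∣ x
  ∣-refl {x} = divides-by 1# (*-identityˡ x)

  1∣ : ∀ x → 1# ∣ x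
  1∣ x = divides-by x (*-identityʳ x)

  ∣-resp : ∀ {x y z} → y ≈ z → x ∣ y → x ∣ z
  ∣-resp y≈z (divides-by c e) = divides-by c (trans e y≈z)

  ∣-respˡ : ∀ {x y z} → x ≈ y → x ∣ z → y ∣ z
  ∣-respˡ x≈y (divides-by c e) = divides-by c (trans (*-congˡ (sym x≈y)) e)

  ∣-*ˡ : ∀ {x y} z → x ∣ y → x ∣ z * y
  ∣-*ˡ z (divides-by c e) = divides-by (z * c) (trans (*-assoc z c _) (*-congˡ e))

  ∣-trans : ∀ {x y z} → x ∣ y → y ∣ z → x ∣ z
  ∣-trans x∣y (divides-by d f) = ∣-resp f (∣-*ˡ d x∣y)

  ∣-*-mono : ∀ {x y u v} → x ∣ y → u ∣ v → x * u ∣ y * v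
  ∣-*-mono {x} {y} {u} {v} (divides-by c e) (divides-by d f) = divides-by (c * d)
    (trans (solve 4 (λ c d x u → (c :* d) :* (x :* u) := (c :* x) :* (d :* u)) refl c d x u) (*-cong e f))

  ∣-+ : ∀ {x y z} → x ∣ y → x ∣ z → x ∣ y + z
  ∣-+ (divides-by c e) (divides-by d f) = divides-by (c + d) (trans (distribʳ _ c d) (+-cong e f))

  ∣-neg : ∀ {x y} → x ∣ y → x ∣ - y
  ∣-neg {x} {y} (divides-by c e) = divides-by (- c) (trans (solve 2 (λ c x → :- c :* x := :- (c :* x)) refl c x) (-‿cong e))

  -- The exponents k for which P divides (1 - q^k) x are closed under sums, differences and
  -- multiples, hence under gcd. This takes the place of a Euclidean algorithm for the polynomials 1
  -- - q^k.
  1−q^-closed-+ : ∀ {P} x j k → P ∣ 1−q^ j * x → P ∣ 1−q^ k * x → P ∣ 1−q^ (j ℕ.+ k) * x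
  1−q^-closed-+ x j k d₁ d₂ = ∣-resp (begin
    1−q^ j * x + q ^ j * (1−q^ k * x)  ≈⟨ solve 4 (λ a b c x → a :* x :+ b :* (c :* x) := (a :+ b :* c) :* x) refl (1−q^ j) (q ^ j) (1−q^ k) x ⟩
    (1−q^ j + q ^ j * 1−q^ k) * x      ≈⟨ *-congʳ (1−q^-+ j k) ⟨
    1−q^ (j ℕ.+ k) * x                 ∎) (∣-+ d₁ (∣-*ˡ (q ^ j) d₂))

  1−q^-closed-− : ∀ {P} x j k → P ∣ 1−q^ (j ℕ.+ k) * x → P ∣ 1−q^ k * x → P ∣ 1−q^ j * x
  1−q^-closed-− x j k d₁ d₂ = ∣-resp (begin
    1−q^ (j ℕ.+ k) * x - q ^ j * (1−q^ k * x)  ≈⟨ +-congʳ (*-congʳ (1−q^-+ j k)) ⟩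
    (1−q^ j + q ^ j * 1−q^ k) * x - q ^ j * (1−q^ k * x) ≈⟨ solve 4 (λ a b c x → (a :+ b :* c) :* x :- b :* (c :* x) := a :* x) refl (1−q^ j) (q ^ j) (1−q^ k) x ⟩
    1−q^ j * x                                 ∎) (∣-+ d₁ (∣-neg (∣-*ˡ (q ^ j) d₂)))

  1−q^-closed-* : ∀ {P} x c k → P ∣ 1−q^ k * x → P ∣ 1−q^ (c ℕ.* k) * x
  1−q^-closed-* x zero k _ = divides-by 0# (trans (zeroˡ _) (sym (trans (*-congʳ (-‿inverseʳ 1#)) (zeroˡ x))))
  1−q^-closed-* x (suc c) k d = 1−q^-closed-+ x k (c ℕ.* k) d (1−q^-closed-* x c k d)

  1−q^-closed-Bézout : ∀ {P} x {g j k} → Bézout.Identity g j k → P ∣ 1−q^ j * x → P ∣ 1−q^ k * x → P ∣ 1−q^ g * x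
  1−q^-closed-Bézout {P} x {g} {j} {k} (Bézout.+- a b eq) dj dk =
    1−q^-closed-− x g (b ℕ.* k) (≡.subst (λ i → P ∣ 1−q^ i * x) (≡.sym eq) (1−q^-closed-* x a j dj)) (1−q^-closed-* x b k dk)
  1−q^-closed-Bézout {P} x {g} {j} {k} (Bézout.-+ a b eq) dj dk =
    1−q^-closed-− x g (a ℕ.* j) (≡.subst (λ i → P ∣ 1−q^ i * x) (≡.sym eq) (1−q^-closed-* x b k dk)) (1−q^-closed-* x a j dj)

  1−q^-∣ : ∀ {j k} → j ℕ.∣ k → 1−q^ j ∣ 1−q^ k
  1−q^-∣ {j} (ℕ.divides c ≡.refl) = ∣-resp (*-identityʳ _) (1−q^-closed-* 1# c j (∣-resp (sym (*-identityʳ _)) ∣-refl))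

  prod : ℕ → (ℕ → Carrier) → Carrier
  prod zero f = 1#
  prod (suc k) f = f 0 * prod k (f ∘ suc)

  prod-last : ∀ k f → prod (suc k) f ≈ prod k f * f k
  prod-last zero f = *-comm _ _
  prod-last (suc k) f = trans (*-congˡ (prod-last k (f ∘ suc))) (sym (*-assoc _ _ _))

  prod-∣ : ∀ k {f g} → (∀ i → i < k → f i ∣ g i) → prod k f ∣ prod k g
  prod-∣ zero _ = ∣-refl
  prod-∣ (suc k) h = ∣-*-mono (h 0 (s≤s z≤n)) (prod-∣ k (λ i i<k → h (suc i) (s≤s i<k)))

  prod-prefix : ∀ {j k} f → j ≤ k → prod j f ∣ prod k f
  prod-prefix f z≤n = 1∣ _
  prod-prefix f (s≤s j≤k) = ∣-*-mono ∣-refl (prod-prefix (f ∘ suc) j≤k)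

  -- Regularity modulo P and not a Bézout identity: coprime elements of ℤ[q] need not generate the
  -- unit ideal, as q - 1 and q + 1 show.
  CoprimeTo : Carrier → Carrier → Set
  CoprimeTo P x = ∀ y → P ∣ x * y → P ∣ y

  coprime-factor : ∀ {P x d} → CoprimeTo P x → d ∣ x → CoprimeTo P d
  coprime-factor {P} {x} {d} cop (divides-by c e) y h = cop y (∣-resp (trans (sym (*-assoc c d y)) (*-congʳ e)) (∣-*ˡ c h))

  coprime-1 : ∀ {P} → CoprimeTo P 1#
  coprime-1 y = ∣-resp (*-identityˡ y)

  coprime-prod : ∀ {P} k f → (∀ i → i < k → CoprimeTo P (f i)) → CoprimeTo P (prod k f)
  coprime-prod zero f _ = coprime-1
  coprime-prod (suc k) f h y d = coprime-prod k (f ∘ suc) (λ i i<k → h (suc i) (s≤s i<k)) y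
    (h 0 (s≤s z≤n) _ (∣-resp (*-assoc _ _ _) d))

  -- One factor at a time: if the product of the earlier factors times c is x, then f k divides that
  -- product times c, and being coprime to the product it divides c.
  prod-coprime-∣ : ∀ k f x → (∀ i → i < k → f i ∣ x) → (∀ i → i < k → CoprimeTo (f i) (prod i f)) → prod k f ∣ x
  prod-coprime-∣ zero f x _ _ = 1∣ x
  prod-coprime-∣ (suc k) f x f∣x cop with prod-coprime-∣ k f x (λ i i<k → f∣x i (ℕ.m<n⇒m<1+n i<k)) (λ i i<k → cop i (ℕ.m<n⇒m<1+n i<k))
  ... | divides-by c e = ∣-respˡ (sym (prod-last k f)) (∣-resp (trans (*-comm _ _) e)
    (∣-*-mono ∣-refl (cop k (ℕ.n<1+n k) c (∣-resp (trans (sym e) (*-comm _ _)) (f∣x k (ℕ.n<1+n k))))))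

-- Cyclotomic polynomials over ℤ.

module CyclotomicPolynomials where

  q : Poly
  q = X^ 1

  open GaussianBinomials ℤ[q] ℤ⟶ℤ[q] q using (1−q^; _^_; solve; _:=_; _:+_; _:*_; _:-_; :-_; :1)
  open Divisibility ℤ[q] ℤ⟶ℤ[q] q

  shiftP≐ : ∀ k p → shiftP k p ≐ q ^ k ⊗ p
  shiftP≐ zero p = ≐-sym (⊗-identityˡ p)
  shiftP≐ (suc k) p = ≐-trans (0∷-cong (shiftP≐ k p)) (≐-sym
    (≐-trans (⊗-congʳ p (q⊗ (q ^ k))) (0∷-⊗ (q ^ k) p)))
    where
    q⊗ : ∀ p → q ⊗ p ≐ 0ℤ ∷ p
    q⊗ p = ≐-trans (0∷-⊗ (cst 1ℤ) p) (0∷-cong (⊗-identityˡ p))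

  X^≐ : ∀ k → X^ k ≐ q ^ k
  X^≐ k = ≐-trans (shiftP≐ k (cst 1ℤ)) (≐-trans (⊗-comm (q ^ k) (cst 1ℤ)) (⊗-identityˡ (q ^ k)))

  X^-1≐ : ∀ k → X^ k ⊖ cst 1ℤ ≐ negP (1−q^ k)
  X^-1≐ k = ≐-trans (⊕-congʳ (negP (cst 1ℤ)) (X^≐ k)) (solve 1 (λ x → x :- :1 := :- (:1 :- x)) ≐-refl (q ^ k))

  X^-1-monic : ∀ n → Monic (X^ (suc n) ⊖ cst 1ℤ) (suc n)
  X^-1-monic n = Monic-cong (∷-cong ≡.refl (≐-sym (⊕-identityʳ (X^ n))))
    (monic (X^-top n) (λ { (suc i) (s≤s n<i) → X^-above n i n<i }))
    where
    X^-top : ∀ n → coeff (X^ n) n ≡ 1ℤ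
    X^-top zero = ≡.refl
    X^-top (suc n) = X^-top n
    X^-above : ∀ n i → n < i → coeff (X^ n) i ≡ 0ℤ
    X^-above zero (suc i) _ = ≡.refl
    X^-above (suc n) (suc i) (s≤s lt) = X^-above n i lt

  -- The Euler operator q d/dq.
  θ : Poly → Poly
  θ [] = []
  θ (a ∷ p) = 0ℤ ∷ (p ⊕ θ p)

  coeff-θ : ∀ p i → coeff (θ p) i ≡ + i ℤ.* coeff p i
  coeff-θ [] i = ≡.sym (ℤ.*-zeroʳ (+ i))
  coeff-θ (a ∷ p) zero = ≡.refl
  coeff-θ (a ∷ p) (suc i) = ≡.trans (coeff-⊕ p (θ p) i)
    (≡.trans (≡.cong (ℤ._+_ (coeff p i)) (coeff-θ p i)) (≡.sym (ℤ.suc-* (+ i) (coeff p i))))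

  θ-cong : ∀ {p r} → p ≐ r → θ p ≐ θ r
  θ-cong {p} {r} e .at i = ≡.trans (coeff-θ p i) (≡.trans (≡.cong (+ i ℤ.*_) (e .at i)) (≡.sym (coeff-θ r i)))

  θ-⊕ : ∀ p r → θ (p ⊕ r) ≐ θ p ⊕ θ r
  θ-⊕ p r .at i rewrite coeff-θ (p ⊕ r) i | coeff-⊕ p r i | coeff-⊕ (θ p) (θ r) i | coeff-θ p i | coeff-θ r i =
    ℤ.*-distribˡ-+ (+ i) (coeff p i) (coeff r i)

  θ-scale : ∀ c p → θ (scale c p) ≐ scale c (θ p)
  θ-scale c p .at i rewrite coeff-θ (scale c p) i | coeff-scale c p i | coeff-scale c (θ p) i | coeff-θ p i =
    ℤ-solve 3 (λ i c x → i ⊛ (c ⊛ x) ⊜ c ⊛ (i ⊛ x)) ≡.refl (+ i) c (coeff p i)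
    where open ℤ.+-*-Solver using () renaming (solve to ℤ-solve; _:*_ to _⊛_; _:=_ to _⊜_)

  θ-⊗ : ∀ p r → θ (p ⊗ r) ≐ θ p ⊗ r ⊕ p ⊗ θ r
  θ-⊗ [] r = ≐-refl
  θ-⊗ (a ∷ p) r = ≐-trans (θ-⊕ (scale a r) (0ℤ ∷ (p ⊗ r)))
    (≐-trans (⊕-cong (θ-scale a r) (0∷-cong (⊕-congˡ (p ⊗ r) (θ-⊗ p r))))
    (≐-trans (solve 4 (λ A B C D → A :+ (B :+ (C :+ D)) := (B :+ C) :+ (A :+ D)) ≐-refl
                (scale a (θ r)) (0ℤ ∷ (p ⊗ r)) (0ℤ ∷ (θ p ⊗ r)) (0ℤ ∷ (p ⊗ θ r)))
    (⊕-congʳ (scale a (θ r) ⊕ (0ℤ ∷ (p ⊗ θ r))) (≐-sym (≐-trans (0∷-⊗ (p ⊕ θ p) r) (0∷-cong (⊗-distribʳ r p (θ p))))))))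

  θ-X^ : ∀ n → θ (X^ n) ≐ cst (+ n) ⊗ X^ n
  θ-X^ n = ≐-trans (by-coeff (λ i → ≡.trans (coeff-θ (X^ n) i) (≡.trans (only-n n i) (≡.sym (coeff-scale (+ n) (X^ n) i))))) (≐-sym (cst-⊗ (+ n) (X^ n)))
    where
    only-n : ∀ n i → + i ℤ.* coeff (X^ n) i ≡ + n ℤ.* coeff (X^ n) i
    only-n zero zero = ≡.refl
    only-n zero (suc i) = ℤ.*-zeroʳ (+ suc i)
    only-n (suc n) zero = ≡.sym (ℤ.*-zeroʳ (+ suc n))
    only-n (suc n) (suc i) = ≡.trans (ℤ.suc-* (+ i) (coeff (X^ n) i))
      (≡.trans (≡.cong (ℤ._+_ (coeff (X^ n) i)) (only-n n i)) (≡.sym (ℤ.suc-* (+ n) (coeff (X^ n) i))))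

  -- q^n - 1 has no repeated factor, since q (q^n - 1)′ - n (q^n - 1) = n.
  factors-coprime : ∀ n {D} f g → Monic f D → f ⊗ g ≐ X^ (suc n) ⊖ cst 1ℤ → CoprimeTo f g
  factors-coprime n f g m fg y (divides-by c cf) = divides-by c′ (by-coeff (λ i →
    ℤ.*-cancelˡ-≡ z (coeff (c′ ⊗ f) i) (coeff y i) (≡.trans (≡.sym (coeff-scale z (c′ ⊗ f) i)) (≡.trans (cancelled .at i) (coeff-scale z y i)))))
    where
    z = + suc n
    N = cst z
    x = X^ (suc n)
    bézout : (θ g ⊖ N ⊗ g) ⊗ f ⊕ θ f ⊗ g ≐ N
    bézout = ≐-trans (solve 5 (λ f g f′ g′ N → (g′ :- N :* g) :* f :+ f′ :* g := (f′ :* g :+ f :* g′) :- N :* (f :* g)) ≐-refl f g (θ f) (θ g) N)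
      (≐-trans (⊕-cong (≐-trans (≐-sym (θ-⊗ f g)) (≐-trans (θ-cong fg) (≐-trans (θ-⊕ x (negP (cst 1ℤ)))
                  (≐-trans (⊕-cong (θ-X^ (suc n)) ∷-zero) (⊕-identityʳ (N ⊗ x))))))
                (negP-cong (⊗-congˡ N fg)))
      (solve 2 (λ N x → N :* x :- N :* (x :- :1) := N) ≐-refl N x))
    f∣Ny : f ∣ N ⊗ y
    f∣Ny = ∣-resp (≐-trans (solve 5 (λ a f b g y → (a :* y) :* f :+ b :* (g :* y) := (a :* f :+ b :* g) :* y) ≐-refl (θ g ⊖ N ⊗ g) f (θ f) g y) (⊗-congʳ y bézout))
      (∣-+ (∣-*ˡ ((θ g ⊖ N ⊗ g) ⊗ y) ∣-refl) (∣-*ˡ (θ f) (divides-by c cf)))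
    C : Poly
    C = _∣_.quotient f∣Ny
    quotients : ∀ p → (∀ i → z ∣ℤ coeff p i) → Σ Poly λ p′ → p ≐ scale z p′
    quotients [] _ = [] , ≐-refl
    quotients (a ∷ p) h with h 0 | quotients p (h ∘ suc)
    ... | divides k e | p′ , e′ = k ∷ p′ , ∷-cong (≡.trans e (ℤ.*-comm k z)) e′
    -- The integer `z` divides every coefficient of C f = z y. As f is monic, it divides those of
    -- `C` too, and cancelling it yields f ∣ y.
    divided : Σ Poly λ c′ → C ≐ scale z c′
    divided = quotients C (monic-divisible z m C (λ i _ → divides (coeff y i)
      (≡.trans (_∣_.equality f∣Ny .at i) (≡.trans (cst-⊗ z y .at i) (≡.trans (coeff-scale z y i) (ℤ.*-comm z (coeff y i)))))))
    c′ : Poly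
    c′ = proj₁ divided
    cancelled : scale z (c′ ⊗ f) ≐ scale z y
    cancelled = ≐-trans (≐-sym (scale-⊗ z c′ f)) (≐-trans (⊗-congʳ f (≐-sym (proj₂ divided)))
      (≐-trans (_∣_.equality f∣Ny) (cst-⊗ z y)))

  cycTable-Φ : ∀ n d → suc d ≤ n → cycTable n (suc d) ≡ Φ (suc d)
  cycTable-Φ (suc n) d d≤n with suc d ℕ.≟ suc n
  cycTable-Φ (suc n) .n d≤n | yes ≡.refl with suc n ℕ.≟ suc n
  ... | yes ≡.refl = ≡.refl
  ... | no n≢n = contradiction ≡.refl n≢n
  cycTable-Φ (suc n) d d≤n | no d≢n = cycTable-Φ n d (ℕ.s≤s⁻¹ (ℕ.≤∧≢⇒< d≤n d≢n))

  data Factor (n : ℕ) : ℕ → Poly → Set where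
    trivial : ∀ {d} → Factor n d (cst 1ℤ)
    cyclotomic : ∀ {d} → suc d ℕ.∣ suc n → Factor n (suc d) (Φ (suc d))

  factor-view : ∀ n d → d ≤ n → Factor n d (factor n d)
  factor-view n zero _ = trivial
  factor-view n (suc d) d≤n with suc d ℕ.∣? suc n
  ... | yes d∣n = ≡.subst (Factor n (suc d)) (≡.sym (cycTable-Φ n d d≤n)) (cyclotomic d∣n)
  ... | no _ = trivial

  factor-Φ : ∀ n d → d < n → suc d ℕ.∣ suc n → factor n (suc d) ≡ Φ (suc d)
  factor-Φ n d d<n d∣n with suc d ℕ.∣? suc n
  ... | yes _ = cycTable-Φ n d d<n
  ... | no d∤n = contradiction d∣n d∤n

  -- The product of Φ_d over the proper divisors d of n + 1; the other indices contribute 1.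
  Ψ : ℕ → Poly
  Ψ n = prod (suc n) (factor n)

  prodP≡prod : ∀ (f : ℕ → Poly) k → prodP (map f (upTo k)) ≡ prod k f
  prodP≡prod f k = ≡.trans (≡.cong prodP (map-upTo f k)) (go f k)
    where
    go : ∀ f k → prodP (applyUpTo f k) ≡ prod k f
    go f zero = ≡.refl
    go f (suc k) = ≡.cong (f 0 ⊗_) (go (f ∘ suc) k)

  left-factor-∣ : ∀ n f g → f ⊗ g ≐ X^ (suc n) ⊖ cst 1ℤ → f ∣ 1−q^ (suc n)
  left-factor-∣ n f g e = ∣-resp (≐-trans (negP-cong (X^-1≐ (suc n))) (solve 1 (λ x → :- (:- x) := x) ≐-refl (1−q^ (suc n))))
      (∣-neg (divides-by g (≐-trans (⊗-comm g f) e)))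

  -- Proved together by strong induction: the division defining Φ_(n+1) is exact because the earlier
  -- Φ_d are monic and mutually coprime divisors of q^(n+1) - 1, while `coprime` uses the
  -- factorization of q^g - 1 for proper divisors g of n + 1.
  record Cyclotomic (n : ℕ) : Set where
    field
      factorization : Φ (suc n) ⊗ Ψ n ≐ X^ (suc n) ⊖ cst 1ℤ
      {degree} : ℕ
      Φ-monic : Monic (Φ (suc n)) degree
      coprime : ∀ k → k < n → CoprimeTo (Φ (suc n)) (1−q^ (suc k))

    Φ∣1−q^ : Φ (suc n) ∣ 1−q^ (suc n)
    Φ∣1−q^ = left-factor-∣ n (Φ (suc n)) (Ψ n) factorization

  Monic-prod : ∀ k f → (∀ i → i < k → ∃ (Monic (f i))) → ∃ (Monic (prod k f))
  Monic-prod zero f _ = 0 , monic ≡.refl (λ { (suc i) _ → ≡.refl })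
  Monic-prod (suc k) f h with h 0 (s≤s z≤n) | Monic-prod k (f ∘ suc) (λ i i<k → h (suc i) (s≤s i<k))
  ... | D , m | E , m′ = D ℕ.+ E , Monic-⊗ (f 0) m m′

  Φ-cyclotomic : ∀ n → Cyclotomic n
  Φ-cyclotomic = <-rec Cyclotomic step
    where
    step : ∀ n → (∀ {m} → m < n → Cyclotomic m) → Cyclotomic n
    step n rec = record { factorization = factorization ; Φ-monic = proj₂ Φ-monic ; coprime = coprime }
      where
      open Cyclotomic using (Φ∣1−q^)

      factor-monic : ∀ d → d < suc n → ∃ (Monic (factor n d))
      factor-monic d (s≤s d≤n) with factor n d | factor-view n d d≤n
      ... | _ | trivial = 0 , monic ≡.refl (λ { (suc i) _ → ≡.refl })
      ... | _ | cyclotomic _ = _ , Cyclotomic.Φ-monic (rec d≤n)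

      factor-∣ : ∀ d → d < suc n → factor n d ∣ 1−q^ (suc n)
      factor-∣ d (s≤s d≤n) with factor n d | factor-view n d d≤n
      ... | _ | trivial = 1∣ _
      ... | _ | cyclotomic d∣n = ∣-trans (Φ∣1−q^ (rec d≤n)) (1−q^-∣ d∣n)

      -- For i < d, Φ_i divides 1 - q^i, and by induction Φ_d is coprime to 1 - q^i, hence to Φ_i.
      factors-independent : ∀ d → d < suc n → CoprimeTo (factor n d) (prod d (factor n))
      factors-independent d (s≤s d≤n) with factor n d | factor-view n d d≤n
      ... | _ | trivial = λ y _ → 1∣ y
      ... | _ | cyclotomic {d′} _ = coprime-prod (suc d′) (factor n) coprime-factorᵢ
        where
        coprime-factorᵢ : ∀ i → i < suc d′ → CoprimeTo (Φ (suc d′)) (factor n i)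
        coprime-factorᵢ i (s≤s i≤d′) with factor n i | factor-view n i (ℕ.≤-trans i≤d′ (ℕ.<⇒≤ d≤n))
        ... | _ | trivial = coprime-1
        ... | _ | cyclotomic {i′} _ = coprime-factor (Cyclotomic.coprime (rec d≤n) i′ i≤d′)
                                        (Φ∣1−q^ (rec (ℕ.<-trans i≤d′ d≤n)))

      Ψ-monic : ∃ (Monic (Ψ n))
      Ψ-monic = Monic-prod (suc n) (factor n) factor-monic

      Ψ∣ : Ψ n ∣ X^ (suc n) ⊖ cst 1ℤ
      Ψ∣ = ∣-resp (≐-sym (X^-1≐ (suc n))) (∣-neg (prod-coprime-∣ (suc n) (factor n) _ factor-∣ factors-independent))

      c : Poly
      c = _∣_.quotient Ψ∣

      Φ≐c : Φ (suc n) ≐ c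
      Φ≐c rewrite Φ-divMonic n | prodP≡prod (factor n) (suc n) =
        divMonic-correct (X^ (suc n) ⊖ cst 1ℤ) (Ψ n) c (proj₂ Ψ-monic) (≐-sym (_∣_.equality Ψ∣))

      factorization : Φ (suc n) ⊗ Ψ n ≐ X^ (suc n) ⊖ cst 1ℤ
      factorization = ≐-trans (⊗-congʳ (Ψ n) Φ≐c) (_∣_.equality Ψ∣)

      Φ-monic : ∃ (Monic (Φ (suc n)))
      Φ-monic = Monic-quotient (proj₂ Ψ-monic) (Φ (suc n)) (X^-1-monic n) factorization

      -- Up to sign, 1 - q^(g+1) is Φ_(g+1) times `Ψ g`. Divisors of g + 1 divide n + 1, so the
      -- factors of `Ψ g` recur among those of `Ψ n` with index at most g, and Φ_(g+1) is the factor
      -- that follows them.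
      1−q^∣Ψ : ∀ g → g < n → suc g ℕ.∣ suc n → 1−q^ (suc g) ∣ Ψ n
      1−q^∣Ψ g g<n g∣n = ∣-trans 1−q^∣ (∣-trans (∣-*-mono (∣-refl {Φ (suc g)}) Ψ∣prefix) (∣-respˡ prefix (prod-prefix (factor n) (s≤s g<n))))
        where
        1−q^∣ : 1−q^ (suc g) ∣ Φ (suc g) ⊗ Ψ g
        1−q^∣ = ∣-resp (≐-sym (≐-trans (Cyclotomic.factorization (rec g<n)) (X^-1≐ (suc g)))) (∣-neg ∣-refl)
        Ψ∣prefix : Ψ g ∣ prod (suc g) (factor n)
        Ψ∣prefix = prod-∣ (suc g) pointwise
          where
          pointwise : ∀ i → i < suc g → factor g i ∣ factor n i
          pointwise i (s≤s i≤g) with factor g i | factor-view g i i≤g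
          ... | _ | trivial = 1∣ _
          ... | _ | cyclotomic {i′} i∣g rewrite factor-Φ n i′ (ℕ.<-trans i≤g g<n) (ℕ.∣-trans i∣g g∣n) = ∣-refl
        prefix : prod (suc (suc g)) (factor n) ≐ Φ (suc g) ⊗ prod (suc g) (factor n)
        prefix = ≐-trans (prod-last (suc g) (factor n))
          (≐-trans (⊗-comm (prod (suc g) (factor n)) (factor n (suc g)))
            (≡.subst (λ f → f ⊗ prod (suc g) (factor n) ≐ Φ (suc g) ⊗ prod (suc g) (factor n)) (≡.sym (factor-Φ n g g<n g∣n)) ≐-refl))

      -- As Φ_(n+1) divides 1 - q^(n+1), the exponent k + 1 may be lowered to its gcd with n + 1, a
      -- proper divisor. For that exponent 1 - q^gcd divides `Ψ n`, which is coprime to Φ_(n+1)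
      -- because q^(n+1) - 1 has no repeated factor.
      coprime : ∀ k → k < n → CoprimeTo (Φ (suc n)) (1−q^ (suc k))
      coprime k k<n y d with Bézout.lemma (suc k) (suc n)
      ... | Bézout.result zero gcd _ with () ← ℕ.0∣⇒≡0 (GCD.gcd∣m gcd)
      ... | Bézout.result (suc g) gcd b =
        coprime-factor (factors-coprime n (Φ (suc n)) (Ψ n) (proj₂ Φ-monic) factorization)
          (1−q^∣Ψ g (ℕ.≤-trans (ℕ.∣⇒≤ (GCD.gcd∣m gcd)) k<n) (GCD.gcd∣n gcd)) y
          (1−q^-closed-Bézout y b d (∣-resp (⊗-comm y (1−q^ (suc n))) (∣-*ˡ y (left-factor-∣ n (Φ (suc n)) (Ψ n) factorization))))

open CyclotomicPolynomials

-- The q-binomials defined by division are the Gaussian binomials.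

module ExactBinomials where
  open GaussianBinomials ℤ[q] ℤ⟶ℤ[q] q
  open Divisibility ℤ[q] ℤ⟶ℤ[q] q using (prod; prod-last)

  private
    f : ℕ → Poly
    f j = X^ j ⊖ cst 1ℤ

  f-absorb : ∀ n k → f (suc k) ⊗ gb (suc n) (suc k) ≐ f (suc n) ⊗ gb n k
  f-absorb n k = ≐-trans (⊗-congʳ (gb (suc n) (suc k)) (X^-1≐ (suc k)))
    (≐-trans (solve 2 (λ y g → :- y :* g := :- (y :* g)) ≐-refl (1−q^ (suc k)) (gb (suc n) (suc k)))
    (≐-trans (negP-cong (gb-absorb n k))
    (≐-trans (solve 2 (λ y g → :- (y :* g) := :- y :* g) ≐-refl (1−q^ (suc n)) (gb n k))
    (⊗-congʳ (gb n k) (≐-sym (X^-1≐ (suc n)))))))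

  -- `f-absorb` exchanges the first numerator factor q^n - 1 for the last denominator factor q^k -
  -- 1, which leaves the claim for n - 1 and k - 1.
  numerator≐ : ∀ n k → k ≤ n → prod k (λ j → f (n ∸ j)) ≐ gb n k ⊗ prod k (λ i → f (suc i))
  numerator≐ n zero _ = ≐-sym (⊗-identityˡ (cst 1ℤ))
  numerator≐ (suc n) (suc k) (s≤s k≤n) = begin
    f (suc n) ⊗ prod k (λ j → f (n ∸ j))     ≈⟨ ⊗-congˡ (f (suc n)) (numerator≐ n k k≤n) ⟩
    f (suc n) ⊗ (gb n k ⊗ d)                 ≈⟨ ≐-sym (⊗-assoc (f (suc n)) (gb n k) d) ⟩
    (f (suc n) ⊗ gb n k) ⊗ d                 ≈⟨ ⊗-congʳ d (≐-sym (f-absorb n k)) ⟩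
    (f (suc k) ⊗ gb (suc n) (suc k)) ⊗ d     ≈⟨ solve 3 (λ a b c → (a :* b) :* c := b :* (c :* a)) ≐-refl (f (suc k)) (gb (suc n) (suc k)) d ⟩
    gb (suc n) (suc k) ⊗ (d ⊗ f (suc k))     ≈⟨ ⊗-congˡ (gb (suc n) (suc k)) (≐-sym (prod-last k (λ i → f (suc i)))) ⟩
    gb (suc n) (suc k) ⊗ prod (suc k) (λ i → f (suc i)) ∎
    where d = prod k (λ i → f (suc i))

  qbinomℕ≐gb : ∀ n k → qbinomℕ n k ≐ gb n k
  qbinomℕ≐gb n k with k ≤? n
  ... | no k≰n = ≐-sym (gb-zero (ℕ.≰⇒> k≰n))
  ... | yes k≤n rewrite prodP≡prod (λ j → f (n ∸ j)) k | prodP≡prod (λ i → f (suc i)) k =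
    divMonic-correct (prod k (λ j → f (n ∸ j))) (prod k (λ i → f (suc i))) (gb n k)
      (proj₂ (Monic-prod k (λ i → f (suc i)) (λ i _ → suc i , X^-1-monic i))) (numerator≐ n k k≤n)

-- Laurent polynomials in a ring where q is a unit.

module Laurent
  (R : CommutativeRing 0ℓ 0ℓ)
  (ℤ⟶R : ℤ.+-*-rawRing -Raw-AlmostCommutative⟶ fromCommutativeRing R)
  (q p : CommutativeRing.Carrier R)
  where
  open CommutativeRing R
  open LucasSums R ℤ⟶R q

  module _ (pq≈1 : p * q ≈ 1#) (shift : ℕ → Carrier → Carrier) (shift≈ : ∀ k x → shift k x ≈ q ^ k * x) where

    private
      clear : ∀ s x → p ^ s * (q ^ s * x) ≈ x
      clear s x = trans (sym (*-assoc _ _ _)) (trans (*-congʳ (inverse-^ pq≈1 s)) (*-identityˡ x))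

    laurent-+ : ∀ s t a b → p ^ (s ℕ.+ t) * (shift t a + shift s b) ≈ p ^ s * a + p ^ t * b
    laurent-+ s t a b = begin
      p ^ (s ℕ.+ t) * (shift t a + shift s b)          ≈⟨ *-cong (^-homo-* p s t) (+-cong (shift≈ t a) (shift≈ s b)) ⟩
      (p ^ s * p ^ t) * (q ^ t * a + q ^ s * b)        ≈⟨ solve 6 (λ x y u v a b → (x :* y) :* (u :* a :+ v :* b) := x :* (y :* (u :* a)) :+ y :* (x :* (v :* b))) refl (p ^ s) (p ^ t) (q ^ t) (q ^ s) a b ⟩
      p ^ s * (p ^ t * (q ^ t * a)) + p ^ t * (p ^ s * (q ^ s * b)) ≈⟨ +-cong (*-congˡ (clear t a)) (*-congˡ (clear s b)) ⟩
      p ^ s * a + p ^ t * b                            ∎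

    laurent-* : ∀ s t a b → p ^ (s ℕ.+ t) * (a * b) ≈ (p ^ s * a) * (p ^ t * b)
    laurent-* s t a b = trans (*-congʳ (^-homo-* p s t))
      (solve 4 (λ x y a b → (x :* y) :* (a :* b) := (x :* a) :* (y :* b)) refl (p ^ s) (p ^ t) a b)

    laurent-injective : ∀ s t a b → p ^ s * a ≈ p ^ t * b → shift t a ≈ shift s b
    laurent-injective s t a b e = begin
      shift t a                       ≈⟨ shift≈ t a ⟩
      q ^ t * a                       ≈⟨ *-congˡ (clear s a) ⟨
      q ^ t * (p ^ s * (q ^ s * a))   ≈⟨ solve 4 (λ t x s a → t :* (x :* (s :* a)) := t :* (s :* (x :* a))) refl (q ^ t) (p ^ s) (q ^ s) a ⟩
      q ^ t * (q ^ s * (p ^ s * a))   ≈⟨ *-congˡ (*-congˡ e) ⟩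
      q ^ t * (q ^ s * (p ^ t * b))   ≈⟨ solve 4 (λ t x s b → t :* (s :* (x :* b)) := s :* (x :* (t :* b))) refl (q ^ t) (p ^ t) (q ^ s) b ⟩
      q ^ s * (p ^ t * (q ^ t * b))   ≈⟨ *-congˡ (clear t b) ⟩
      q ^ s * b                       ≈⟨ shift≈ s b ⟨
      shift s b                       ∎

    q^-∸ : ∀ {a b} → b ≤ a → q ^ (a ∸ b) ≈ q ^ a * p ^ b
    q^-∸ {a} {b} b≤a = begin
      q ^ (a ∸ b)                    ≈⟨ clear b _ ⟨
      p ^ b * (q ^ b * q ^ (a ∸ b))  ≈⟨ *-congˡ (^-homo-* q b (a ∸ b)) ⟨
      p ^ b * q ^ (b ℕ.+ (a ∸ b))    ≈⟨ *-congˡ (^-≡ q (ℕ.m+[n∸m]≡n b≤a)) ⟩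
      p ^ b * q ^ a                  ≈⟨ *-comm _ _ ⟩
      q ^ a * p ^ b                  ∎

    p^-∸ : ∀ {a b} → a ≤ b → p ^ (b ∸ a) ≈ q ^ a * p ^ b
    p^-∸ {a} {b} a≤b = begin
      p ^ (b ∸ a)                    ≈⟨ trans (*-congʳ (inverse-^ pq≈1 a)) (*-identityˡ _) ⟨
      (p ^ a * q ^ a) * p ^ (b ∸ a)  ≈⟨ solve 3 (λ x y z → (x :* y) :* z := y :* (x :* z)) refl (p ^ a) (q ^ a) (p ^ (b ∸ a)) ⟩
      q ^ a * (p ^ a * p ^ (b ∸ a))  ≈⟨ *-congˡ (^-homo-* p a (b ∸ a)) ⟨
      q ^ a * p ^ (a ℕ.+ (b ∸ a))    ≈⟨ *-congˡ (^-≡ p (ℕ.m+[n∸m]≡n a≤b)) ⟩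
      q ^ a * p ^ b                  ∎

  -- When e² = 0, q^(n+1) = 1 - e has the inverse 1 + e, so q^n (1 + e) inverts q.
  inverse : ∀ n → 1−q^ (suc n) * 1−q^ (suc n) ≈ 0# → (q ^ n * (1# + 1−q^ (suc n))) * q ≈ 1#
  inverse n e²≈0 = begin
    (q ^ n * (1# + 1−q^ (suc n))) * q  ≈⟨ solve 2 (λ x q → (x :* (:1 :+ (:1 :- q :* x))) :* q := :1 :- (:1 :- q :* x) :* (:1 :- q :* x)) refl (q ^ n) q ⟩
    1# - 1−q^ (suc n) * 1−q^ (suc n)   ≈⟨ +-congˡ (-‿cong e²≈0) ⟩
    1# - 0#                            ≈⟨ trans (+-congˡ -0#≈0#) (+-identityʳ 1#) ⟩
    1#                                 ∎
    where open Algebra.Properties.Ring ring using (-0#≈0#)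

-- The exponents of 𝒜 and ℬ as exact halves.

half-double : ∀ w → half (w ℤ.* + 2) ≡ w
half-double (+ n) = ≡.trans (≡.cong half (≡.sym (ℤ.pos-* n 2))) (≡.cong +_ (ℕ.m*n/n≡m n 2))
-- Floor division of a negative integer branches on the remainder, which is 0 here.
half-double -[1+ n ] with suc n ℕ.* 2 ℕ.% 2 | ℕ.m*n%n≡0 (suc n) 2 {{_}}
... | .0 | ≡.refl = ≡.cong (λ k → ℤ.- + k) (ℕ.m*n/n≡m (suc n) 2)

half-unique : ∀ {z} w → z ≡ w ℤ.* + 2 → half z ≡ w
half-unique w e = ≡.trans (≡.cong half e) (half-double w)

module _ where
  open ℤ.+-*-Solver

  pentagonal*2 : ∀ r → + pentagonal r ℤ.* + 2 ≡ + r ℤ.* (+ 3 ℤ.* + r ℤ.- 1ℤ)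
  pentagonal*2 zero = ≡.refl
  pentagonal*2 (suc r) = ≡.trans (≡.cong (λ x → (1ℤ ℤ.+ x ℤ.+ + pentagonal r) ℤ.* + 2) (ℤ.pos-* r 3))
    (≡.trans (solve 2 (λ r P → (con 1ℤ :+ r :* con (+ 3) :+ P) :* con (+ 2) := P :* con (+ 2) :+ (con (+ 2) :+ con (+ 6) :* r)) ≡.refl (+ r) (+ pentagonal r))
    (≡.trans (≡.cong (ℤ._+ (+ 2 ℤ.+ + 6 ℤ.* + r)) (pentagonal*2 r))
    (solve 1 (λ r → r :* (con (+ 3) :* r :- con 1ℤ) :+ (con (+ 2) :+ con (+ 6) :* r) := (con 1ℤ :+ r) :* (con (+ 3) :* (con 1ℤ :+ r) :- con 1ℤ)) ≡.refl (+ r))))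

  half-3r-1 : ∀ r → half (+ r ℤ.* (+ (3 ℕ.* r) ℤ.- 1ℤ)) ≡ + pentagonal r
  half-3r-1 r = half-unique (+ pentagonal r) (≡.trans (≡.cong (λ t → + r ℤ.* (t ℤ.- 1ℤ)) (ℤ.pos-* 3 r)) (≡.sym (pentagonal*2 r)))

  half-3r+1 : ∀ r → half (+ r ℤ.* (+ (3 ℕ.* r) ℤ.+ 1ℤ)) ≡ + (pentagonal r ℕ.+ r)
  half-3r+1 r = half-unique (+ (pentagonal r ℕ.+ r)) (≡.trans (≡.cong (λ t → + r ℤ.* (t ℤ.+ 1ℤ)) (ℤ.pos-* 3 r))
    (≡.trans (solve 1 (λ r → r :* (con (+ 3) :* r :+ con 1ℤ) := r :* (con (+ 3) :* r :- con 1ℤ) :+ r :* con (+ 2)) ≡.refl (+ r))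
    (≡.trans (≡.cong (ℤ._+ + r ℤ.* + 2) (≡.sym (pentagonal*2 r))) (≡.sym (ℤ.*-distribʳ-+ (+ 2) (+ pentagonal r) (+ r))))))

  half-[r+1][3r+2] : ∀ r → half ((+ r ℤ.+ 1ℤ) ℤ.* (+ (3 ℕ.* r) ℤ.+ + 2)) ≡ + (suc (r ℕ.* 3) ℕ.+ pentagonal r)
  half-[r+1][3r+2] r = half-unique (+ (suc (r ℕ.* 3) ℕ.+ pentagonal r)) (≡.trans (≡.cong (λ t → (+ r ℤ.+ 1ℤ) ℤ.* (t ℤ.+ + 2)) (ℤ.pos-* 3 r))
    (≡.trans (solve 1 (λ r → (r :+ con 1ℤ) :* (con (+ 3) :* r :+ con (+ 2)) := (con 1ℤ :+ r :* con (+ 3)) :* con (+ 2) :+ r :* (con (+ 3) :* r :- con 1ℤ)) ≡.refl (+ r))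
    (≡.trans (≡.cong (ℤ._+_ ((1ℤ ℤ.+ + r ℤ.* + 3) ℤ.* + 2)) (≡.sym (pentagonal*2 r)))
    (≡.trans (≡.sym (ℤ.*-distribʳ-+ (+ 2) (1ℤ ℤ.+ + r ℤ.* + 3) (+ pentagonal r)))
    (≡.cong (λ x → (1ℤ ℤ.+ x ℤ.+ + pentagonal r) ℤ.* + 2) (≡.sym (ℤ.pos-* r 3)))))))

  -- This exponent is -1 at r = 1, and that of the next lemma is -1 at r = 0; hence `⊖` instead of a
  -- natural number.
  half-3r-5 : ∀ r → half (+ r ℤ.* (+ (3 ℕ.* r) ℤ.- + 5)) ≡ pentagonal r ℤ.⊖ (2 ℕ.* r)
  half-3r-5 r = ≡.trans (half-unique (+ pentagonal r ℤ.- + (2 ℕ.* r)) (≡.trans (≡.cong (λ t → + r ℤ.* (t ℤ.- + 5)) (ℤ.pos-* 3 r))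
    (≡.trans (solve 1 (λ r → r :* (con (+ 3) :* r :- con (+ 5)) := r :* (con (+ 3) :* r :- con 1ℤ) :- (con (+ 2) :* r) :* con (+ 2)) ≡.refl (+ r))
    (≡.trans (≡.cong₂ (λ x y → x ℤ.- y ℤ.* + 2) (≡.sym (pentagonal*2 r)) (≡.sym (ℤ.pos-* 2 r)))
    (solve 2 (λ P t → P :* con (+ 2) :- t :* con (+ 2) := (P :- t) :* con (+ 2)) ≡.refl (+ pentagonal r) (+ (2 ℕ.* r)))))))
    (ℤ.m-n≡m⊖n (pentagonal r) (2 ℕ.* r))

  half-[r-1][3r+2] : ∀ r → half ((+ r ℤ.- 1ℤ) ℤ.* (+ (3 ℕ.* r) ℤ.+ + 2)) ≡ pentagonal r ℤ.⊖ 1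
  half-[r-1][3r+2] r = ≡.trans (half-unique (+ pentagonal r ℤ.- 1ℤ) (≡.trans (≡.cong (λ t → (+ r ℤ.- 1ℤ) ℤ.* (t ℤ.+ + 2)) (ℤ.pos-* 3 r))
    (≡.trans (solve 1 (λ r → (r :- con 1ℤ) :* (con (+ 3) :* r :+ con (+ 2)) := r :* (con (+ 3) :* r :- con 1ℤ) :- con (+ 2)) ≡.refl (+ r))
    (≡.trans (≡.cong (ℤ._- + 2) (≡.sym (pentagonal*2 r)))
    (solve 1 (λ P → P :* con (+ 2) :- con (+ 2) := (P :- con 1ℤ) :* con (+ 2)) ≡.refl (+ pentagonal r))))))
    (ℤ.m-n≡m⊖n (pentagonal r) 1)

monoᴸ-⊖-< : ∀ {a b} → a < b → monoᴸ (a ℤ.⊖ b) ≡ (b ∸ a , cst 1ℤ)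
monoᴸ-⊖-< {a} {b} a<b with b ∸ a | ℤ.⊖-< a<b | ℕ.m<n⇒0<n∸m a<b
... | suc d | e | _ = ≡.cong monoᴸ e

-- The residue classes modulo 3 and the cases of 𝒜 and ℬ.

data Thirds : ℕ → Set where
  3r : ∀ r → Thirds (r ℕ.* 3)
  3r+1 : ∀ r → Thirds (1 ℕ.+ r ℕ.* 3)
  3r+2 : ∀ r → Thirds (2 ℕ.+ r ℕ.* 3)

thirds : ∀ n → Thirds n
thirds zero = 3r 0
thirds (suc n) with thirds n
... | 3r r = 3r+1 r
... | 3r+1 r = 3r+2 r
... | 3r+2 r = 3r (suc r)

private
  %3 : ∀ i r → i < 3 → (i ℕ.+ r ℕ.* 3) ℕ.% 3 ≡ i
  %3 i r i<3 = ≡.trans (ℕ.[m+kn]%n≡m%n i r 3) (ℕ.m<n⇒m%n≡m i<3)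

  /3 : ∀ i r → i < 3 → (i ℕ.+ r ℕ.* 3) ℕ./ 3 ≡ r
  /3 i r i<3 = ≡.trans (ℕ.+-distrib-/-∣ʳ i (ℕ.divides r ≡.refl)) (≡.cong₂ ℕ._+_ (ℕ.m<n⇒m/n≡0 i<3) (ℕ.m*n/n≡m r 3))

  0<3 : 0 < 3
  0<3 = s≤s z≤n
  1<3 : 1 < 3
  1<3 = s≤s (s≤s z≤n)
  2<3 : 2 < 3
  2<3 = s≤s (s≤s (s≤s z≤n))

𝒜-3r : ∀ r → 𝒜 (r ℕ.* 3) ≡ cstᴸ (sgn r) ⊗ᴸ (cstᴸ 1ℤ ⊕ᴸ monoᴸ (+ r)) ⊗ᴸ monoᴸ (+ pentagonal r)
𝒜-3r r with (r ℕ.* 3) ℕ.% 3 | %3 0 r 0<3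
... | _ | ≡.refl with (r ℕ.* 3) ℕ./ 3 | /3 0 r 0<3
... | _ | ≡.refl = ≡.cong (λ z → cstᴸ (sgn r) ⊗ᴸ (cstᴸ 1ℤ ⊕ᴸ monoᴸ (+ r)) ⊗ᴸ monoᴸ z) (half-3r-1 r)

𝒜-3r+1 : ∀ r → 𝒜 (1 ℕ.+ r ℕ.* 3) ≡ cstᴸ (sgn r) ⊗ᴸ monoᴸ (+ (pentagonal r ℕ.+ r))
𝒜-3r+1 r with (1 ℕ.+ r ℕ.* 3) ℕ.% 3 | %3 1 r 1<3
... | _ | ≡.refl with (1 ℕ.+ r ℕ.* 3) ℕ./ 3 | /3 1 r 1<3
... | _ | ≡.refl = ≡.cong (λ z → cstᴸ (sgn r) ⊗ᴸ monoᴸ z) (half-3r+1 r)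

𝒜-3r+2 : ∀ r → 𝒜 (2 ℕ.+ r ℕ.* 3) ≡ cstᴸ (ℤ.- sgn r) ⊗ᴸ monoᴸ (+ (suc (r ℕ.* 3) ℕ.+ pentagonal r))
𝒜-3r+2 r with (2 ℕ.+ r ℕ.* 3) ℕ.% 3 | %3 2 r 2<3
... | _ | ≡.refl with (2 ℕ.+ r ℕ.* 3) ℕ./ 3 | /3 2 r 2<3
... | _ | ≡.refl = ≡.cong (λ z → cstᴸ (ℤ.- sgn r) ⊗ᴸ monoᴸ z) (half-[r+1][3r+2] r)

ℬ-3r : ∀ r → ℬ (r ℕ.* 3) ≡ cstᴸ (sgn r) ⊗ᴸ (cstᴸ 1ℤ ⊕ᴸ monoᴸ (+ (2 ℕ.* r))) ⊗ᴸ monoᴸ (pentagonal r ℤ.⊖ (2 ℕ.* r))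
ℬ-3r r with (r ℕ.* 3) ℕ.% 3 | %3 0 r 0<3
... | _ | ≡.refl with (r ℕ.* 3) ℕ./ 3 | /3 0 r 0<3
... | _ | ≡.refl = ≡.cong (λ z → cstᴸ (sgn r) ⊗ᴸ (cstᴸ 1ℤ ⊕ᴸ monoᴸ (+ (2 ℕ.* r))) ⊗ᴸ monoᴸ z) (half-3r-5 r)

ℬ-3r+1 : ∀ r → ℬ (1 ℕ.+ r ℕ.* 3) ≡ cstᴸ (sgn r) ⊗ᴸ monoᴸ (+ (pentagonal r ℕ.+ r))
ℬ-3r+1 r with (1 ℕ.+ r ℕ.* 3) ℕ.% 3 | %3 1 r 1<3
... | _ | ≡.refl with (1 ℕ.+ r ℕ.* 3) ℕ./ 3 | /3 1 r 1<3
... | _ | ≡.refl = ≡.cong (λ z → cstᴸ (sgn r) ⊗ᴸ monoᴸ z) (half-3r+1 r)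

ℬ-3r+2 : ∀ r → ℬ (2 ℕ.+ r ℕ.* 3) ≡ cstᴸ (ℤ.- sgn r) ⊗ᴸ monoᴸ (pentagonal r ℤ.⊖ 1)
ℬ-3r+2 r with (2 ℕ.+ r ℕ.* 3) ℕ.% 3 | %3 2 r 2<3
... | _ | ≡.refl with (2 ℕ.+ r ℕ.* 3) ℕ./ 3 | /3 2 r 2<3
... | _ | ≡.refl = ≡.cong (λ z → cstᴸ (ℤ.- sgn r) ⊗ᴸ monoᴸ z) (half-[r-1][3r+2] r)

-- The summands of τ₀.

half-tri : ∀ k → (k ℕ.* (k ∸ 1)) ℕ./ 2 ≡ tri k
half-tri k = ≡.trans (≡.cong (ℕ._/ 2) (≡.sym (tri*2 k))) (ℕ.m*n/n≡m (tri k) 2)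

-- A nameable copy of the summand local to `τ₀`; the two agree by unfolding, on which `τ₀≡sum`
-- relies.
τTerm : ℕ → ℕ → ℕ → Poly
τTerm N M k = scale (sgn k) (shiftP (N ℕ.* k ∸ (k ℕ.* (k ∸ 1)) ℕ./ 2)
  (qbinom (+ N) (+ k) ⊗ qbinom (+ (2 ℕ.* N ∸ 2 ℕ.* k)) (+ N ℤ.- + M ℤ.- + k)))

module _ (c n : ℕ) where
  private
    N M : ℕ
    N = suc c ℕ.* n
    M = c ℕ.* n

  lower-index : ∀ k → + N ℤ.- + M ℤ.- + k ≡ n ℤ.⊖ k
  lower-index k = ≡.trans (≡.cong (ℤ._- + k) N-M) (ℤ.m-n≡m⊖n n k)
    where
    N-M : + N ℤ.- + M ≡ + n
    N-M = ≡.trans (ℤ.m-n≡m⊖n N M) (≡.trans (ℤ.⊖-≥ (ℕ.m≤n+m M n)) (≡.cong +_ (ℕ.m+n∸n≡m n M)))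

  τTerm-≤ : ∀ k → k ≤ n → τTerm N M k ≡
    scale (sgn k) (shiftP (N ℕ.* k ∸ tri k) (qbinom (+ N) (+ k) ⊗ qbinom (+ (2 ℕ.* N ∸ 2 ℕ.* k)) (+ (n ∸ k))))
  τTerm-≤ k k≤n = ≡.cong₂ (λ t z → scale (sgn k) (shiftP (N ℕ.* k ∸ t) (qbinom (+ N) (+ k) ⊗ qbinom (+ (2 ℕ.* N ∸ 2 ℕ.* k)) z)))
    (half-tri k) (≡.trans (lower-index k) (ℤ.⊖-≥ k≤n))

  -- The lower index n - k is negative, where `qbinom` is zero by definition.
  τTerm-> : ∀ k → n < k → τTerm N M k ≐ []
  τTerm-> k n<k = ≐-trans (by-≡ (≡.cong (λ x → scale (sgn k) (shiftP e (qbinom (+ N) (+ k) ⊗ x))) (vanishes n<k)))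
    (≐-trans (scale-cong (sgn k) (≐-trans (shiftP≐ e _) (⊗-congˡ (q ^ e) (⊗-zeroʳ (qbinom (+ N) (+ k))))))
    (scale-cong (sgn k) (⊗-zeroʳ (q ^ e))))
    where
    open GaussianBinomials ℤ[q] ℤ⟶ℤ[q] q using (_^_)
    e = N ℕ.* k ∸ (k ℕ.* (k ∸ 1)) ℕ./ 2
    by-≡ : ∀ {p r} → p ≡ r → p ≐ r
    by-≡ ≡.refl = ≐-refl
    vanishes : n < k → qbinom (+ (2 ℕ.* N ∸ 2 ℕ.* k)) (+ N ℤ.- + M ℤ.- + k) ≡ []
    vanishes n<k with k ∸ n | ≡.trans (lower-index k) (ℤ.⊖-< n<k) | ℕ.m<n⇒0<n∸m n<k
    ... | suc d | eq | _ = ≡.cong (qbinom (+ (2 ℕ.* N ∸ 2 ℕ.* k))) eq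

-- Passage to ℤ[q] modulo Φ_n².

module ModuloΦ² (n′ : ℕ) where
  open Cyclotomic (Φ-cyclotomic n′)
  open Divisibility ℤ[q] ℤ⟶ℤ[q] q using (_∣_; divides-by)
  module Z = GaussianBinomials ℤ[q] ℤ⟶ℤ[q] q
  φ = Φ (suc n′)
  open Quotient ℤ[q] ℤ⟶ℤ[q] (φ ⊗ φ) public renaming (R/P to ℤ[q]/Φ²; ℤ⟶R/P to ℤ⟶ℤ[q]/Φ²; ≈⇒∼ to ≐⇒∼)
  module Q = GaussianBinomials ℤ[q]/Φ² ℤ⟶ℤ[q]/Φ² q
  open CommutativeRing ℤ[q]/Φ² public using () renaming
    (refl to ∼-refl; sym to ∼-sym; trans to ∼-trans; reflexive to ∼-reflexive; *-cong to ⊗-cong-∼; +-cong to ⊕-cong-∼; -‿cong to neg-cong-∼)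

  -- Both rings have the same operations on the same lists, so powers and binomials coincide even
  -- propositionally, and facts from ℤ[q] transfer by substitution.
  ^-quotient : ∀ k → q Q.^ k ≡ q Z.^ k
  ^-quotient zero = ≡.refl
  ^-quotient (suc k) = ≡.cong (q ⊗_) (^-quotient k)

  gb-quotient : ∀ n k → Q.gb n k ≡ Z.gb n k
  gb-quotient n zero = ≡.refl
  gb-quotient zero (suc k) = ≡.refl
  gb-quotient (suc n) (suc k) = ≡.cong₂ _⊕_ (gb-quotient n k) (≡.cong₂ _⊗_ (^-quotient (suc k)) (gb-quotient n (suc k)))

  1−q^-quotient : ∀ k → Q.1−q^ k ≡ Z.1−q^ k
  1−q^-quotient k = ≡.cong (λ x → cst 1ℤ ⊖ x) (^-quotient k)

  e²∼0 : Q.1−q^ (suc n′) ⊗ Q.1−q^ (suc n′) ∼ []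
  e²∼0 = ≡.subst (λ y → y ⊗ y ∼ []) (≡.sym (1−q^-quotient (suc n′)))
    (congruent (c ⊗ c) (≐-trans
    (Z.solve 2 (λ c f → (c Z.:* c) Z.:* (f Z.:* f) Z.:= (c Z.:* f) Z.:* (c Z.:* f)) ≐-refl c φ)
    (≐-trans (≐-trans (⊗-congʳ (c ⊗ φ) cφ) (⊗-congˡ y cφ)) (≐-sym (⊕-identityʳ (y ⊗ y))))))
    where
    open _∣_ Φ∣1−q^ renaming (quotient to c; equality to cφ)
    y = Z.1−q^ (suc n′)

  -- `coprime` concerns φ and not its square, so it is applied twice: (1 - q^k) x = C φ² yields x =
  -- y φ, the monic φ is cancelled, and (1 - q^k) y = C φ yields φ ∣ y.
  regular-∼ : ∀ k → 0 < k → k < suc n′ → ∀ x → Q.1−q^ k ⊗ x ∼ [] → x ∼ []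
  regular-∼ (suc k) _ (s≤s k<n′) x x∼0 = congruent w
    (≐-trans (≐-sym (⊗-assoc w φ φ)) (≐-trans (⊗-congʳ φ wφ) (≐-trans yφ (≐-sym (⊕-identityʳ x)))))
    where
    Y = Z.1−q^ (suc k)
    open _∼_ (≡.subst (λ z → z ⊗ x ∼ []) (1−q^-quotient (suc k)) x∼0) renaming (quotient to C; equality to Cφ²)
    Cφφ : (C ⊗ φ) ⊗ φ ≐ Y ⊗ x
    Cφφ = ≐-trans (⊗-assoc C φ φ) (≐-trans Cφ² (⊕-identityʳ (Y ⊗ x)))
    open _∣_ (coprime k k<n′ x (divides-by (C ⊗ φ) Cφφ)) renaming (quotient to y; equality to yφ)
    Cφ : C ⊗ φ ≐ Y ⊗ y
    Cφ = monic-cancel Φ-monic (C ⊗ φ) (Y ⊗ y) (≐-trans Cφφ (≐-trans (⊗-congˡ Y (≐-sym yφ)) (≐-sym (⊗-assoc Y y φ))))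
    open _∣_ (coprime k k<n′ y (divides-by C Cφ)) renaming (quotient to w; equality to wφ)

  p : Poly
  p = q Q.^ n′ ⊗ (cst 1ℤ ⊕ Q.1−q^ (suc n′))

  pq∼1 : p ⊗ q ∼ cst 1ℤ
  pq∼1 = Laurent.inverse ℤ[q]/Φ² ℤ⟶ℤ[q]/Φ² q p n′ e²∼0

  open RootOfUnity ℤ[q]/Φ² ℤ⟶ℤ[q]/Φ² q p public using
    ( _^_; gb; 1−q^; sum; sum-cong; sum-split; sum-zero; term; sum-terms
    ; lucasSumA; lucasSumA-3r; lucasSumA-3r+1; lucasSumA-3r+2
    ; lucasSumB; lucasSumB-3r; lucasSumB-3r+1; lucasSumB-3r+2 )
  module L = Laurent ℤ[q]/Φ² ℤ⟶ℤ[q]/Φ² q p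

  shiftP∼ : ∀ k x → shiftP k x ∼ q ^ k ⊗ x
  shiftP∼ k x = ≡.subst (λ y → shiftP k x ∼ y ⊗ x) (≡.sym (^-quotient k)) (≐⇒∼ (shiftP≐ k x))

  X^∼ : ∀ k → X^ k ∼ q ^ k
  X^∼ k = ≡.subst (X^ k ∼_) (≡.sym (^-quotient k)) (≐⇒∼ (X^≐ k))

  -- (s , a) stands for q^(-s) a, and q^(-s) exists modulo Φ²
  infix 4 _⇓_
  record _⇓_ (x : LPoly) (a : Poly) : Set where
    constructor evaluates
    field value : p ^ proj₁ x ⊗ proj₂ x ∼ a
  open _⇓_

  ⇓-lift : ∀ {a b} → a ∼ b → lift a ⇓ b
  ⇓-lift {a} a∼b = evaluates (∼-trans (≐⇒∼ (⊗-identityˡ a)) a∼b)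

  ⇓-cst : ∀ c → cstᴸ c ⇓ cst c
  ⇓-cst c = ⇓-lift ∼-refl

  ⇓-cong : ∀ {x a b} → a ∼ b → x ⇓ a → x ⇓ b
  ⇓-cong a∼b (evaluates e) = evaluates (∼-trans e a∼b)

  ⇓-⊕ : ∀ {x y a b} → x ⇓ a → y ⇓ b → x ⊕ᴸ y ⇓ a ⊕ b
  ⇓-⊕ {s , u} {t , v} (evaluates e) (evaluates f) =
    evaluates (∼-trans (L.laurent-+ pq∼1 shiftP shiftP∼ s t u v) (⊕-cong-∼ e f))

  ⇓-⊗ : ∀ {x y a b} → x ⇓ a → y ⇓ b → x ⊗ᴸ y ⇓ a ⊗ b
  ⇓-⊗ {s , u} {t , v} (evaluates e) (evaluates f) =
    evaluates (∼-trans (L.laurent-* pq∼1 shiftP shiftP∼ s t u v) (⊗-cong-∼ e f))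

  ⇓-⊖ : ∀ {x y a b} → x ⇓ a → y ⇓ b → x ⊖ᴸ y ⇓ a ⊖ b
  ⇓-⊖ {y = t , v} e (evaluates f) = ⇓-⊕ e (evaluates (∼-trans
    (≐⇒∼ (Z.solve 2 (λ x v → x Z.:* (Z.:- v) Z.:= Z.:- (x Z.:* v)) ≐-refl (p ^ t) v)) (neg-cong-∼ f)))

  ⇓-mono : ∀ {z} k → z ≡ + k → monoᴸ z ⇓ q ^ k
  ⇓-mono k ≡.refl = ⇓-lift (X^∼ k)

  ⇓-mono-⊖ : ∀ {z} a b → z ≡ a ℤ.⊖ b → monoᴸ z ⇓ q ^ a ⊗ p ^ b
  ⇓-mono-⊖ a b ≡.refl = Sum.[ nonneg , negative ]′ (ℕ.≤-<-connex b a)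
    where
    nonneg : b ≤ a → monoᴸ (a ℤ.⊖ b) ⇓ q ^ a ⊗ p ^ b
    nonneg b≤a = ≡.subst (_⇓ q ^ a ⊗ p ^ b) (≡.cong monoᴸ (≡.sym (ℤ.⊖-≥ b≤a)))
      (⇓-cong (L.q^-∸ pq∼1 shiftP shiftP∼ b≤a) (⇓-lift (X^∼ (a ∸ b))))
    negative : a < b → monoᴸ (a ℤ.⊖ b) ⇓ q ^ a ⊗ p ^ b
    negative a<b = ≡.subst (_⇓ q ^ a ⊗ p ^ b) (≡.sym (monoᴸ-⊖-< a<b))
      (evaluates (∼-trans (≐⇒∼ (≐-trans (⊗-comm (p ^ (b ∸ a)) (cst 1ℤ)) (⊗-identityˡ (p ^ (b ∸ a)))))
        (L.p^-∸ pq∼1 shiftP shiftP∼ (ℕ.<⇒≤ a<b))))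

  ⇓-congruent : ∀ {x y a} → x ⇓ a → y ⇓ a → x ≡ y [modₚ φ ⊗ φ ]
  ⇓-congruent {s , u} {t , v} (evaluates e) (evaluates f) = _∼_.quotient x∼y , _∼_.equality x∼y .at
    where
    x∼y : shiftP t u ∼ shiftP s v
    x∼y = L.laurent-injective pq∼1 shiftP shiftP∼ s t u v (∼-trans e (∼-sym f))

  -- The view is of k = n - 1 while the formulas are those of n, so the residues shift: k = 3r + 2
  -- belongs to n = 3(r+1).
  𝒜⇓ : ∀ {k} → Thirds k → 𝒜 (suc k) ⇓ lucasSumA k
  𝒜⇓ (3r+2 r) = ≡.subst (_⇓ lucasSumA (2 ℕ.+ r ℕ.* 3)) (≡.sym (𝒜-3r (suc r))) (⇓-cong (∼-sym (lucasSumA-3r r))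
    (⇓-⊗ (⇓-⊗ (⇓-cst (sgn (suc r))) (⇓-⊕ (⇓-cst 1ℤ) (⇓-mono (suc r) ≡.refl))) (⇓-mono (pentagonal (suc r)) ≡.refl)))
  𝒜⇓ (3r r) = ≡.subst (_⇓ lucasSumA (r ℕ.* 3)) (≡.sym (𝒜-3r+1 r)) (⇓-cong (∼-sym (lucasSumA-3r+1 r))
    (⇓-⊗ (⇓-cst (sgn r)) (⇓-mono (pentagonal r ℕ.+ r) ≡.refl)))
  𝒜⇓ (3r+1 r) = ≡.subst (_⇓ lucasSumA (1 ℕ.+ r ℕ.* 3)) (≡.sym (𝒜-3r+2 r)) (⇓-cong (∼-sym (lucasSumA-3r+2 r))
    (⇓-⊗ (⇓-cst (ℤ.- sgn r)) (⇓-mono (suc (r ℕ.* 3) ℕ.+ pentagonal r) ≡.refl)))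

  ℬ⇓ : ∀ {k} → Thirds k → ℬ (suc k) ⇓ lucasSumB p k
  ℬ⇓ (3r+2 r) = ≡.subst (_⇓ lucasSumB p (2 ℕ.+ r ℕ.* 3)) (≡.sym (ℬ-3r (suc r))) (⇓-cong (∼-sym (lucasSumB-3r {p} pq∼1 r))
    (⇓-⊗ (⇓-⊗ (⇓-cst (sgn (suc r))) (⇓-⊕ (⇓-cst 1ℤ) (⇓-mono (2 ℕ.* suc r) ≡.refl))) (⇓-mono-⊖ (pentagonal (suc r)) (2 ℕ.* suc r) ≡.refl)))
  ℬ⇓ (3r r) = ≡.subst (_⇓ lucasSumB p (r ℕ.* 3)) (≡.sym (ℬ-3r+1 r)) (⇓-cong (∼-sym (lucasSumB-3r+1 {p} pq∼1 r))
    (⇓-⊗ (⇓-cst (sgn r)) (⇓-mono (pentagonal r ℕ.+ r) ≡.refl)))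
  ℬ⇓ (3r+1 r) = ≡.subst (_⇓ lucasSumB p (1 ℕ.+ r ℕ.* 3)) (≡.sym (ℬ-3r+2 r)) (⇓-cong (∼-sym (lucasSumB-3r+2 {p} pq∼1 r))
    (⇓-⊗ (⇓-cst (ℤ.- sgn r)) (⇓-mono-⊖ (pentagonal r) 1 ≡.refl)))

  n : ℕ
  n = suc n′

  sumP≡sum : ∀ (f : ℕ → Poly) k → sumP (map f (upTo k)) ≡ sum k f
  sumP≡sum f k = ≡.trans (≡.cong sumP (map-upTo f k)) (go f k)
    where
    go : ∀ f k → sumP (applyUpTo f k) ≡ sum k f
    go f zero = ≡.refl
    go f (suc k) = ≡.cong (f 0 ⊕_) (go (f ∘ suc) k)

  τ₀≡sum : ∀ N M → τ₀ N M ≡ sum (suc N) (τTerm N M)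
  τ₀≡sum N M = sumP≡sum (τTerm N M) (suc N)

  qbinom∼gb : ∀ a b → qbinom (+ a) (+ b) ∼ gb a b
  qbinom∼gb a b = ≡.subst (qbinomℕ a b ∼_) (≡.sym (gb-quotient a b)) (≐⇒∼ (ExactBinomials.qbinomℕ≐gb a b))

  module _ (c : ℕ) where
    N M : ℕ
    N = suc c ℕ.* n
    M = c ℕ.* n

    scale∼ : ∀ a x → scale a x ∼ cst a ⊗ x
    scale∼ a x = ≐⇒∼ (≐-sym (cst-⊗ a x))

    τTerm∼ : ∀ k → k < suc n → τTerm N M k ∼ term pq∼1 n′ e²∼0 regular-∼ (suc c) k
    τTerm∼ k (s≤s k≤n) = ∼-trans (∼-reflexive (τTerm-≤ c n k k≤n))
      (∼-trans (scale∼ (sgn k) _) (∼-trans (⊗-cong-∼ (∼-refl {cst (sgn k)}) (∼-trans (shiftP∼ (N ℕ.* k ∸ tri k) _)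
        (⊗-cong-∼ (L.q^-∸ pq∼1 shiftP shiftP∼ tri≤) (⊗-cong-∼ (qbinom∼gb N k) (qbinom∼gb (2 ℕ.* N ∸ 2 ℕ.* k) (n ∸ k))))))
        (≐⇒∼ (≐-sym (⊗-assoc (cst (sgn k)) (q ^ (N ℕ.* k) ⊗ p ^ tri k) (gb N k ⊗ gb (2 ℕ.* N ∸ 2 ℕ.* k) (n ∸ k)))))))
      where
      tri≤ : tri k ≤ N ℕ.* k
      tri≤ = ℕ.≤-trans (ℕ.m≤m+n (tri k) (tri (suc k))) (≡.subst (_≤ N ℕ.* k) (≡.sym (tri+tri k)) (ℕ.*-monoˡ-≤ k (ℕ.≤-trans k≤n (ℕ.m≤m+n n M))))

    -- `suc N` unfolds to `suc n ℕ.+ M`, so the sum splits after k = n, and the remaining M terms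
    -- vanish.
    τ₀∼ : τ₀ N M ∼ sum (suc n) (term pq∼1 n′ e²∼0 regular-∼ (suc c))
    τ₀∼ = ∼-trans (∼-reflexive (τ₀≡sum N M)) (∼-trans (sum-split (suc n) M (τTerm N M))
      (∼-trans (⊕-cong-∼ (sum-cong (suc n) τTerm∼) (sum-zero M (λ i _ → ≐⇒∼ (τTerm-> c n (suc n ℕ.+ i) (s≤s (ℕ.m≤m+n n i))))))
      (≐⇒∼ (⊕-identityʳ _))))

    -- With m = c + 1, m(2m-1) is C(2m,2), the coefficient that comes from [2mn, n].
    coefficient₁ : n ℕ.* suc c ℕ.* (2 ℕ.* suc c ∸ 1) ≡ n ℕ.* tri (2 ℕ.* suc c)
    coefficient₁ = ≡.trans (ℕ.*-assoc n (suc c) _) (≡.cong (n ℕ.*_) (ℕ.*-cancelʳ-≡ _ _ 2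
      (≡.trans (solve 2 (λ c x → c :* x :* con 2 := con 2 :* c :* x) ≡.refl (suc c) (2 ℕ.* suc c ∸ 1)) (≡.sym (tri*2 (2 ℕ.* suc c))))))
      where open ℕ.+-*-Solver

    coefficient₂ : (3 ℕ.* n ℕ.* suc c ℕ.* c) ℕ./ 2 ≡ 3 ℕ.* n ℕ.* tri (suc c)
    coefficient₂ = ≡.trans (≡.cong (ℕ._/ 2) (≡.trans (ℕ.*-assoc (3 ℕ.* n) (suc c) c) (≡.trans (≡.cong (3 ℕ.* n ℕ.*_) (≡.sym (tri*2 (suc c)))) (≡.sym (ℕ.*-assoc (3 ℕ.* n) (tri (suc c)) 2)))))
      (ℕ.m*n/n≡m (3 ℕ.* n ℕ.* tri (suc c)) 2)

    exponent : (n ℕ.* (n ℕ.+ 1)) ℕ./ 2 ≡ tri (suc n)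
    exponent = ≡.trans (≡.cong (ℕ._/ 2) (≡.trans (≡.cong (n ℕ.*_) (ℕ.+-comm n 1)) (ℕ.*-comm n (suc n)))) (half-tri (suc n))

    oneMinus⇓ : cstᴸ 1ℤ ⊖ᴸ monoᴸ (+ n) ⇓ 1−q^ n
    oneMinus⇓ = ⇓-⊖ (⇓-cst 1ℤ) (⇓-mono n ≡.refl)

    cst⇓ : ∀ {a b} → a ≡ b → cstᴸ (+ a) ⇓ cst (+ b)
    cst⇓ ≡.refl = ⇓-cst _

    RHS⇓ : RHS (suc c) n ⇓ sum (suc n) (term pq∼1 n′ e²∼0 regular-∼ (suc c))
    RHS⇓ = ⇓-cong (∼-sym (sum-terms pq∼1 n′ e²∼0 regular-∼ c))
      (⇓-⊕ (⇓-⊖ (⇓-cst (+ (2 ℕ.* suc c))) (⇓-⊗ (cst⇓ coefficient₁) oneMinus⇓))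
           (⇓-⊗ (⇓-⊗ (⇓-cst (sgn n)) (⇓-mono (tri (suc n)) (≡.cong +_ exponent)))
                (⇓-⊖ (⇓-⊗ (⇓-cst (+ suc c)) (⇓-⊖ (⇓-⊕ (𝒜⇓ (thirds n′)) (ℬ⇓ (thirds n′))) (⇓-cst 1ℤ)))
                     (⇓-⊗ (cst⇓ coefficient₂) oneMinus⇓))))

    τ₀≡RHS : lift (τ₀ N M) ≡ RHS (suc c) n [modₚ φ ⊗ φ ]
    τ₀≡RHS = ⇓-congruent (⇓-lift τ₀∼) RHS⇓

open import Data.Nat using (_*_)

theorem1p1 : (m n : ℕ) → 1 ≤ m → 1 ≤ n →
    lift (τ₀ (m * n) ((m ∸ 1) * n)) ≡ RHS m n [modₚ Φ n ⊗ Φ n ]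
theorem1p1 (suc c) (suc n′) _ _ = ModuloΦ².τ₀≡RHS n′ c
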